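{- Let $u\in S_n$ and $\mu=\max\{i:c_i(u)>0\}$. Then the encoding map $\varphi_u$ described below is a bijection $\mathrm{PD}(u)\to\Phi_u$ which is weight-preserving: $\mathrm{wt}_u(\varphi_u(D))=\mathrm{wt}(D)$ for all $D\in\mathrm{PD}(u)$.
   Context: Pipe dreams: $\Delta_n=\{(i,j)\in[n]^2:i+j\le n+1\}$ (row $i$, column $j$). For $D\subseteq\Delta_n$, put crosses at positions of $D$ and elbows elsewhere. Label the pipes entering the top $1,\dots,n$ from left to right. $D$ is a pipe dream for $u\in S_n$ if no two pipes cross twice and the labels of pipes exiting the left edge, read top to bottom, give $u$. $\mathrm{PD}(u)$ is the set of such $D$, and $\mathrm{wt}(D)$ is the sequence of numbers of crosses in rows $1,2,\dots$. The code of $u$ is $(c_1(u),c_2(u),\dots)$ with $c_i(u)=|\{j>i:u(j)<u(i)\}|$. Inverse ladder move $L^{ -1}_{r,s}$: defined on $D$ when $(r,s)\in D$, $(r,s-1)\notin D$, and for some $m\ge1$ we have $(r+k',s-1),(r+k',s)\in D$ for $1\le k'<m$ and $(r+m,s-1),(r+m,s)\notin D$. Then $L^{ -1}_{r,s}(D)=(D\setminus\{(r,s)\})\cup\{(r+m,s-1)\}$. Encoding $\varphi_u$. Repeat the following round. Choose $i$ maximal such that some $j$ has $(i,j)\notin D$, $(i,j+1)\in D$; if none exists, stop. Choose $j$ maximal with this property, and $k>j$ minimal with $(i,k+1)\notin D$. Apply $L^{ -1}_{i,j+1},\dots,L^{ -1}_{i,k}$ in order; this moves the patch of crosses in columns $j+1,\dots,k$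 of row $i$ down by a common number of rows. A moved patch is moved again in later rounds until left-aligned. Let $\mathcal L_\mu=\{(i,k_1,\dots,k_\ell)\in\mathbb N_{\ge1}^{\ell+1}:\ell\ge1,\ |\mathbf i|:=i+k_1+\dots+k_\ell\le\mu\}$ and $\Phi_\mu=\mathbb N^{\mathcal L_\mu}$. Define $\varphi_u(D)=x$, where $x_{(i,k_1,\dots,k_\ell)}$ is the number of crosses in the patch starting in row $i$ of $D$ that is moved down successively $k_1,\dots,k_\ell$ rows until left-aligned; all other entries are $0$. $u$-weight of $x\in\Phi_\mu$: $\mathrm{wt}_u(x)_j=c_j(u)-\sum_{|\mathbf i|=j}x_{\mathbf i}+\sum_{\mathbf i=(j,\dots)}x_{\mathbf i}$. Ladder order: $(i,k_1,\dots,k_\ell)\prec(i',k'_1,\dots,k'_{\ell'})$ if (a) $i>i'$; or (b) $i=i'$ and for some $0\le t<\min(\ell,\ell')$, $k_s=k'_s$ for $s\le t$ and $k_{t+1}<k'_{t+1}$; or (c) $i=i'$, $\ell>\ell'$ and $k_s=k'_s$ for $s\le\ell'$. Compatible sequences. Fix $\varkappa\subseteq\mathcal L_\mu$. For $\mathbf i\in\varkappa$, $x\in\Phi_\mu$ and $i<j\le|\mathbf i|$, set $c^{\mathbf i}_j(x)=c_j(u)-\sum_{\mathbf i'\in\varkappa,\ \mathbf i\prec\mathbf i',\ |\mathbf i'|=j}x_{\mathbf i'}$. Let $\varkappa^{\mathbf i}=\{\mathbf i'\in\varkappa:\mathbf i\prec\mathbf i',\ i'=i\}$. If $\varkappa^{\mathbf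 i}=\varnothing$, set $c^{\mathbf i}_i(x)=c_i(u)-\sum_{\mathbf i'\in\varkappa,\ \mathbf i\prec\mathbf i',\ |\mathbf i'|=i}x_{\mathbf i'}$. Otherwise, let $\mathbf i'=(i,k'_1,\dots,k'_{\ell'})$ be the $\prec$-minimal element of $\varkappa^{\mathbf i}$ and set $c^{\mathbf i}_i(x)=c^{\mathbf i}_{|\mathbf i'|}(x)+x_{\mathbf i'}+\ell'$. $\Phi_{\varkappa,u}$ is the set of $x\in\Phi_\mu$ such that: (1) $\mathbf i\in\varkappa$ iff $x_{\mathbf i}\ne0$; (2) $\sum_{\mathbf i\in\varkappa,\ |\mathbf i|=j}x_{\mathbf i}\le c_j(u)$ for all $j\in[\mu]$; (3) for all $\mathbf i=(i,k_1,\dots,k_\ell)\in\varkappa$, $p\in[\ell]$, $q\in[k_p]$: if $q=k_p$, then $c^{\mathbf i}_{i+k_1+\dots+k_{p-1}}(x)\le c^{\mathbf i}_{|\mathbf i|}(x)-x_{\mathbf i}+\ell-p$; if $q\ne k_p$, then $c^{\mathbf i}_{i+k_1+\dots+k_{p-1}+q}(x)\ge c^{\mathbf i}_{|\mathbf i|}(x)+\ell-p+1$. $\Phi_u=\bigcup_{\varkappa\subseteq\mathcal L_\mu}\Phi_{\varkappa,u}$. -}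

module Defs where

open import Data.Nat as ℕ using (ℕ; zero; suc; _+_; _*_; _∸_; _≤_; _<_; _⊔_; _<ᵇ_; _≡ᵇ_; _≤?_; _<?_)
open import Data.Bool using (Bool; true; false; T; if_then_else_; _∧_; _∨_; not)
open import Data.List as L using (List; []; _∷_; _++_; length; map; concatMap; upTo; foldr; filter)
open import Data.Nat.ListAction using (sum)
open import Data.Bool.ListAction using (any)
open import Data.List.Relation.Unary.All as All using (All)
open import Data.List.Membership.Propositional using (_∈_)
open import Data.Maybe using (Maybe; just; nothing; _>>=_)
open import Data.Product using (Σ; _×_; _,_; proj₁; proj₂)
open import Data.Fin as F using (Fin; toℕ; fromℕ<)
open import Data.Fin.Permutation using (Permutation′; _⟨$⟩ʳ_)
open import Data.Vec as V using (Vec)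
open import Data.Integer as ℤ using (ℤ; +_)
open import Relation.Binary.PropositionalEquality using (_≡_; _≢_)
open import Relation.Nullary using (Dec; yes; no; ¬_)
open import Relation.Nullary.Decidable using (_×-dec_)

-- Basic conventions: all rows / columns / positions are 1-based naturals.

Pos : Set
Pos = ℕ × ℕ

range : ℕ → List ℕ
range n = map suc (upTo n)

count : ∀ {A : Set} → (A → Bool) → List A → ℕ
count p xs = length (L.filterᵇ p xs)

-- code u i = c_i(u) = |{ j > i : u(j) < u(i) }|  (1-based i; 0 outside [n])
codeF : ∀ {n} → Permutation′ n → Fin n → ℕ
codeF {n} u i = count (λ j → (toℕ i <ᵇ toℕ j) ∧ (toℕ (u ⟨$⟩ʳ j) <ᵇ toℕ (u ⟨$⟩ʳ i))) (L.allFin n)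

code : ∀ {n} → Permutation′ n → ℕ → ℕ
code u zero = 0
code {n} u (suc k) with k <? n
... | yes p = codeF u (fromℕ< p)
... | no _  = 0

-- μ = max { i : c_i(u) > 0 }  (taken to be 0 if u is the identity)
μ : ∀ {n} → Permutation′ n → ℕ
μ {n} u = foldr _⊔_ 0 (map (λ i → if 0 <ᵇ code u i then i else 0) (range n))

-- Subsets D of the n×n grid (row-major Boolean matrix); T (cell D r c)
-- means (r,c) ∈ D.

Grid : ℕ → Set
Grid n = Vec (Vec Bool n) n

at : ∀ {A : Set} {m} → A → Vec A m → ℕ → A
at d V.[] _ = d
at d (x V.∷ xs) zero = x
at d (x V.∷ xs) (suc k) = at d xs k

cell : ∀ {n} → Grid n → ℕ → ℕ → Bool
cell D zero _ = false
cell D (suc r) zero = false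
cell {n} D (suc r) (suc c) = at false (at (V.replicate n false) D r) c

InΔ : ∀ {n} → Grid n → Set
InΔ {n} D = ∀ r c → T (cell D r c) → r + c ≤ suc n

crossList : ∀ {n} → Grid n → List Pos
crossList {n} D = concatMap (λ r → map (λ c → (r , c)) (L.filterᵇ (cell D r) (range n))) (range n)

wt : ∀ {n} → Grid n → ℕ → ℕ
wt {n} D r = count (cell D r) (range n)

-- Pipes.  Crosses at positions of D, elbows elsewhere in Δ_n.
-- An elbow joins top↔left and right↔bottom; a cross lets pipes go straight.
-- A pipe is traced from the top of column j; the result is the row at which
-- it exits the left edge together with the list of crosses it passes through
-- (nothing if it leaves Δ_n any other way or the fuel runs out).

data Dir : Set where
  down left : Dir

trace : ∀ {n} → Grid n → (fuel r c : ℕ) → Dir → List Pos → Maybe (ℕ × List Pos)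
trace D zero r c d acc = nothing
trace D (suc f) r zero down acc = nothing
trace D (suc f) r zero left acc = just (r , acc)
trace {n} D (suc f) r (suc c) d acc with suc n <ᵇ r + suc c | cell D r (suc c) | d
... | true  | _     | _    = nothing
... | false | true  | down = trace D f (suc r) (suc c) down ((r , suc c) ∷ acc)
... | false | false | down = trace D f r c left acc
... | false | true  | left = trace D f r c left ((r , suc c) ∷ acc)
... | false | false | left = trace D f (suc r) (suc c) down acc

pipe : ∀ {n} → Grid n → ℕ → Maybe (ℕ × List Pos)
pipe {n} D j = trace D (suc (suc (n + n))) 1 j down []

posEq : Pos → Pos → Bool
posEq (a , b) (c , d) = (a ≡ᵇ c) ∧ (b ≡ᵇ d)

elemP : Pos → List Pos → Bool
elemP p = any (posEq p)

crossings : ∀ {n} → Grid n → ℕ → ℕ → ℕ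
crossings D a b with pipe D a | pipe D b
... | just (_ , ca) | just (_ , cb) = count (λ p → elemP p cb) ca
... | _ | _ = 0

record IsPipeDream {n} (u : Permutation′ n) (D : Grid n) : Set where
  field
    subsetΔ : InΔ D
    exits   : ∀ (i : Fin n) → Σ (List Pos) λ cs →
                pipe D (suc (toℕ (u ⟨$⟩ʳ i))) ≡ just (suc (toℕ i) , cs)
    reduced : ∀ (a b : Fin n) → a ≢ b → crossings D (suc (toℕ a)) (suc (toℕ b)) ≤ 1

-- Index set 𝓛_μ and Φ_μ = ℕ^{𝓛_μ}.  An index (i,k₁,…,k_ℓ) is (i , k₁ ∷ … ∷ k_ℓ ∷ []).

Index : Set
Index = ℕ × List ℕ

absI : Index → ℕ
absI (i , ks) = i + sum ks

InL : ℕ → Index → Set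
InL m (i , ks) = 1 ≤ i × 1 ≤ length ks × All (1 ≤_) ks × i + sum ks ≤ m

InL? : ∀ m e → Dec (InL m e)
InL? m (i , ks) = (1 ≤? i) ×-dec ((1 ≤? length ks) ×-dec (All.all? (1 ≤?_) ks ×-dec (i + sum ks ≤? m)))

seqs : ℕ → ℕ → List (List ℕ)
seqs zero m = [] ∷ []
seqs (suc ℓ) m = concatMap (λ k → map (k ∷_) (seqs ℓ m)) (range m)

Lenum : ℕ → List Index
Lenum m = filter (InL? m)
  (concatMap (λ i → concatMap (λ ℓ → map (λ ks → (i , ks)) (seqs ℓ m)) (range m)) (range m))

-- elements of Φ_μ are functions on indices; only their values on 𝓛_μ matter
Φ : Set
Φ = Index → ℕ

_≈[_]_ : Φ → ℕ → Φ → Set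
x ≈[ m ] y = ∀ e → InL m e → x e ≡ y e

sumWhere : (Index → Bool) → Φ → List Index → ℕ
sumWhere p x es = sum (map x (L.filterᵇ p es))

wtu : ∀ {n} → Permutation′ n → Φ → ℕ → ℤ
wtu u x j = (+ code u j ℤ.- + sumWhere (λ e → absI e ≡ᵇ j) x (Lenum (μ u)))
            ℤ.+ + sumWhere (λ e → proj₁ e ≡ᵇ j) x (Lenum (μ u))

precL : List ℕ → List ℕ → Bool
precL [] _ = false
precL (a ∷ r) [] = true
precL (a ∷ r) (b ∷ r') = if a <ᵇ b then true else (if a ≡ᵇ b then precL r r' else false)

prec : Index → Index → Bool
prec (i , ks) (i' , ks') = (i' <ᵇ i) ∨ ((i ≡ᵇ i') ∧ precL ks ks')

-- ≺-minimal element of a list (≺ is total on distinct indices)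
minPrec : List Index → Maybe Index
minPrec [] = nothing
minPrec (e ∷ es) with minPrec es
... | nothing = just e
... | just m  = if prec e m then just e else just m

cOther : ∀ {n} → Permutation′ n → List Index → Φ → Index → ℕ → ℤ
cOther u κ x 𝐢 j = + code u j ℤ.- + sumWhere (λ e → prec 𝐢 e ∧ (absI e ≡ᵇ j)) x κ

cc : ∀ {n} → Permutation′ n → List Index → Φ → Index → ℕ → ℤ
cc u κ x 𝐢 j with j ≡ᵇ proj₁ 𝐢
... | false = cOther u κ x 𝐢 j
... | true with minPrec (L.filterᵇ (λ e → prec 𝐢 e ∧ (proj₁ e ≡ᵇ proj₁ 𝐢)) κ)
...   | nothing = cOther u κ x 𝐢 j
...   | just e  = cOther u κ x 𝐢 (absI e) ℤ.+ + x e ℤ.+ + length (proj₂ e)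

record InΦκ {n} (u : Permutation′ n) (κ : List Index) (x : Φ) : Set where
  field
    cond1 : ∀ e → InL (μ u) e → (e ∈ κ → x e ≢ 0) × (x e ≢ 0 → e ∈ κ)
    cond2 : ∀ j → 1 ≤ j → j ≤ μ u → sumWhere (λ e → absI e ≡ᵇ j) x κ ≤ code u j
    cond3 : ∀ i ks → (i , ks) ∈ κ →
            ∀ pre k post → ks ≡ pre ++ k ∷ post →       -- p = length pre + 1, k = k_p, ℓ − p = length post
            ∀ q → 1 ≤ q → q ≤ k →
              (q ≡ k → cc u κ x (i , ks) (i + sum pre)
                         ℤ.≤ cc u κ x (i , ks) (absI (i , ks)) ℤ.- + x (i , ks) ℤ.+ + length post)
            × (q ≢ k → cc u κ x (i , ks) (i + sum pre + q)
                         ℤ.≥ cc u κ x (i , ks) (absI (i , ks)) ℤ.+ + length post ℤ.+ ℤ.1ℤ)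

-- ϰ ⊆ 𝓛_μ, represented as a duplicate-free list
open import Data.List.Relation.Unary.Unique.Propositional using (Unique)

InΦu : ∀ {n} → Permutation′ n → Φ → Set
InΦu u x = Σ (List Index) λ κ → Unique κ × All (InL (μ u)) κ × InΦκ u κ x

-- The encoding φ_u.  State: list of crosses, each tagged with the index
-- (origin row, successive downward moves) of the patch it belongs to.

State : Set
State = List (Pos × Index)

memS : State → Pos → Bool
memS st p = any (λ e → posEq (proj₁ e) p) st

maxPos : Pos → Maybe Pos → Maybe Pos
maxPos p nothing = just p
maxPos (a , b) (just (c , d)) =
  if (c <ᵇ a) ∨ ((a ≡ᵇ c) ∧ (d <ᵇ b)) then just (a , b) else just (c , d)

candidate : State → Maybe Pos
candidate st = foldr step nothing st
  where
    step : Pos × Index → Maybe Pos → Maybe Pos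
    step ((r , zero) , _) acc = acc
    step ((r , suc zero) , _) acc = acc
    step ((r , suc (suc c)) , _) acc =
      if memS st (r , suc c) then acc else maxPos (r , suc c) acc

findK : State → (fuel i k : ℕ) → Maybe ℕ
findK st zero i k = nothing
findK st (suc f) i k = if memS st (i , suc k) then findK st f i (suc k) else just k

findM : State → (fuel r s k' : ℕ) → Maybe ℕ
findM st zero r s k' = nothing
findM st (suc f) r s k' with memS st (r + k' , s ∸ 1) | memS st (r + k' , s)
... | true  | true  = findM st f r s (suc k')
... | false | false = just k'
... | _     | _     = nothing

extract : Pos → State → Maybe (Index × State)
extract p [] = nothing
extract p (e ∷ st) with posEq (proj₁ e) p
... | true = just (proj₂ e , st)
... | false with extract p st
...   | nothing = nothing
...   | just (t , st') = just (t , e ∷ st')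

ladderInv : ℕ → State → ℕ → ℕ → Maybe State
ladderInv fuel st r s with memS st (r , s) ∧ not (memS st (r , s ∸ 1))
... | false = nothing
... | true = findM st fuel r s 1 >>= λ m →
             extract (r , s) st >>= λ where
               ((o , ks) , st') → just (((r + m , s ∸ 1) , (o , ks ++ m ∷ [])) ∷ st')

applyAll : ℕ → State → ℕ → List ℕ → Maybe State
applyAll fuel st r [] = just st
applyAll fuel st r (s ∷ ss) = ladderInv fuel st r s >>= λ st' → applyAll fuel st' r ss

rounds : ℕ → ℕ → State → Maybe State
rounds n zero st = nothing
rounds n (suc f) st with candidate st
... | nothing = just st
... | just (i , j) =
  findK st (suc (suc n)) i (suc j) >>= λ k →
  applyAll (suc (suc n)) st i (map (λ t → j + suc t) (upTo (k ∸ j))) >>= λ st' →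
  rounds n f st'

indexEq : Index → Index → Bool
indexEq (i , ks) (i' , ks') = (i ≡ᵇ i') ∧ listEq ks ks'
  where
    listEq : List ℕ → List ℕ → Bool
    listEq [] [] = true
    listEq (a ∷ as) (b ∷ bs) = (a ≡ᵇ b) ∧ listEq as bs
    listEq _ _ = false

tally : State → Φ
tally st (i , []) = 0
tally st (i , ks) = count (λ e → indexEq (proj₂ e) (i , ks)) st

-- φ_u(D); nothing if the algorithm gets stuck (some move undefined)
encode : ∀ {n} → Grid n → Maybe Φ
encode {n} D =
  rounds n (suc (n * n * n)) (map (λ p → (p , (proj₁ p , []))) (crossList D)) >>= λ st →
  just (tally st)

{-# OPTIONS --safe #-}
module Submission where

-- A row whose crosses occupy columns 1,…,l acts on pipes by an explicit rule, so a left-aligned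
-- pipe dream is known from its row lengths, and these are the code of its permutation.  Process
-- the rows from the bottom up, keeping the rows below left-aligned.  A patch in columns j+1,…,j+m
-- with an elbow in column j can be exchanged for m more crosses at the end of the row where the
-- pipe through that elbow leaves: only the entry columns j,…,j+m are permuted, cyclically, and
-- this is consistent with reducedness exactly when that pipe leaves above the pipes j+1,…,j+m.
-- The turns of this pipe are the successive landings of the falling patch, so the inverse ladder
-- moves compute the exchange.  In terms of the lengths alone, a patch can fall along a given
-- index iff the rows it passes reach beyond it and the rows it lands in stop short of it, which
-- is condition (3).  The events of a run are ≺-increasing, hence the run can be undone from the
-- last event on, which gives the inverse map.

open import Defs
open import Data.Nat
open import Data.Nat.Properties
open import Data.Nat.ListAction using (sum)
open import Data.Nat.ListAction.Properties using (sum-↭; sum-++)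
open import Data.Bool using (Bool; true; false; T; if_then_else_; _∧_; _∨_)
open import Data.Bool.Properties using (∨-assoc; ∨-comm; ∨-zeroʳ; ∨-identityʳ; ∧-zeroʳ)
open import Data.Empty using (⊥; ⊥-elim)
open import Data.Fin as F using (Fin; toℕ; fromℕ<)
open import Data.Fin.Permutation using (Permutation′; _⟨$⟩ʳ_; _⟨$⟩ˡ_; inverseˡ; inverseʳ)
open import Data.Fin.Properties using (toℕ<n; toℕ-fromℕ<; fromℕ<-toℕ; toℕ-injective)
open import Data.List as L using (List; []; _∷_; _++_; length; map; concatMap; upTo; foldr; [_])
open import Data.List.Membership.Propositional using (_∈_)
open import Data.List.Membership.Propositional.Properties using (∈-∃++; ∈-++⁻; ∈-++⁺ˡ; ∈-++⁺ʳ; ∈-map⁺; ∈-map⁻; ∈-upTo⁺; ∈-concatMap⁺; ∈-concatMap⁻; ∈-filter⁺; ∈-filter⁻; ∈-allFin)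
open import Data.List.Properties using (++-assoc; ++-identityʳ; foldr-cong; upTo-∷ʳ; map-++; map-upTo; map-∘; map-id; map-cong-local; filter-++; length-++; length-map; length-upTo; length-tabulate; concatMap-++)
open import Data.List.Relation.Binary.Permutation.Propositional using (_↭_; ↭-refl; ↭-sym; ↭-trans; ↭-reflexive; prep; swap)
import Data.List.Relation.Binary.Permutation.Propositional as Perm
open import Data.List.Relation.Binary.Permutation.Propositional.Properties using (∈-resp-↭; drop-∷; map⁺; ↭-length; filter-↭; drop-mid; shifts; ↭-empty-inv) renaming (shift to ↭-shift)
open import Data.List.Relation.Unary.All as All using (All; []; _∷_)
import Data.List.Relation.Unary.All.Properties as AllP
open import Data.List.Relation.Unary.AllPairs as AllPairs using (AllPairs; []; _∷_)
open import Data.List.Relation.Unary.Any as Any using (Any; here; there; satisfied)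
open import Data.List.Relation.Unary.Unique.Propositional using (Unique)
import Data.List.Relation.Unary.Unique.Propositional.Properties as Uniq
open import Data.Maybe using (Maybe; just; nothing)
open import Data.Maybe.Properties using (just-injective)
open import Data.Product using (Σ; ∃-syntax; _×_; _,_; proj₁; proj₂)
open import Data.Sum using (_⊎_; inj₁; inj₂)
open import Data.Vec as V using (Vec)
open import Algebra.Properties.CommutativeMonoid.Sum +-0-commutativeMonoid using (sum-permute) renaming (sum to finSum)
open import Function using (_∘_; id)
open import Relation.Binary.Definitions using (tri<; tri≈; tri>)
open import Relation.Binary.PropositionalEquality hiding ([_])
open import Relation.Nullary using (yes; no; ¬_; contradiction)
open import Relation.Nullary.Decidable using (dec-true; dec-false)

-- Pipes through rows

-- The pivot is `Run`, the history of an encoding reduced to rows, lengths and events. It is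
-- compared separately with pipe dreams, with the executed algorithm and with compatible sequences,
-- so that no argument handles two of these at once.
--
-- The obstacle is that reducedness concerns pairs of whole pipes. It is traded for a condition at
-- single crosses: if the pipe that runs horizontally through a cross continues below that row, it
-- leaves above the pipe that runs vertically through it. This is necessary, since pipes leaving in
-- the other order would meet again. It is sufficient, since two pipes that have just met then leave
-- in the order of their columns, and such pipes do not meet. Taking away the rightmost patch of a
-- row does not affect the pipes further left, so the condition stays available for the crosses
-- still to be processed.
--
-- That the final lengths are the code is not tracked through the moves: each step keeps the exit
-- rows of all pipes, and left-aligned rows with equal exits have equal lengths.

Row : Set
Row = ℕ → Bool

-- The column where a pipe moving left through columns c, c-1, ... turns down; zero if it reaches
-- the left edge.
lastElbow : Row → ℕ → ℕ
lastElbow S zero = zero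
lastElbow S (suc c) = if S (suc c) then lastElbow S c else suc c

descend : Row → ℕ → ℕ
descend S zero = zero
descend S (suc c) = if S (suc c) then suc c else lastElbow S c

leftCrosses : ℕ → Row → ℕ → List Pos
leftCrosses r S zero = []
leftCrosses r S (suc c) = if S (suc c) then leftCrosses r S c ++ [ (r , suc c) ] else []

rowCrosses : ℕ → Row → ℕ → List Pos
rowCrosses r S zero = []
rowCrosses r S (suc c) = if S (suc c) then [ (r , suc c) ] else leftCrosses r S c

-- Pipe n R r c t cs: the pipe entering row r at the top of column c leaves at row t and
-- meets the crosses cs; zero as a value of descend means leaving through the left edge.
data Pipe (n : ℕ) (R : ℕ → Row) : ℕ → ℕ → ℕ → List Pos → Set where
  exit : ∀ {r c} → r + suc c ≤ suc n → descend (R r) (suc c) ≡ 0 →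
         Pipe n R r (suc c) r (rowCrosses r (R r) (suc c))
  step : ∀ {r c c′ t cs} → r + suc c ≤ suc n → descend (R r) (suc c) ≡ suc c′ →
         Pipe n R (suc r) (suc c′) t cs →
         Pipe n R r (suc c) t (cs ++ rowCrosses r (R r) (suc c))

data LeftPipe (n : ℕ) (R : ℕ → Row) : ℕ → ℕ → ℕ → List Pos → Set where
  exit : ∀ {r c} → lastElbow (R r) c ≡ 0 → LeftPipe n R r c r (leftCrosses r (R r) c)
  step : ∀ {r c c′ t cs} → lastElbow (R r) c ≡ suc c′ → Pipe n R (suc r) (suc c′) t cs →
         LeftPipe n R r c t (cs ++ leftCrosses r (R r) c)

≮ᵇ⇒≥ : ∀ a b → (a <ᵇ b) ≡ false → b ≤ a
≮ᵇ⇒≥ a b e = ≮⇒≥ (λ p → contradiction (trans (sym (dec-true (a <? b) p)) e) λ ())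

module _ {n : ℕ} (D : Grid n) where
  private
    R : ℕ → Row
    R = cell D

  turn : ∀ {r c t cs} → R r (suc c) ≡ false → r + suc c ≤ suc n →
         LeftPipe n R r c t cs → Pipe n R r (suc c) t cs
  turn {r} {c} e b (exit p) =
    subst (λ z → Pipe n R r (suc c) r z) (cong (λ z → if z then _ else leftCrosses r (R r) c) e)
      (exit b (trans (cong (λ z → if z then suc c else lastElbow (R r) c) e) p))
  turn {r} {c} {t} e b (step {cs = cs} p q) =
    subst (λ z → Pipe n R r (suc c) t (cs ++ z)) (cong (λ z → if z then _ else leftCrosses r (R r) c) e)
      (step b (trans (cong (λ z → if z then suc c else lastElbow (R r) c) e) p) q)

  straight : ∀ {r c t cs} → R r (suc c) ≡ true → r + suc c ≤ suc n →
         Pipe n R (suc r) (suc c) t cs → Pipe n R r (suc c) t (cs ++ [ (r , suc c) ])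
  straight {r} {c} {t} {cs} e b q =
    subst (λ z → Pipe n R r (suc c) t (cs ++ z)) (cong (λ z → if z then [ (r , suc c) ] else leftCrosses r (R r) c) e)
      (step b (cong (λ z → if z then suc c else lastElbow (R r) c) e) q)

  leftStop : ∀ {r c t cs} → R r (suc c) ≡ false →
         Pipe n R (suc r) (suc c) t cs → LeftPipe n R r (suc c) t cs
  leftStop {r} {c} {t} {cs} e q =
    subst (λ z → LeftPipe n R r (suc c) t z)
      (trans (cong (λ z → cs ++ (if z then leftCrosses r (R r) c ++ [ (r , suc c) ] else [])) e) (++-identityʳ cs))
      (step (cong (λ z → if z then lastElbow (R r) c else suc c) e) q)

  leftGo : ∀ {r c t cs} → R r (suc c) ≡ true →
         LeftPipe n R r c t cs → LeftPipe n R r (suc c) t (cs ++ [ (r , suc c) ])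
  leftGo {r} {c} e (exit p) =
    subst (λ z → LeftPipe n R r (suc c) r z)
      (cong (λ z → if z then leftCrosses r (R r) c ++ [ (r , suc c) ] else []) e)
      (exit (trans (cong (λ z → if z then lastElbow (R r) c else suc c) e) p))
  leftGo {r} {c} {t} e (step {cs = cs} p q) =
    subst (λ z → LeftPipe n R r (suc c) t z)
      (trans (cong (λ z → cs ++ (if z then leftCrosses r (R r) c ++ [ (r , suc c) ] else [])) e)
             (sym (++-assoc cs (leftCrosses r (R r) c) [ (r , suc c) ])))
      (step (trans (cong (λ z → if z then lastElbow (R r) c else suc c) e) p) q)

  trace⇒Pipe : ∀ f r c acc {t cs′} → trace D f r c down acc ≡ just (t , cs′) →
               ∃[ cs ] cs′ ≡ cs ++ acc × Pipe n R r c t cs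
  trace⇒LeftPipe : ∀ f r c acc {t cs′} → trace D f r c left acc ≡ just (t , cs′) →
               ∃[ cs ] cs′ ≡ cs ++ acc × LeftPipe n R r c t cs
  trace⇒Pipe (suc f) r (suc c) acc e with suc n <ᵇ r + suc c in e1 | cell D r (suc c) in e2
  ... | false | true with trace⇒Pipe f (suc r) (suc c) _ e
  ...   | cs , refl , p = _ , sym (++-assoc cs _ _) , straight e2 (≮ᵇ⇒≥ (suc n) _ e1) p
  trace⇒Pipe (suc f) r (suc c) acc e | false | false with trace⇒LeftPipe f r c _ e
  ...   | cs , refl , p = _ , refl , turn e2 (≮ᵇ⇒≥ (suc n) _ e1) p
  trace⇒LeftPipe (suc f) r zero acc refl = [] , refl , exit refl
  trace⇒LeftPipe (suc f) r (suc c) acc e with suc n <ᵇ r + suc c in e1 | cell D r (suc c) in e2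
  ... | false | true with trace⇒LeftPipe f r c _ e
  ...   | cs , refl , p = _ , sym (++-assoc cs _ _) , leftGo e2 p
  trace⇒LeftPipe (suc f) r (suc c) acc e | false | false with trace⇒Pipe f (suc r) (suc c) _ e
  ...   | cs , refl , p = _ , refl , leftStop e2 p

  private
    ¬T : ∀ r c → r + suc c ≤ suc n → (suc n <ᵇ r + suc c) ≡ false
    ¬T r c b = dec-false (suc n <? r + suc c) (≤⇒≯ b)

  -- Each step of `trace` uses one unit of fuel and either raises the row or lowers the column by
  -- one, so `c + suc n < f + r` is preserved. Without fuel it would put the position outside the
  -- triangle.
  Pipe⇒trace : ∀ f r c acc {t cs} → Pipe n R r c t cs → c + suc n < f + r →
               trace D f r c down acc ≡ just (t , cs ++ acc)
  LeftPipe⇒trace : ∀ f r c acc {t cs} → LeftPipe n R r c t cs → r + c ≤ suc n → c + suc n < f + r →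
               trace D f r c left acc ≡ just (t , cs ++ acc)
  Pipe⇒trace zero r c acc p h = ⊥-elim (bad p)
    where bad : Pipe n R r c _ _ → ⊥
          bad (exit b _) = <⇒≱ h (≤-trans (m≤m+n r _) (≤-trans b (m≤n+m (suc n) c)))
          bad (step b _ _) = <⇒≱ h (≤-trans (m≤m+n r _) (≤-trans b (m≤n+m (suc n) c)))
  Pipe⇒trace (suc f) r (suc c) acc (exit b d) h rewrite ¬T r c b with cell D r (suc c) in e2
  Pipe⇒trace (suc f) r (suc c) acc (exit b d) h | false =
    LeftPipe⇒trace f r c acc (exit d) (≤-trans (+-monoʳ-≤ r (n≤1+n c)) b) (s≤s⁻¹ h)
  Pipe⇒trace (suc f) r (suc c) acc (step {cs = cs} b d q) h rewrite ¬T r c b with cell D r (suc c) in e2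
  Pipe⇒trace (suc f) r (suc c) acc (step {cs = cs} b refl q) h | true =
    trans (Pipe⇒trace f (suc r) (suc c) _ q (subst (suc c + suc n <_) (sym (+-suc f r)) h))
      (cong (λ z → just (_ , z)) (sym (++-assoc cs _ _)))
  Pipe⇒trace (suc f) r (suc c) acc (step {cs = cs} b d q) h | false =
    LeftPipe⇒trace f r c acc (step d q) (≤-trans (+-monoʳ-≤ r (n≤1+n c)) b) (s≤s⁻¹ h)
  LeftPipe⇒trace zero r c acc p b h = ⊥-elim (<⇒≱ h (≤-trans (m≤m+n r _) (≤-trans b (m≤n+m (suc n) c))))
  LeftPipe⇒trace (suc f) r zero acc (exit p) b h = refl
  LeftPipe⇒trace (suc f) r (suc c) acc (exit p) b h rewrite ¬T r c b with cell D r (suc c) in e2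
  ... | true = trans (LeftPipe⇒trace f r c _ (exit p) (≤-trans (+-monoʳ-≤ r (n≤1+n c)) b) (s≤s⁻¹ h))
                 (cong (λ z → just (_ , z)) (sym (++-assoc (leftCrosses r (R r) c) _ _)))
  LeftPipe⇒trace (suc f) r (suc c) acc (step p q) b h rewrite ¬T r c b with cell D r (suc c) in e2
  LeftPipe⇒trace (suc f) r (suc c) acc (step {cs = cs} p q) b h | true =
    trans (LeftPipe⇒trace f r c _ (step p q) (≤-trans (+-monoʳ-≤ r (n≤1+n c)) b) (s≤s⁻¹ h))
      (cong (λ z → just (_ , z)) (trans (++-assoc cs _ _)
        (trans (cong (cs ++_) (sym (++-assoc (leftCrosses r (R r) c) _ _))) (sym (++-assoc cs _ _)))))
  LeftPipe⇒trace (suc f) r (suc c) acc (step {cs = cs} refl q) b h | false =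
    trans (Pipe⇒trace f (suc r) (suc c) _ q (subst (suc c + suc n <_) (sym (+-suc f r)) h))
      (cong (λ z → just (_ , z ++ acc)) (sym (++-identityʳ cs)))

-- Left-aligned rows and falling patches

-- Exit l r c t: in a pipe dream with left-aligned rows of lengths l, the pipe entering
-- row r in column c leaves at row t.
data Exit (l : ℕ → ℕ) : ℕ → ℕ → ℕ → Set where
  here  : ∀ {r c} → c ≡ suc (l r) → Exit l r c r
  pass  : ∀ {r c t} → c ≤ l r → Exit l (suc r) c t → Exit l r c t
  shift : ∀ {r c t} → l r < c → Exit l (suc r) c t → Exit l r (suc c) t

module _ {l : ℕ → ℕ} where

  exit-≥ : ∀ {r c t} → Exit l r c t → r ≤ t
  exit-≥ (here _) = ≤-refl
  exit-≥ (pass _ e) = <⇒≤ (exit-≥ e)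
  exit-≥ (shift _ e) = <⇒≤ (exit-≥ e)

  exit-here⁻ : ∀ {r c t} → c ≡ suc (l r) → Exit l r c t → t ≡ r
  exit-here⁻ eq (here _) = refl
  exit-here⁻ refl (pass p e) = contradiction p (<⇒≱ (n<1+n _))
  exit-here⁻ refl (shift p e) = contradiction p (<-irrefl refl)

  exit-pass⁻ : ∀ {r c t} → c ≤ l r → Exit l r c t → Exit l (suc r) c t
  exit-pass⁻ h (here refl) = contradiction h (<⇒≱ (n<1+n _))
  exit-pass⁻ h (pass _ e) = e
  exit-pass⁻ h (shift p e) = contradiction (≤-trans p (≤-trans (n≤1+n _) h)) (<-irrefl refl)

  exit-shift⁻ : ∀ {r c t} → l r < c → Exit l r (suc c) t → Exit l (suc r) c t
  exit-shift⁻ h (here refl) = contradiction h (<-irrefl refl)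
  exit-shift⁻ h (pass p e) = contradiction (≤-trans h (≤-trans (n≤1+n _) p)) (<-irrefl refl)
  exit-shift⁻ h (shift p e) = e

  exit-det : ∀ {r c t t′} → Exit l r c t → Exit l r c t′ → t ≡ t′
  exit-det (here p) e = sym (exit-here⁻ p e)
  exit-det (pass p e) e′ = exit-det e (exit-pass⁻ p e′)
  exit-det (shift p e) e′ = exit-det e (exit-shift⁻ p e′)

  exit-row⁻ : ∀ {r c} → Exit l r c r → c ≡ suc (l r)
  exit-row⁻ (here p) = p
  exit-row⁻ (pass _ e) = contradiction (exit-≥ e) (<-irrefl refl)
  exit-row⁻ (shift _ e) = contradiction (exit-≥ e) (<-irrefl refl)

  exit-inj : ∀ {r c c′ t} → Exit l r c t → Exit l r c′ t → c ≡ c′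
  exit-inj (here refl) e = sym (exit-row⁻ e)
  exit-inj e (here refl) = exit-row⁻ e
  exit-inj (pass p e) (pass q e′) = exit-inj e e′
  exit-inj (pass p e) (shift q e′) with exit-inj e e′
  ... | refl = contradiction (≤-trans q p) (<-irrefl refl)
  exit-inj (shift p e) (pass q e′) with exit-inj e e′
  ... | refl = contradiction (≤-trans p q) (<-irrefl refl)
  exit-inj (shift p e) (shift q e′) = cong suc (exit-inj e e′)

exit-agree : ∀ {l l′ r c t} → (∀ s → r ≤ s → l′ s ≡ l s) → Exit l r c t → Exit l′ r c t
exit-agree {r = r} h (here refl) = here (cong suc (sym (h r ≤-refl)))
exit-agree {r = r} h (pass p e) = pass (subst (_ ≤_) (sym (h r ≤-refl)) p) (exit-agree (λ s q → h s (<⇒≤ q)) e)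
exit-agree {r = r} h (shift p e) = shift (subst (_< _) (sym (h r ≤-refl)) p) (exit-agree (λ s q → h s (<⇒≤ q)) e)

-- Fall l q d j m ks t: above left-aligned rows of lengths l, a patch in columns j+1,…,j+m
-- situated d rows above row q falls successively by ks and ends left-aligned in row t.
data Fall (l : ℕ → ℕ) : ℕ → ℕ → ℕ → ℕ → List ℕ → ℕ → Set where
  pass : ∀ {q d j m ks t} → j + m ≤ l q → Fall l (suc q) (suc d) j m ks t → Fall l q d j m ks t
  land : ∀ {q d j m ks t} → l q < j → Fall l (suc q) 1 j m ks t → Fall l q d (suc j) m (d ∷ ks) t
  stop : ∀ {q d j m} → j ≡ suc (l q) → Fall l q d j m (d ∷ []) q

module _ {l : ℕ → ℕ} where

  fall-≥ : ∀ {q d j m ks t} → Fall l q d j m ks t → q ≤ t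
  fall-≥ (pass _ f) = <⇒≤ (fall-≥ f)
  fall-≥ (land _ f) = <⇒≤ (fall-≥ f)
  fall-≥ (stop _) = ≤-refl

  fall-pos : ∀ {q d j m ks t} → Fall l q d j m ks t → 0 < j
  fall-pos (pass _ f) = fall-pos f
  fall-pos (land _ _) = z<s
  fall-pos (stop refl) = z<s

  -- The falling patch follows the pipe through the elbow on its left.
  fall-exit : ∀ {q d j m ks t} → Fall l q d j m ks t → Exit l q j t
  fall-exit (pass {j = j} {m} p f) = pass (≤-trans (m≤m+n j m) p) (fall-exit f)
  fall-exit (land p f) = shift p (fall-exit f)
  fall-exit (stop e) = here e

  -- If the pipe in column j passes straight through row q but the row does not reach beyond the
  -- whole patch, then column `suc (l q)` belongs to the patch and its pipe leaves already at row q,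
  -- against the hypothesis. If the pipe in column j shifts, so do all pipes to its right.
  exits⇒fall : ∀ {q j m t} d → Exit l q j t →
               (∀ s → j < s → s ≤ j + m → ∃[ t′ ] Exit l q s t′ × t < t′) →
               ∃[ ks ] Fall l q d j m ks t
  exits⇒fall d (here e) h = d ∷ [] , stop e
  exits⇒fall {q} {j} {m} {t} d (pass p e) h with j + m ≤? l q
  ... | no ¬p with h (suc (l q)) (s≤s p) (≰⇒> ¬p)
  ...   | t′ , e′ , t<t′ = contradiction (subst (t <_) (exit-here⁻ refl e′) t<t′) (<-asym (exit-≥ e))
  exits⇒fall {q} {j} {m} {t} d (pass p e) h | yes p′ with exits⇒fall {m = m} (suc d) e h′
    where h′ : ∀ s → j < s → s ≤ j + m → ∃[ t′ ] Exit l (suc q) s t′ × t < t′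
          h′ s a b with h s a b
          ... | t′ , e′ , lt = t′ , exit-pass⁻ (≤-trans b p′) e′ , lt
  ... | ks , f = ks , pass p′ f
  exits⇒fall {q} {suc j} {m} {t} d (shift p e) h with exits⇒fall {m = m} 1 e h′
    where h′ : ∀ s → j < s → s ≤ j + m → ∃[ t′ ] Exit l (suc q) s t′ × t < t′
          h′ s a b with h (suc s) (s≤s a) (s≤s b)
          ... | t′ , e′ , lt = t′ , exit-shift⁻ (<-trans p a) e′ , lt
  ... | ks , f = d ∷ ks , land p f

  -- The pipes in the columns of the patch pass and shift together with the pipe through its elbow,
  -- and they still continue downwards when that pipe leaves.
  fall-order : ∀ {q d j m ks t s t′} → Fall l q d j m ks t → j < s → s ≤ j + m → Exit l q s t′ → t < t′
  fall-order (pass p f) a b e = fall-order f a b (exit-pass⁻ (≤-trans b p) e)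
  fall-order {s = suc s} (land p f) a b e = fall-order f (s≤s⁻¹ a) (s≤s⁻¹ b) (exit-shift⁻ (<-trans p (s≤s⁻¹ a)) e)
  fall-order {s = suc s} (stop refl) a b e = exit-≥ (exit-shift⁻ (s≤s⁻¹ a) e)

-- Adding the patch to row t permutes the entry columns cyclically: j becomes j+m, and
-- j+1,…,j+m move one to the left.
module Added {l l′ : ℕ → ℕ} where

  private
    Upd : ℕ → ℕ → Set
    Upd t m = l′ t ≡ l t + m × (∀ r → r ≢ t → l′ r ≡ l r)

    same : ∀ {q t m} → Upd t m → q < t → l′ q ≡ l q
    same u lt = proj₂ u _ (<⇒≢ lt)

    below : ∀ {t m} → Upd t m → ∀ s → suc t ≤ s → l′ s ≡ l s
    below u s lt = proj₂ u s (λ { refl → <-irrefl refl lt })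

  added-low : ∀ {q d j m ks t c s} → Fall l q d j m ks t → Upd t m → c < j →
              Exit l q c s → Exit l′ q c s
  added-low (pass {j = j} {m} p f) u h e =
    pass (≤-trans c≤ (≤-reflexive (sym (same u (fall-≥ f))))) (added-low f u h (exit-pass⁻ c≤ e))
    where c≤ = ≤-trans (<⇒≤ h) (≤-trans (m≤m+n j m) p)
  added-low (land p f) u h (here refl) = here (cong suc (sym (same u (fall-≥ f))))
  added-low (land p f) u h (pass c≤ e) =
    pass (≤-trans c≤ (≤-reflexive (sym (same u (fall-≥ f))))) (added-low f u (≤-<-trans c≤ p) e)
  added-low (land p f) u h (shift c> e) =
    shift (≤-<-trans (≤-reflexive (same u (fall-≥ f))) c>) (added-low f u (s≤s⁻¹ h) e)
  added-low (stop {m = m} refl) u h e =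
    pass (≤-trans (s≤s⁻¹ h) (≤-trans (m≤m+n _ m) (≤-reflexive (sym (proj₁ u)))))
         (exit-agree (below u) (exit-pass⁻ (s≤s⁻¹ h) e))

  added-eq : ∀ {q d j m ks t s} → Fall l q d j m ks t → Upd t m →
             Exit l q j s → Exit l′ q (j + m) s
  added-eq (pass {j = j} {m} p f) u e =
    pass (≤-trans p (≤-reflexive (sym (same u (fall-≥ f)))))
         (added-eq f u (exit-pass⁻ (≤-trans (m≤m+n j m) p) e))
  added-eq (land {j = j} {m} p f) u e =
    shift (≤-<-trans (≤-reflexive (same u (fall-≥ f))) (<-≤-trans p (m≤m+n j m)))
          (added-eq f u (exit-shift⁻ p e))
  added-eq (stop {m = m} refl) u e with exit-here⁻ refl e
  ... | refl = here (cong suc (sym (proj₁ u)))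

  added-mid : ∀ {q d j m ks t c s} → Fall l q d j m ks t → Upd t m → j ≤ c → suc c ≤ j + m →
              Exit l q (suc c) s → Exit l′ q c s
  added-mid (pass p f) u a b e =
    pass (≤-trans (<⇒≤ (≤-trans b p)) (≤-reflexive (sym (same u (fall-≥ f)))))
         (added-mid f u a b (exit-pass⁻ (≤-trans b p) e))
  added-mid {c = suc c} (land p f) u a b e =
    shift (≤-<-trans (≤-reflexive (same u (fall-≥ f))) (<-≤-trans p (s≤s⁻¹ a)))
          (added-mid f u (s≤s⁻¹ a) (s≤s⁻¹ b) (exit-shift⁻ (<-trans p a) e))
  added-mid (stop refl) u a b e =
    pass (≤-trans (s≤s⁻¹ b) (≤-reflexive (sym (proj₁ u)))) (exit-agree (below u) (exit-shift⁻ a e))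

  added-high : ∀ {q d j m ks t c s} → Fall l q d j m ks t → Upd t m → j + m < c →
               Exit l q c s → Exit l′ q c s
  added-high (pass p f) u h (here refl) = here (cong suc (sym (same u (fall-≥ f))))
  added-high (pass p f) u h (pass c≤ e) =
    pass (≤-trans c≤ (≤-reflexive (sym (same u (fall-≥ f))))) (added-high f u h e)
  added-high (pass p f) u h (shift c> e) =
    shift (≤-<-trans (≤-reflexive (same u (fall-≥ f))) c>) (added-high f u (≤-<-trans p c>) e)
  added-high {c = suc c} (land {j = j} {m} p f) u h e =
    shift (≤-<-trans (≤-reflexive (same u (fall-≥ f))) l<) (added-high f u (s≤s⁻¹ h) (exit-shift⁻ l< e))
    where l< = <-trans p (≤-<-trans (m≤m+n j m) (s≤s⁻¹ h))
  added-high {c = suc c} (stop {m = m} refl) u h e =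
    shift (≤-<-trans (≤-reflexive (proj₁ u)) (s≤s⁻¹ h))
          (exit-agree (below u) (exit-shift⁻ (≤-<-trans (m≤m+n _ m) (s≤s⁻¹ h)) e))

-- Columns a+1,...,b. With a = 0 this excludes column zero, which lies outside the grid.
interval : ℕ → ℕ → Row
interval a b c = (a <ᵇ c) ∧ (c ≤ᵇ b)

interval-true : ∀ {a b c} → a < c → c ≤ b → interval a b c ≡ true
interval-true {a} {b} {c} p q = cong₂ _∧_ (dec-true (a <? c) p) (dec-true (c ≤? b) q)

interval-false-low : ∀ {a b c} → c ≤ a → interval a b c ≡ false
interval-false-low {a} {b} {c} p = cong (_∧ (c ≤ᵇ b)) (dec-false (a <? c) (≤⇒≯ p))

interval-false-high : ∀ {a b c} → b < c → interval a b c ≡ false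
interval-false-high {a} {b} {c} p = trans (cong ((a <ᵇ c) ∧_) (dec-false (c ≤? b) (<⇒≱ p))) (∧-zeroʳ _)

true≢false : ∀ {b} → b ≡ true → b ≡ false → ⊥
true≢false refl ()

interval-true⁻ : ∀ {a b c} → interval a b c ≡ true → a < c × c ≤ b
interval-true⁻ {a} {b} {c} e with c ≤? a | c ≤? b
... | yes p | _ = ⊥-elim (true≢false e (interval-false-low p))
... | no _ | no q = ⊥-elim (true≢false e (interval-false-high (≰⇒> q)))
... | no p | yes q = ≰⇒> p , q

lastElbow-≤ : ∀ S c → lastElbow S c ≤ c
lastElbow-≤ S zero = ≤-refl
lastElbow-≤ S (suc c) with S (suc c)
... | true = ≤-trans (lastElbow-≤ S c) (n≤1+n c)
... | false = ≤-refl

lastElbow-elbow : ∀ S c → S c ≡ false → lastElbow S c ≡ c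
lastElbow-elbow S zero e = refl
lastElbow-elbow S (suc c) e = cong (λ z → if z then lastElbow S c else suc c) e

lastElbow-run : ∀ S j m → (∀ c → j < c → c ≤ j + m → S c ≡ true) → lastElbow S (j + m) ≡ lastElbow S j
lastElbow-run S j zero h = cong (lastElbow S) (+-identityʳ j)
lastElbow-run S j (suc m) h = trans (cong (lastElbow S) (+-suc j m))
  (trans (cong (λ z → if z then lastElbow S (j + m) else suc (j + m))
    (h (suc (j + m)) (s≤s (m≤m+n j m)) (≤-reflexive (sym (+-suc j m)))))
    (lastElbow-run S j m (λ c a b → h c a (≤-trans b (≤-trans (n≤1+n _) (≤-reflexive (sym (+-suc j m))))))))

lastElbow-cong : ∀ {S S′} c → (∀ d → d ≤ c → S d ≡ S′ d) → lastElbow S c ≡ lastElbow S′ c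
lastElbow-cong zero h = refl
lastElbow-cong {S} {S′} (suc c) h = cong₂ (λ z w → if z then w else suc c) (h (suc c) ≤-refl)
  (lastElbow-cong c (λ d p → h d (≤-trans p (n≤1+n c))))

descend-cross : ∀ S c → S c ≡ true → descend S c ≡ c
descend-cross S zero e = refl
descend-cross S (suc c) e = cong (λ z → if z then suc c else lastElbow S c) e

descend-elbow : ∀ S c → S (suc c) ≡ false → descend S (suc c) ≡ lastElbow S c
descend-elbow S c e = cong (λ z → if z then suc c else lastElbow S c) e

descend-cong : ∀ {S S′} c → (∀ d → d ≤ c → S d ≡ S′ d) → descend S c ≡ descend S′ c
descend-cong zero h = refl
descend-cong {S} {S′} (suc c) h = cong₂ (λ z w → if z then suc c else w) (h (suc c) ≤-refl)
  (lastElbow-cong c (λ d p → h d (≤-trans p (n≤1+n c))))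

descend-≤ : ∀ S c → descend S c ≤ c
descend-≤ S zero = ≤-refl
descend-≤ S (suc c) with S (suc c)
... | true = ≤-refl
... | false = ≤-trans (lastElbow-≤ S c) (n≤1+n c)

-- The exit row of a pipe that first crosses an arbitrary row S, placed as row r on top of
-- left-aligned rows. It mediates between actual pipes and `Exit` while a row is only partly
-- processed.
RowExit : Row → (ℕ → ℕ) → ℕ → ℕ → ℕ → Set
RowExit S l r c t = (descend S c ≡ 0 × t ≡ r) ⊎ (0 < descend S c × Exit l (suc r) (descend S c) t)

rowExit-aligned : ∀ {S l r c t} → (∀ c → S c ≡ interval 0 (l r) c) →
                  RowExit S l r (suc c) t → Exit l r (suc c) t
rowExit-aligned {S} {l} {r} {c} h e with <-cmp c (l r)
rowExit-aligned {S} {l} {r} {c} h e | tri< lt _ _ with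
  descend-cross S (suc c) (trans (h (suc c)) (interval-true {0} z<s lt)) | e
... | eq | inj₁ (z , _) = contradiction (trans (sym eq) z) λ ()
... | eq | inj₂ (_ , x) = pass lt (subst (λ z → Exit l _ z _) eq x)
rowExit-aligned {S} {l} {r} {c} h e | tri≈ _ refl _ with
  trans (descend-elbow S c (trans (h (suc c)) (interval-false-high {0} {c} ≤-refl)))
        (lastElbow-run S 0 c (λ d a b → trans (h d) (interval-true a b))) | e
... | eq | inj₁ (_ , refl) = here refl
... | eq | inj₂ (p , x) = contradiction eq (>⇒≢ p)
rowExit-aligned {S} {l} {r} {c} h e | tri> _ _ gt with
  trans (descend-elbow S c (trans (h (suc c)) (interval-false-high {0} (≤-trans gt (n≤1+n c)))))
        (lastElbow-elbow S c (trans (h c) (interval-false-high {0} gt))) | e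
... | eq | inj₁ (z , _) = contradiction (trans (sym eq) z) (>⇒≢ (≤-<-trans z≤n gt))
... | eq | inj₂ (p , x) = shift gt (subst (λ z → Exit l _ z _) eq x)

-- S is obtained from S′ by appending a patch in columns j+1,…,j+m beyond an elbow in column j.
record Appended (S S′ : Row) (j m : ℕ) : Set where
  field
    union : ∀ c → S c ≡ (S′ c ∨ interval j (j + m) c)
    bound : ∀ c → j ≤ c → S′ c ≡ false

  on-patch : ∀ {c} → j < c → c ≤ j + m → S c ≡ true
  on-patch {c} p q = trans (union c) (trans (cong (S′ c ∨_) (interval-true p q)) (∨-zeroʳ _))

  before : ∀ {c} → c ≤ j → S c ≡ S′ c
  before {c} p = trans (union c) (trans (cong (S′ c ∨_) (interval-false-low p)) (∨-identityʳ _))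

  beyond : ∀ {c} → j + m < c → S c ≡ false
  beyond {c} p = trans (union c)
    (cong₂ _∨_ (bound c (≤-trans (m≤m+n j m) (<⇒≤ p))) (interval-false-high p))

  elbow : S j ≡ false
  elbow = trans (before ≤-refl) (bound j ≤-refl)

Updated : (l l′ : ℕ → ℕ) → ℕ → ℕ → Set
Updated l l′ t m = l′ t ≡ l t + m × (∀ r → r ≢ t → l′ r ≡ l r)

rowExit-via : ∀ S S′ c {l l′ r s a b} → descend S c ≡ a → descend S′ c ≡ b → 0 < a → 0 < b →
  (Exit l (suc r) a s → Exit l′ (suc r) b s) → RowExit S l r c s → RowExit S′ l′ r c s
rowExit-via S S′ c refl refl p q h (inj₁ (z , _)) = contradiction z (>⇒≢ p)
rowExit-via S S′ c refl refl p q h (inj₂ (_ , x)) = inj₂ (q , h x)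

-- Without the patch, the vertical pipes of columns j+1,...,j+m leave row r one column further left,
-- and the pipe entering in column j+m+1 leaves it in column j+m instead of j. The cycle caused by
-- the longer row t cancels this, so every exit row is kept.
rowExit-appended : ∀ {S S′ l l′ r j m ks t c s} → Appended S S′ j m → Fall l (suc r) 1 j m ks t →
                   Updated l l′ t m → RowExit S l r (suc c) s → RowExit S′ l′ r (suc c) s
rowExit-appended {S} {S′} {l} {l′} {r} {j} {m} {c = c} {s} A f u e with suc c ≤? j
... | yes p = left-part e
  where
    eq : descend S (suc c) ≡ descend S′ (suc c)
    eq = descend-cong (suc c) (λ d q → Appended.before A (≤-trans q p))
    small : descend S′ (suc c) < j
    small with suc c ≟ j
    ... | no ¬q = ≤-<-trans (descend-≤ S′ (suc c)) (≤∧≢⇒< p ¬q)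
    ... | yes refl = ≤-<-trans (≤-reflexive (descend-elbow S′ c (Appended.bound A (suc c) ≤-refl)))
                       (≤-<-trans (lastElbow-≤ S′ c) (n<1+n c))
    left-part : RowExit S l r (suc c) s → RowExit S′ l′ r (suc c) s
    left-part (inj₁ (a , b)) = inj₁ (trans (sym eq) a , b)
    left-part (inj₂ (a , b)) = inj₂ (subst (0 <_) eq a , Added.added-low f u small (subst (λ z → Exit l _ z _) eq b))
... | no ¬p = right-part (s≤s⁻¹ (≰⇒> ¬p))
  where
    c>0 : j ≤ c → 0 < c
    c>0 = <-≤-trans (fall-pos f)
    right-part : j ≤ c → RowExit S′ l′ r (suc c) s
    right-part j≤c with <-cmp c (j + m)
      | trans (descend-elbow S′ c (Appended.bound A (suc c) (≤-trans j≤c (n≤1+n c)))) (lastElbow-elbow S′ c (Appended.bound A c j≤c))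
    ... | tri< lt _ _ | eq′ = rowExit-via S S′ (suc c) (descend-cross S (suc c) (Appended.on-patch A (s≤s j≤c) lt)) eq′ z<s (c>0 j≤c)
            (Added.added-mid f u j≤c lt) e
    ... | tri≈ _ refl _ | eq′ = rowExit-via S S′ (suc (j + m))
            (trans (descend-elbow S (j + m) (Appended.beyond A ≤-refl))
              (trans (lastElbow-run S j m (λ c → Appended.on-patch A)) (lastElbow-elbow S j (Appended.elbow A))))
            eq′ (fall-pos f) (c>0 j≤c) (Added.added-eq f u) e
    ... | tri> _ _ gt | eq′ = rowExit-via S S′ (suc c)
            (trans (descend-elbow S c (Appended.beyond A (≤-trans gt (n≤1+n c)))) (lastElbow-elbow S c (Appended.beyond A gt)))
            eq′ (c>0 j≤c) (c>0 j≤c) (Added.added-high f u gt) e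

-- Runs of the encoding on row lengths

fall-row : ∀ {l q d j m ks t} → Fall l q d j m ks t → t + d ≡ q + sum ks
fall-row {q = q} {d} {t = t} (pass {ks = ks} p f) = suc-injective (trans (sym (+-suc t d)) (fall-row f))
fall-row {q = q} {d} {t = t} (land {ks = ks} p f) = begin
  t + d              ≡⟨ cong (_+ d) (suc-injective (trans (+-comm 1 t) (fall-row f))) ⟩
  q + sum ks + d     ≡⟨ +-assoc q (sum ks) d ⟩
  q + (sum ks + d)   ≡⟨ cong (q +_) (+-comm (sum ks) d) ⟩
  q + (d + sum ks)   ∎
  where open ≡-Reasoning
fall-row {q = q} {d} (stop p) = cong (q +_) (sym (+-identityʳ d))

fall-abs : ∀ {l i j m ks t} → Fall l (suc i) 1 j m ks t → i + sum ks ≡ t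
fall-abs {t = t} f = suc-injective (trans (sym (fall-row f)) (+-comm t 1))

-- Every move costs one column, and the last one brings the patch right behind the `l t` crosses of
-- row t. The column of a patch can therefore be recovered from lengths and index alone, and this is
-- the source of the summand ℓ in the compatibility conditions.
fall-col : ∀ {l q d j m ks t} → Fall l q d j m ks t → j ≡ l t + length ks
fall-col (pass p f) = fall-col f
fall-col {l} {t = t} (land {ks = ks} p f) = trans (cong suc (fall-col f)) (sym (+-suc (l t) (length ks)))
fall-col {l} {q} (stop e) = trans e (+-comm 1 (l q))

fall-head : ∀ {l q d j m ks t} → Fall l q d j m ks t → ∃[ k ] ∃[ ks′ ] ks ≡ k ∷ ks′ × d ≤ k
fall-head (pass p f) with fall-head f
... | k , ks′ , e , lt = k , ks′ , e , <⇒≤ lt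
fall-head (land p f) = _ , _ , refl , ≤-refl
fall-head (stop p) = _ , _ , refl , ≤-refl

fall-steps : ∀ {l q d j m ks t} → 1 ≤ d → Fall l q d j m ks t → All (1 ≤_) ks
fall-steps h (pass p f) = fall-steps (≤-trans h (n≤1+n _)) f
fall-steps h (land p f) = h ∷ fall-steps ≤-refl f
fall-steps h (stop p) = h ∷ []

-- The bound is n, not n+1, because no cross of a pipe dream lies on the antidiagonal. Empty rows
-- are exempt so that the condition can hold for rows beyond n.
Bounded : ℕ → (ℕ → ℕ) → Set
Bounded n l = ∀ r → 0 < l r → r + l r ≤ n

-- Going back up from the landing row, a patch gains at most one column per row, so the bound at row
-- t carries over to all rows above it.
fall-bound : ∀ {n l l′ q d j m ks t} → Fall l q d j m ks t → 1 ≤ m → Updated l l′ t m →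
             Bounded n l′ → q + (j + m) ≤ suc n
fall-bound (pass p f) h u b = <⇒≤ (fall-bound f h u b)
fall-bound {q = q} (land {j = j} {m} p f) h u b = ≤-trans (≤-reflexive (+-suc q (j + m))) (fall-bound f h u b)
fall-bound {n} {l} {l′} {q} (stop {m = m} refl) h u b =
  ≤-trans (≤-reflexive (+-suc q (l q + m))) (s≤s (subst (λ z → q + z ≤ n) (proj₁ u)
    (b q (<-≤-trans (≤-trans h (m≤n+m m (l q))) (≤-reflexive (sym (proj₁ u)))))))

Event : Set
Event = Index × ℕ

-- The state is the row i being processed, its remaining crosses S, and the lengths l; for r ≤ i,
-- l r is the length of the initial run of crosses of row r.  The events lead to the final lengths lf.
data Run (D : ℕ → Row) (lf : ℕ → ℕ) : ℕ → Row → (ℕ → ℕ) → List Event → Set where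
  done  : ∀ {S l} → (∀ r → l r ≡ lf r) → Run D lf zero S l []
  row   : ∀ {i S l es} → (∀ c → S c ≡ interval 0 (l (suc i)) c) → Run D lf i (D i) l es →
          Run D lf (suc i) S l es
  patch : ∀ {i S S′ l l′ j m ks t es} → 1 ≤ m → Appended S S′ j m →
          Fall l (suc (suc i)) 1 j m ks t → Updated l l′ t m → Run D lf (suc i) S′ l′ es →
          Run D lf (suc i) S l (((suc i , ks) , m) ∷ es)

sumEvents : (Index → Bool) → List Event → ℕ
sumEvents p [] = 0
sumEvents p ((e , m) ∷ es) = (if p e then m else 0) + sumEvents p es

sumEvents-none : ∀ p es → All (λ e → p (proj₁ e) ≡ false) es → sumEvents p es ≡ 0
sumEvents-none p [] [] = refl
sumEvents-none p ((e , m) ∷ es) (h ∷ hs) rewrite h = sumEvents-none p es hs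

run-index : ∀ {D lf i S l es} → Run D lf i S l es → All (λ e → proj₁ (proj₁ e) ≤ i) es
run-index (done _) = []
run-index (row _ ρ) = All.map (λ p → ≤-trans p (n≤1+n _)) (run-index ρ)
run-index (patch _ _ _ _ ρ) = ≤-refl ∷ run-index ρ

run-sum : ∀ {D lf i S l es} → Run D lf i S l es → ∀ r → l r + sumEvents (λ e → absI e ≡ᵇ r) es ≡ lf r
run-sum (done h) r = trans (+-identityʳ _) (h r)
run-sum (row _ ρ) r = run-sum ρ r
run-sum {l = l} (patch {i = i} {l′ = l′} {m = m} {ks} {t} {es} _ _ f u ρ) r with t ≟ r
... | yes refl rewrite fall-abs f | dec-true (t ≟ t) refl =
      trans (sym (+-assoc (l t) m _)) (trans (cong (_+ sumEvents (λ e → absI e ≡ᵇ t) es) (sym (proj₁ u))) (run-sum ρ t))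
... | no ¬p rewrite fall-abs f | dec-false (t ≟ r) ¬p =
      trans (cong (_+ sumEvents (λ e → absI e ≡ᵇ r) es) (sym (proj₂ u r (λ e → ¬p (sym e))))) (run-sum ρ r)

run-≤ : ∀ {D lf i S l es} → Run D lf i S l es → ∀ r → l r ≤ lf r
run-≤ ρ r = ≤-trans (m≤m+n _ _) (≤-reflexive (run-sum ρ r))

run-bounded : ∀ {n D lf i S l es} → Run D lf i S l es → Bounded n lf → Bounded n l
run-bounded ρ b r h = ≤-trans (+-monoʳ-≤ r (run-≤ ρ r)) (b r (<-≤-trans h (run-≤ ρ r)))

run-InL : ∀ {D lf i S l es M} → Run D lf i S l es → (∀ r → 0 < lf r → r ≤ M) →
          All (λ e → InL M (proj₁ e)) es
run-InL (done _) h = []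
run-InL (row _ ρ) h = run-InL ρ h
run-InL {M = M} (patch {m = m} {ks} {t} 1≤m _ f u ρ) h =
  (s≤s z≤n , len , fall-steps ≤-refl f ,
    subst (_≤ M) (sym (fall-abs f))
      (h t (<-≤-trans (≤-trans 1≤m (≤-trans (m≤n+m m _) (≤-reflexive (sym (proj₁ u))))) (run-≤ ρ t))))
  ∷ run-InL ρ h
  where len : 1 ≤ length ks
        len with fall-head f
        ... | _ , _ , refl , _ = s≤s z≤n

run-pos : ∀ {D lf i S l es} → Run D lf i S l es → All (λ e → 1 ≤ proj₂ e) es
run-pos (done _) = []
run-pos (row _ ρ) = run-pos ρ
run-pos (patch h _ _ _ ρ) = h ∷ run-pos ρ

-- The events and the final lengths leave no choice. All events of a run that has passed to row i
-- have origin at most i, so `row` and `patch` cannot be confused. The lengths before an event are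
-- those after it, less m in row |𝐢|, and `fall-col` then gives the column of the patch.
run-injective : ∀ {D D′ lf i S S′ l l′ es} → Run D lf i S l es → Run D′ lf i S′ l′ es →
  (∀ r → l r ≡ l′ r) × (1 ≤ i → ∀ c → S c ≡ S′ c) × (∀ r c → 1 ≤ r → r < i → D r c ≡ D′ r c)
run-injective (done h) (done h′) = (λ r → trans (h r) (sym (h′ r))) , (λ ()) , λ _ _ _ ()
run-injective {D} {D′} (row {i} h ρ) (row h′ ρ′) with run-injective ρ ρ′
... | a , b , c = a , (λ _ x → trans (h x) (trans (cong (λ z → interval 0 z x) (a (suc i))) (sym (h′ x)))) , rows
  where rows : ∀ r x → 1 ≤ r → r < suc i → D r x ≡ D′ r x
        rows r x p q with r ≟ i
        ... | yes refl = b p x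
        ... | no ¬e = c r x p (≤∧≢⇒< (s≤s⁻¹ q) ¬e)
run-injective (row _ ρ) (patch _ _ _ _ _) with run-index ρ
... | p ∷ _ = contradiction p (<-irrefl refl)
run-injective (patch _ _ _ _ _) (row _ ρ) with run-index ρ
... | p ∷ _ = contradiction p (<-irrefl refl)
run-injective {l = l₁} {l₂} (patch {l′ = k₁} {m = m} {ks} {t} _ A f u ρ) (patch {l′ = k₂} {t = t′} _ A′ f′ u′ ρ′)
  with trans (sym (fall-abs f)) (fall-abs f′) | run-injective ρ ρ′
... | refl | a , b , c = leq , (λ _ x → trans (Appended.union A x) (trans (cong₂ _∨_ (b (s≤s z≤n) x)
        (cong (λ z → interval z (z + m) x) jeq)) (sym (Appended.union A′ x)))) , c
  where
    leq : ∀ r → l₁ r ≡ l₂ r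
    leq r with r ≟ t
    ... | yes refl = +-cancelʳ-≡ m (l₁ t) (l₂ t) (trans (sym (proj₁ u)) (trans (a t) (proj₁ u′)))
    ... | no ¬e = trans (sym (proj₂ u r ¬e)) (trans (a r) (proj₂ u′ r ¬e))
    jeq = trans (fall-col f) (trans (cong (_+ length ks) (leq t)) (sym (fall-col f′)))

-- The encoding algorithm

posEq-refl : ∀ p → posEq p p ≡ true
posEq-refl (a , b) = cong₂ _∧_ (dec-true (a ≟ a) refl) (dec-true (b ≟ b) refl)

posEq-row : ∀ {a b c d} → a ≢ c → posEq (a , b) (c , d) ≡ false
posEq-row {a} {b} {c} {d} h = cong (_∧ (b ≡ᵇ d)) (dec-false (a ≟ c) h)

posEq-col : ∀ {a b c d} → b ≢ d → posEq (a , b) (c , d) ≡ false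
posEq-col {a} {b} {c} {d} h = trans (cong ((a ≡ᵇ c) ∧_) (dec-false (b ≟ d) h)) (∧-zeroʳ _)

posEq-sound : ∀ p q → posEq p q ≡ true → p ≡ q
posEq-sound (a , b) (c , d) e with a ≟ c | b ≟ d
... | yes refl | yes refl = refl
... | no ¬p | _ = ⊥-elim (true≢false e (posEq-row {a} {b} {c} {d} ¬p))
... | yes _ | no ¬q = ⊥-elim (true≢false e (posEq-col {a} ¬q))

memS-++ : ∀ xs ys p → memS (xs ++ ys) p ≡ (memS xs p ∨ memS ys p)
memS-++ [] ys p = refl
memS-++ (x ∷ xs) ys p = trans (cong (posEq (proj₁ x) p ∨_) (memS-++ xs ys p)) (sym (∨-assoc (posEq (proj₁ x) p) _ _))

memS-↭ : ∀ {xs ys} → xs ↭ ys → ∀ p → memS xs p ≡ memS ys p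
memS-↭ Perm.refl p = refl
memS-↭ (prep x e) p = cong (posEq (proj₁ x) p ∨_) (memS-↭ e p)
memS-↭ {_ ∷ _ ∷ xs} {_ ∷ _ ∷ ys} (swap x y e) p = begin
  a ∨ b ∨ memS xs p     ≡⟨ cong (λ z → a ∨ b ∨ z) (memS-↭ e p) ⟩
  a ∨ b ∨ memS ys p     ≡⟨ sym (∨-assoc a b _) ⟩
  (a ∨ b) ∨ memS ys p   ≡⟨ cong (_∨ memS ys p) (∨-comm a b) ⟩
  (b ∨ a) ∨ memS ys p   ≡⟨ ∨-assoc b a _ ⟩
  b ∨ a ∨ memS ys p     ∎
  where open ≡-Reasoning
        a = posEq (proj₁ x) p
        b = posEq (proj₁ y) p
memS-↭ (Perm.trans e f) p = trans (memS-↭ e p) (memS-↭ f p)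

memS-∈ : ∀ {xs p t} → (p , t) ∈ xs → memS xs p ≡ true
memS-∈ {p = p} (here refl) rewrite posEq-refl p = refl
memS-∈ {x ∷ xs} {p} (there h) = trans (cong (posEq (proj₁ x) p ∨_) (memS-∈ h)) (∨-zeroʳ _)

∨-false : ∀ {a b} → a ≡ false → b ≡ false → (a ∨ b) ≡ false
∨-false refl refl = refl

∨-true : ∀ {a b} → (a ∨ b) ≡ true → a ≡ true ⊎ b ≡ true
∨-true {true} e = inj₁ refl
∨-true {false} e = inj₂ e

∨-falseʳ : ∀ {a b} → (a ∨ b) ≡ false → b ≡ false
∨-falseʳ {true} ()
∨-falseʳ {false} e = e

block : ℕ → ℕ → ℕ → Index → State
block r j zero tag = []
block r j (suc a) tag = ((r , suc j) , tag) ∷ block r (suc j) a tag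

block-snoc : ∀ r j a tag → block r j (suc a) tag ≡ block r j a tag ++ [ ((r , suc (j + a)) , tag) ]
block-snoc r j zero tag = cong (λ z → [ ((r , suc z) , tag) ]) (sym (+-identityʳ j))
block-snoc r j (suc a) tag = cong (((r , suc j) , tag) ∷_)
  (trans (block-snoc r (suc j) a tag) (cong (λ z → block r (suc j) a tag ++ [ ((r , suc z) , tag) ]) (sym (+-suc j a))))

memS-block-true : ∀ r j a tag {c} → j < c → c ≤ j + a → memS (block r j a tag) (r , c) ≡ true
memS-block-true r j zero tag p q = contradiction (≤-trans q (≤-reflexive (+-identityʳ j))) (<⇒≱ p)
memS-block-true r j (suc a) tag {c} p q with suc j ≟ c
... | yes refl rewrite posEq-refl (r , suc j) = refl
... | no ¬e = trans (cong (posEq (r , suc j) (r , c) ∨_)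
    (memS-block-true r (suc j) a tag (≤∧≢⇒< p ¬e) (≤-trans q (≤-reflexive (+-suc j a))))) (∨-zeroʳ _)

memS-block-row : ∀ r j a tag {x c} → r ≢ x → memS (block r j a tag) (x , c) ≡ false
memS-block-row r j zero tag h = refl
memS-block-row r j (suc a) tag {x} {c} h = ∨-false (posEq-row {r} {suc j} {d = c} h) (memS-block-row r (suc j) a tag h)

memS-block-low : ∀ r j a tag {x c} → c ≤ j → memS (block r j a tag) (x , c) ≡ false
memS-block-low r j zero tag h = refl
memS-block-low r j (suc a) tag {x} h = ∨-false (posEq-col {r} {c = x} (>⇒≢ (s≤s h))) (memS-block-low r (suc j) a tag (≤-trans h (n≤1+n j)))

memS-block-high : ∀ r j a tag {x c} → j + a < c → memS (block r j a tag) (x , c) ≡ false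
memS-block-high r j zero tag h = refl
memS-block-high r j (suc a) tag {x} {c} h = ∨-false (posEq-col {r} {c = x} (<⇒≢ (≤-<-trans (s≤s (m≤m+n j a)) h′))) (memS-block-high r (suc j) a tag h′)
  where h′ = subst (_< c) (+-suc j a) h

∈-block : ∀ r j a tag {x c t} → ((x , c) , t) ∈ block r j a tag → x ≡ r × j < c × c ≤ j + a
∈-block r j (suc a) tag (here refl) = refl , ≤-refl , ≤-trans (s≤s (m≤m+n j a)) (≤-reflexive (sym (+-suc j a)))
∈-block r j (suc a) tag {c = c} (there h) with ∈-block r (suc j) a tag h
... | e , p , q = e , <⇒≤ p , subst (c ≤_) (sym (+-suc j a)) q

-- A copy of the folding function local to candidate.
considerCross : State → Pos × Index → Maybe Pos → Maybe Pos
considerCross st ((r , zero) , _) acc = acc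
considerCross st ((r , suc zero) , _) acc = acc
considerCross st ((r , suc (suc c)) , _) acc = if memS st (r , suc c) then acc else maxPos (r , suc c) acc

candidate-foldr : ∀ st → candidate st ≡ foldr (considerCross st) nothing st
candidate-foldr st = foldr-cong
  (λ { ((r , zero) , _) acc → refl ; ((r , suc zero) , _) acc → refl ; ((r , suc (suc c)) , _) acc → refl }) refl st

_≼_ : Pos → Pos → Set
(a , b) ≼ (c , d) = a < c ⊎ (a ≡ c × b ≤ d)

UpTo : Pos → Maybe Pos → Set
UpTo top nothing = T true
UpTo top (just q) = q ≼ top

maxPos-cases : ∀ p q → maxPos p (just q) ≡ just p ⊎ maxPos p (just q) ≡ just q
maxPos-cases (a , b) (c , d) with (c <ᵇ a) ∨ ((a ≡ᵇ c) ∧ (d <ᵇ b))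
... | true = inj₁ refl
... | false = inj₂ refl

maxPos-top : ∀ top m → UpTo top m → maxPos top m ≡ just top
maxPos-top top nothing h = refl
maxPos-top (a , b) (just (c , d)) (inj₁ lt) rewrite dec-true (c <? a) lt = refl
maxPos-top (a , b) (just (.a , d)) (inj₂ (refl , le)) with m≤n⇒m<n∨m≡n le
... | inj₁ lt rewrite dec-true (a ≟ a) refl | dec-true (d <? b) lt | ∨-zeroʳ (a <ᵇ a) = refl
... | inj₂ refl with maxPos-cases (a , b) (a , b)
...   | inj₁ e = e
...   | inj₂ e = e

maxPos-keep : ∀ q top → q ≼ top → maxPos q (just top) ≡ just top
maxPos-keep (a , b) (c , d) (inj₁ lt) rewrite dec-false (c <? a) (<-asym lt) | dec-false (a ≟ c) (<⇒≢ lt) = refl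
maxPos-keep (a , b) (.a , d) (inj₂ (refl , le)) rewrite dec-false (a <? a) (<-irrefl refl) | dec-true (a ≟ a) refl
  | dec-false (d <? b) (≤⇒≯ le) = refl

maxPos-upTo : ∀ {top} q m → q ≼ top → UpTo top m → UpTo top (maxPos q m)
maxPos-upTo q nothing h _ = h
maxPos-upTo {top} q (just q′) h h′ with maxPos q (just q′) | maxPos-cases q q′
... | _ | inj₁ refl = h
... | _ | inj₂ refl = h′

-- The list `xs` is kept apart from `st` because the fold consumes the list while membership is
-- always tested in the full state. Columns start at two, since a cross in column one has no elbow
-- on its left.
Active≼ : State → Pos → State → Set
Active≼ st top xs = ∀ r c t → ((r , suc (suc c)) , t) ∈ xs → memS st (r , suc c) ≡ false → (r , suc c) ≼ top

fold-upTo : ∀ st top xs → Active≼ st top xs → UpTo top (foldr (considerCross st) nothing xs)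
fold-upTo st top [] h = _
fold-upTo st top (((r , zero) , t) ∷ xs) h = fold-upTo st top xs (λ r c t m → h r c t (there m))
fold-upTo st top (((r , suc zero) , t) ∷ xs) h = fold-upTo st top xs (λ r c t m → h r c t (there m))
fold-upTo st top (((r , suc (suc c)) , t) ∷ xs) h with memS st (r , suc c) in e
... | true = fold-upTo st top xs (λ r c t m → h r c t (there m))
... | false = maxPos-upTo (r , suc c) (foldr (considerCross st) nothing xs) (h r c t (here refl) e) (fold-upTo st top xs (λ r c t m → h r c t (there m)))

fold-top : ∀ st p j t xs → Active≼ st (p , suc j) xs → ((p , suc (suc j)) , t) ∈ xs →
           memS st (p , suc j) ≡ false → foldr (considerCross st) nothing xs ≡ just (p , suc j)
fold-top st p j t (x ∷ xs) h (here refl) e rewrite e =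
  maxPos-top (p , suc j) (foldr (considerCross st) nothing xs) (fold-upTo st (p , suc j) xs (λ r c t m → h r c t (there m)))
fold-top st p j t (((r , zero) , _) ∷ xs) h (there m) e = fold-top st p j t xs (λ r c t m → h r c t (there m)) m e
fold-top st p j t (((r , suc zero) , _) ∷ xs) h (there m) e = fold-top st p j t xs (λ r c t m → h r c t (there m)) m e
fold-top st p j t (((r , suc (suc c)) , t′) ∷ xs) h (there m) e with memS st (r , suc c) in e′
... | true = fold-top st p j t xs (λ r c t m → h r c t (there m)) m e
... | false rewrite fold-top st p j t xs (λ r c t m → h r c t (there m)) m e =
  maxPos-keep (r , suc c) (p , suc j) (h r c t′ (here refl) e′)

candidate-just : ∀ st p j t → Active≼ st (p , suc j) st → ((p , suc (suc j)) , t) ∈ st →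
                 memS st (p , suc j) ≡ false → candidate st ≡ just (p , suc j)
candidate-just st p j t h m e = trans (candidate-foldr st) (fold-top st p j t st h m e)

candidate-nothing : ∀ st → (∀ r c t → ((r , suc (suc c)) , t) ∈ st → memS st (r , suc c) ≡ true) →
                    candidate st ≡ nothing
candidate-nothing st h = trans (candidate-foldr st) (go st h)
  where
    go : ∀ xs → (∀ r c t → ((r , suc (suc c)) , t) ∈ xs → memS st (r , suc c) ≡ true) →
         foldr (considerCross st) nothing xs ≡ nothing
    go [] h = refl
    go (((r , zero) , t) ∷ xs) h = go xs (λ r c t m → h r c t (there m))
    go (((r , suc zero) , t) ∷ xs) h = go xs (λ r c t m → h r c t (there m))
    go (((r , suc (suc c)) , t) ∷ xs) h rewrite h r c t (here refl) = go xs (λ r c t m → h r c t (there m))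

findK-just : ∀ st f i k b → (∀ c → k < c → c ≤ k + b → memS st (i , c) ≡ true) →
             memS st (i , suc (k + b)) ≡ false → b < f → findK st f i k ≡ just (k + b)
findK-just st (suc f) i k zero h e lt rewrite +-identityʳ k | e = refl
findK-just st (suc f) i k (suc b) h e lt rewrite h (suc k) ≤-refl (≤-trans (s≤s (m≤m+n k b)) (≤-reflexive (sym (+-suc k b)))) =
  trans (findK-just st f i (suc k) b (λ c p q → h c (<⇒≤ p) (≤-trans q (≤-reflexive (sym (+-suc k b)))))
           (trans (cong (λ z → memS st (i , suc z)) (sym (+-suc k b))) e) (s≤s⁻¹ lt))
        (cong just (sym (+-suc k b)))

findM-just : ∀ st f r s k b → (∀ x → k ≤ x → x < k + b → memS st (r + x , s) ≡ true × memS st (r + x , suc s) ≡ true) →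
             memS st (r + (k + b) , s) ≡ false → memS st (r + (k + b) , suc s) ≡ false → b < f →
             findM st f r (suc s) k ≡ just (k + b)
findM-just st (suc f) r s k zero h e e′ lt rewrite +-identityʳ k | e | e′ = refl
findM-just st (suc f) r s k (suc b) h e e′ lt
  rewrite proj₁ (h k ≤-refl (≤-trans (s≤s (m≤m+n k b)) (≤-reflexive (sym (+-suc k b)))))
        | proj₂ (h k ≤-refl (≤-trans (s≤s (m≤m+n k b)) (≤-reflexive (sym (+-suc k b))))) =
  trans (findM-just st f r s (suc k) b (λ x p q → h x (<⇒≤ p) (≤-trans q (≤-reflexive (sym (+-suc k b)))))
           (trans (cong (λ z → memS st (r + z , s)) (sym (+-suc k b))) e)
           (trans (cong (λ z → memS st (r + z , suc s)) (sym (+-suc k b))) e′) (s≤s⁻¹ lt))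
        (cong just (sym (+-suc k b)))

-- States are followed only up to permutation, as `ladderInv` puts the moved cross in front. That
-- `rest` has no cross at p makes the extracted tag unambiguous.
extract-just : ∀ st p t rest → st ↭ (p , t) ∷ rest → memS rest p ≡ false →
               ∃[ st′ ] extract p st ≡ just (t , st′) × st′ ↭ rest
extract-just [] p t rest h e with ↭-length h
... | ()
extract-just (x ∷ st) p t rest h e with posEq (proj₁ x) p in eq | ∈-resp-↭ h (here refl)
... | true | here refl = st , refl , drop-∷ h
... | true | there m with posEq-sound (proj₁ x) p eq
...   | refl = ⊥-elim (true≢false (memS-∈ m) e)
extract-just (x ∷ st) p t rest h e | false | here refl = ⊥-elim (true≢false (posEq-refl p) eq)
extract-just (x ∷ st) p t rest h e | false | there m with ∈-∃++ m
... | ys , zs , refl with extract-just st p t (ys ++ zs) (drop-mid [] ((p , t) ∷ ys) h)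
                            (∨-falseʳ {posEq (proj₁ x) p} (trans (memS-↭ (↭-sym (↭-shift x ys zs)) p) e))
...   | st′ , e′ , h′ rewrite e′ = x ∷ st′ , refl , ↭-trans (prep x h′) (↭-sym (↭-shift x ys zs))

ladderInv-just : ∀ f st r s o ks rest b → st ↭ ((r , suc s) , (o , ks)) ∷ rest → memS rest (r , suc s) ≡ false →
  memS st (r , s) ≡ false →
  (∀ x → 1 ≤ x → x < suc b → memS st (r + x , s) ≡ true × memS st (r + x , suc s) ≡ true) →
  memS st (r + suc b , s) ≡ false → memS st (r + suc b , suc s) ≡ false → b < f →
  ∃[ st′ ] ladderInv f st r (suc s) ≡ just (((r + suc b , s) , (o , ks ++ suc b ∷ [])) ∷ st′) × st′ ↭ rest
ladderInv-just f st r s o ks rest b h e₀ e₁ full e₂ e₃ lt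
  with extract-just st (r , suc s) (o , ks) rest h e₀
... | st′ , e , h′
  rewrite e₁ | memS-∈ (∈-resp-↭ (↭-sym h) (here refl)) | findM-just st f r s 1 b full e₂ e₃ lt | e = st′ , refl , h′

columns : ℕ → ℕ → List ℕ
columns j zero = []
columns j (suc b) = suc j ∷ columns (suc j) b

columns-upTo : ∀ j b → map (λ t → j + suc t) (upTo b) ≡ columns j b
columns-upTo j b = trans (map-upTo (λ t → j + suc t) b) (go _ j b (λ _ → refl))
  where
    go : ∀ f j b → (∀ t → f t ≡ j + suc t) → L.applyUpTo f b ≡ columns j b
    go f j zero h = refl
    go f j (suc b) h = cong₂ _∷_ (trans (h 0) (trans (+-suc j 0) (cong suc (+-identityʳ j))))
      (go (f ∘ suc) (suc j) b (λ t → trans (h (suc t)) (+-suc j (suc t))))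

memS-right : ∀ xs ys p → memS ys p ≡ true → memS (xs ++ ys) p ≡ true
memS-right xs ys p e = trans (memS-++ xs ys p) (trans (cong (memS xs p ∨_) e) (∨-zeroʳ _))

memS-left : ∀ xs ys p → memS xs p ≡ true → memS (xs ++ ys) p ≡ true
memS-left xs ys p e = trans (memS-++ xs ys p) (cong (_∨ memS ys p) e)

memS-neither : ∀ xs ys p → memS xs p ≡ false → memS ys p ≡ false → memS (xs ++ ys) p ≡ false
memS-neither xs ys p e e′ = trans (memS-++ xs ys p) (∨-false e e′)

-- The termination measure of the encoding: a round moves each cross of a nonempty patch one column
-- to the left.
columnSum : State → ℕ
columnSum st = sum (map (λ e → proj₂ (proj₁ e)) st)

columnSum-↭ : ∀ {xs ys} → xs ↭ ys → columnSum xs ≡ columnSum ys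
columnSum-↭ h = sum-↭ (map⁺ (λ e → proj₂ (proj₁ e)) h)

columnSum-++ : ∀ xs ys → columnSum (xs ++ ys) ≡ columnSum xs + columnSum ys
columnSum-++ xs ys = trans (cong sum (map-++ (λ e → proj₂ (proj₁ e)) xs ys)) (sum-++ (map _ xs) (map _ ys))

columnSum-block-≤ : ∀ p q j m tag tag′ → columnSum (block q j m tag′) ≤ columnSum (block p (suc j) m tag)
columnSum-block-≤ p q j zero tag tag′ = ≤-refl
columnSum-block-≤ p q j (suc m) tag tag′ = +-mono-≤ (n≤1+n (suc j)) (columnSum-block-≤ p q (suc j) m tag tag′)

columnSum-block-< : ∀ p q j m tag tag′ → 1 ≤ m → columnSum (block q j m tag′) < columnSum (block p (suc j) m tag)
columnSum-block-< p q j (suc m) tag tag′ _ = +-mono-<-≤ (n<1+n (suc j)) (columnSum-block-≤ p q (suc j) m tag tag′)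

rounds-step : ∀ n f st {i j k st′} → candidate st ≡ just (i , j) → findK st (suc (suc n)) i (suc j) ≡ just k →
  applyAll (suc (suc n)) st i (map (λ t → j + suc t) (upTo (k ∸ j))) ≡ just st′ →
  rounds n (suc f) st ≡ rounds n f st′
rounds-step n f st e₁ e₂ e₃ rewrite e₁ | e₂ | e₃ = refl

-- One round: the patch in columns j+2,…,j+1+m of row p moves down b+1 rows.
module Move (n : ℕ) (l : ℕ → ℕ) (rest : State) (p j m b o : ℕ) (ks : List ℕ)
  (right : ∀ c → suc j ≤ c → memS rest (p , c) ≡ false)
  (under : ∀ x → p < x → ∀ c → memS rest (x , c) ≡ interval 0 (l x) c)
  (full  : ∀ x → 1 ≤ x → x < suc b → suc j + m ≤ l (p + x))
  (room  : l (p + suc b) < suc j)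
  (size  : 1 ≤ m)
  (inΔ   : p + suc b + (suc j + m) ≤ suc n) where

  private
    q : ℕ
    q = p + suc b
    tag tag′ : Index
    tag = (o , ks)
    tag′ = (o , ks ++ suc b ∷ [])
    p<q : p < q
    p<q = ≤-trans (≤-reflexive (+-comm 1 p)) (+-monoʳ-≤ p (s≤s z≤n))

  -- Loop invariant: a crosses have already arrived in row q and b′ are still in row p. The elbow
  -- that the next inverse ladder move needs on its left is the original one or the place just
  -- vacated.
  applyAll-block : ∀ b′ a k {st} → k ≡ suc j + a → a + b′ ≡ m →
    st ↭ block q j a tag′ ++ (block p k b′ tag ++ rest) →
    ∃[ st′ ] applyAll (suc (suc n)) st p (columns k b′) ≡ just st′ × st′ ↭ block q j m tag′ ++ rest
  applyAll-block zero a k {st} e e′ h = st , refl , subst (λ z → st ↭ block q j z tag′ ++ rest) (trans (sym (+-identityʳ a)) e′) h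
  applyAll-block (suc b′) a k {st} refl e′ h = finish
    where
      rest₁ = block q j a tag′ ++ (block p (suc k) b′ tag ++ rest)
      h₁ : st ↭ ((p , suc k) , tag) ∷ rest₁
      h₁ = ↭-trans h (↭-shift ((p , suc k) , tag) (block q j a tag′) (block p (suc k) b′ tag ++ rest))
      inRest₁ : ∀ x c → memS rest (x , c) ≡ true → memS st (x , c) ≡ true
      inRest₁ x c e = trans (memS-↭ h (x , c)) (memS-right (block q j a tag′) _ _ (memS-right (block p k (suc b′) tag) rest _ e))
      absent : ∀ c → suc j ≤ c → c ≤ suc k → memS rest₁ (p , c) ≡ false
      absent c a≤ c≤ = memS-neither (block q j a tag′) _ _ (memS-block-row q j a tag′ (>⇒≢ p<q))
        (memS-neither (block p (suc k) b′ tag) rest _ (memS-block-low p (suc k) b′ tag c≤) (right c a≤))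
      e₁ : memS st (p , k) ≡ false
      e₁ = trans (memS-↭ h₁ (p , k)) (∨-false (posEq-col {p} {c = p} (>⇒≢ (n<1+n k)))
             (absent k (m≤m+n (suc j) a) (n≤1+n k)))
      free : ∀ c → k ≤ c → memS st (q , c) ≡ false
      free c k≤ = trans (memS-↭ h₁ (q , c)) (∨-false (posEq-row {p} {suc k} {d = c} (<⇒≢ p<q))
        (memS-neither (block q j a tag′) _ _ (memS-block-high q j a tag′ k≤)
          (memS-neither (block p (suc k) b′ tag) rest _ (memS-block-row p (suc k) b′ tag (<⇒≢ p<q))
            (trans (under q p<q c) (interval-false-high {0} (<-≤-trans room (≤-trans (m≤m+n (suc j) a) k≤)))))))
      k<m : suc k ≤ suc j + m
      k<m = ≤-trans (s≤s (s≤s (≤-trans (m≤m+n (j + a) b′) (≤-reflexive (+-assoc j a b′)))))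
              (≤-trans (≤-reflexive (cong suc (trans (sym (+-suc j (a + b′))) (cong (j +_) (sym (+-suc a b′))))))
                (≤-reflexive (cong (λ z → suc (j + z)) e′)))
      present : ∀ x → 1 ≤ x → x < suc b → memS st (p + x , k) ≡ true × memS st (p + x , suc k) ≡ true
      present x 1≤x x≤ = inRest₁ _ _ (cross k z<s (≤-trans (n≤1+n k) k<m)) , inRest₁ _ _ (cross (suc k) z<s k<m)
        where cross : ∀ c → 0 < c → c ≤ suc j + m → memS rest (p + x , c) ≡ true
              cross c 0<c c≤ = trans (under (p + x) (≤-trans (≤-reflexive (+-comm 1 p)) (+-monoʳ-≤ p 1≤x)) c)
                              (interval-true 0<c (≤-trans c≤ (full x 1≤x x≤)))
      -- The search for the landing row has fuel n+2, and row q still lies in the triangle.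
      b<F : b < suc (suc n)
      b<F = ≤-trans (≤-trans (m≤n+m (suc b) p) (≤-trans (m≤m+n q _) inΔ)) (n≤1+n _)
      finish : ∃[ st′ ] applyAll (suc (suc n)) st p (columns k (suc b′)) ≡ just st′ × st′ ↭ block q j m tag′ ++ rest
      finish with ladderInv-just (suc (suc n)) st p k o ks rest₁ b h₁ (absent (suc k) (≤-trans (m≤m+n (suc j) a) (n≤1+n k)) ≤-refl)
                    e₁ present (free k ≤-refl) (free (suc k) (n≤1+n k)) b<F
      ... | st₁ , eq , h₂ rewrite eq = applyAll-block b′ (suc a) (suc k) (cong suc (sym (+-suc j a))) (trans (sym (+-suc a b′)) e′) h₃
        where
          h₃ : ((q , k) , tag′) ∷ st₁ ↭ block q j (suc a) tag′ ++ (block p (suc k) b′ tag ++ rest)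
          h₃ = ↭-trans (prep _ h₂) (↭-trans (↭-sym (↭-shift ((q , k) , tag′) (block q j a tag′) _))
                 (Perm.↭-reflexive (trans (sym (++-assoc (block q j a tag′) [ ((q , k) , tag′) ] _))
                   (cong (_++ (block p (suc k) b′ tag ++ rest)) (sym (block-snoc q j a tag′))))))

  -- The elbow in column j+1 of row p is the maximal candidate: the rows below p are left-aligned,
  -- and outside the patch row p has no cross from that column on.
  round : ∀ f {st} → st ↭ block p (suc j) m tag ++ rest →
    ∃[ st′ ] rounds n (suc f) st ≡ rounds n f st′ × st′ ↭ block q j m tag′ ++ rest
  round f {st} h = finish m refl size
    where
      memSt : ∀ {c} x → memS (block p (suc j) m tag) (x , c) ≡ false → memS rest (x , c) ≡ false → memS st (x , c) ≡ false
      memSt x e e′ = trans (memS-↭ h _) (memS-neither (block p (suc j) m tag) rest _ e e′)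
      onBlock : ∀ c → suc j < c → c ≤ suc j + m → memS st (p , c) ≡ true
      onBlock c a b = trans (memS-↭ h _) (memS-left (block p (suc j) m tag) rest _ (memS-block-true p (suc j) m tag a b))
      active : Active≼ st (p , suc j) st
      active r c t i e with ∈-++⁻ (block p (suc j) m tag) (∈-resp-↭ h i)
      ... | inj₁ i′ with ∈-block p (suc j) m tag i′
      ...   | refl , lo , hi with suc c ≤? suc j
      ...     | yes le = inj₂ (refl , le)
      ...     | no ¬le = ⊥-elim (true≢false (onBlock (suc c) (≰⇒> ¬le) (≤-trans (n≤1+n _) hi)) e)
      active r c t i e | inj₂ i′ with <-cmp r p
      ... | tri< lt _ _ = inj₁ lt
      ... | tri≈ _ refl _ with suc j ≤? suc (suc c)
      ...   | yes le = ⊥-elim (true≢false (memS-∈ i′) (right _ le))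
      ...   | no ¬le = inj₂ (refl , ≤-trans (n≤1+n _) (<⇒≤ (≰⇒> ¬le)))
      active r c t i e | inj₂ i′ | tri> _ _ gt =
        ⊥-elim (true≢false (trans (memS-↭ h _) (memS-right (block p (suc j) m tag) rest _
          (trans (under r gt (suc c)) (interval-true z<s (≤-trans (n≤1+n _)
            (proj₂ (interval-true⁻ {0} {l r} (trans (sym (under r gt (suc (suc c)))) (memS-∈ i′))))))))) e)
      elbow : memS st (p , suc j) ≡ false
      elbow = memSt p (memS-block-low p (suc j) m tag ≤-refl) (right (suc j) ≤-refl)
      edge : ∀ m′ → m ≡ suc m′ → memS st (p , suc (suc (suc j) + m′)) ≡ false
      edge m′ refl = memSt p (memS-block-high p (suc j) m tag (≤-reflexive (cong (λ z → suc (suc z)) (+-suc j m′))))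
        (right _ (≤-trans (m≤m+n (suc j) m′) (≤-trans (n≤1+n _) (n≤1+n _))))
      finish : ∀ m₀ → m₀ ≡ m → 1 ≤ m₀ → ∃[ st′ ] rounds n (suc f) st ≡ rounds n f st′ × st′ ↭ block q j m tag′ ++ rest
      finish (suc m′) refl _ with applyAll-block m 0 (suc j) {st} (sym (+-identityʳ (suc j))) refl h
      ... | st′ , eq , h′ = st′ , eqn , h′
        where
          eqn : rounds n (suc f) st ≡ rounds n f st′
          k≡ : suc (suc j) + m′ ≡ suc j + suc m′
          k≡ = cong suc (sym (+-suc j m′))
          cols : map (λ t → suc j + suc t) (upTo (suc (suc j) + m′ ∸ suc j)) ≡ columns (suc j) (suc m′)
          cols = trans (cong (λ z → map (λ t → suc j + suc t) (upTo z)) (trans (cong (_∸ suc j) k≡) (m+n∸m≡n (suc j) (suc m′))))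
                       (columns-upTo (suc j) (suc m′))
          eqn = rounds-step n f st (candidate-just st p j tag active (∈-resp-↭ (↭-sym h) (here refl)) elbow)
            (findK-just st (suc (suc n)) p (suc (suc j)) m′
                (λ c lo hi → onBlock c (<⇒≤ lo) (≤-trans hi (≤-reflexive k≡)))
                (edge m′ refl)
                (≤-trans (≤-trans (m≤n+m m (q + suc j)) (≤-trans (≤-reflexive (+-assoc q (suc j) m)) inΔ)) (n≤1+n _)))
            (trans (cong (applyAll (suc (suc n)) st p) cols) eq)

-- A `pass` costs no round, it only extends the record `full` of rows that reach beyond the patch. A
-- round is spent on each landing; afterwards all rows strictly below the patch are still
-- left-aligned, so the same patch is chosen again until it is aligned.
falls : ∀ {n l l′ q d j m ks t rest o} p ks₀ → Fall l q (suc d) j m ks t → q ≡ p + suc d →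
  (∀ x → 1 ≤ x → x < suc d → j + m ≤ l (p + x)) → 1 ≤ m → Updated l l′ t m → Bounded n l′ →
  (∀ c → j ≤ c → memS rest (p , c) ≡ false) →
  (∀ x → p < x → ∀ c → memS rest (x , c) ≡ interval 0 (l x) c) →
  ∀ f st → st ↭ block p j m (o , ks₀) ++ rest → columnSum st < f →
  ∃[ st′ ] ∃[ f′ ] rounds n f st ≡ rounds n f′ st′ × columnSum st′ < f′ ×
    st′ ↭ block t (l t) m (o , ks₀ ++ ks) ++ rest
falls {l = l} {d = d} {j} {m} p ks₀ (pass a φ) refl full 1≤m u b right under f st h lt =
  falls p ks₀ φ (sym (+-suc p (suc d))) full′ 1≤m u b right under f st h lt
  where
    full′ : ∀ x → 1 ≤ x → x < suc (suc d) → j + m ≤ l (p + x)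
    full′ x 1≤x x< with m≤n⇒m<n∨m≡n (s≤s⁻¹ x<)
    ... | inj₁ x<d = full x 1≤x x<d
    ... | inj₂ refl = a
falls {n} {l} {d = d} {suc j} {m} {rest = rest} {o} p ks₀ (land {ks = ks} a φ) refl full 1≤m u b right under (suc f) st h lt
  with Move.round n l rest p j m d o ks₀ right under full (<-trans a (n<1+n j)) 1≤m
         (≤-trans (≤-reflexive (+-suc (p + suc d) (j + m))) (fall-bound φ 1≤m u b)) f h
... | st₁ , eq , h₁ with falls (p + suc d) (ks₀ ++ suc d ∷ []) φ (sym (+-comm (p + suc d) 1))
        (λ { x (s≤s _) (s≤s ()) }) 1≤m u b
        (λ c j≤c → trans (under (p + suc d) p<q c) (interval-false-high {0} (<-≤-trans a j≤c)))
        (λ x q<x → under x (<-trans p<q q<x)) f st₁ h₁ small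
  where
    p<q : p < p + suc d
    p<q = ≤-trans (≤-reflexive (+-comm 1 p)) (+-monoʳ-≤ p (s≤s z≤n))
    small : columnSum st₁ < f
    small = <-≤-trans (subst₂ _<_ (trans (sym (columnSum-++ (block (p + suc d) j m _) rest)) (sym (columnSum-↭ h₁)))
                        (trans (sym (columnSum-++ (block p (suc j) m _) rest)) (sym (columnSum-↭ h)))
                        (+-monoˡ-< (columnSum rest) (columnSum-block-< p (p + suc d) j m _ _ 1≤m)))
                      (s≤s⁻¹ lt)
... | st′ , f′ , eq′ , lt′ , h′ = st′ , f′ , trans eq eq′ , lt′ ,
      subst (λ z → st′ ↭ block _ _ m (o , z) ++ rest) (++-assoc ks₀ (suc d ∷ []) ks) h′
falls {n} {l} {q = q} {d = d} {m = m} {rest = rest} {o} p ks₀ (stop refl) refl full 1≤m u b right under (suc f) st h lt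
  with Move.round n l rest p (l q) m d o ks₀ right under full (n<1+n (l q)) 1≤m
         (fall-bound {l = l} {d = d} {j = suc (l q)} (stop refl) 1≤m u b) f h
... | st₁ , eq , h₁ = st₁ , f , eq , small , h₁
  where
    small : columnSum st₁ < f
    small = <-≤-trans (subst₂ _<_ (trans (sym (columnSum-++ (block q (l q) m _) rest)) (sym (columnSum-↭ h₁)))
                        (trans (sym (columnSum-++ (block p (suc (l q)) m _) rest)) (sym (columnSum-↭ h)))
                        (+-monoˡ-< (columnSum rest) (columnSum-block-< p q (l q) m _ _ 1≤m)))
                      (s≤s⁻¹ lt)

-- Tagged states of a run and the executed algorithm

entries : ℕ → List ℕ → State
entries r = map (λ c → ((r , c) , (r , [])))

rowList : Row → ℕ → List ℕ
rowList S n = L.filterᵇ S (range n)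

range-suc : ∀ n → range (suc n) ≡ range n ++ [ suc n ]
range-suc n = trans (cong (map suc) (sym (upTo-∷ʳ n))) (map-++ suc (upTo n) [ n ])

filterᵇ-[] : ∀ (S : Row) c → L.filterᵇ S [ c ] ≡ (if S c then [ c ] else [])
filterᵇ-[] S c with S c
... | true = refl
... | false = refl

rowList-suc : ∀ S n → rowList S (suc n) ≡ rowList S n ++ (if S (suc n) then [ suc n ] else [])
rowList-suc S n = trans (cong (L.filterᵇ S) (range-suc n))
  (trans (filter-++ _ (range n) [ suc n ]) (cong (rowList S n ++_) (filterᵇ-[] S (suc n))))

rowList-cong : ∀ S S′ n → (∀ c → c ≤ n → S c ≡ S′ c) → rowList S n ≡ rowList S′ n
rowList-cong S S′ zero h = refl
rowList-cong S S′ (suc n) h = trans (rowList-suc S n) (trans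
  (cong₂ (λ xs b → xs ++ (if b then [ suc n ] else [])) (rowList-cong S S′ n (λ c p → h c (≤-trans p (n≤1+n n)))) (h (suc n) ≤-refl))
  (sym (rowList-suc S′ n)))

rowList-empty : ∀ S j b → (∀ c → j < c → S c ≡ false) → rowList S (j + b) ≡ rowList S j
rowList-empty S j zero h = cong (rowList S) (+-identityʳ j)
rowList-empty S j (suc b) h = trans (cong (rowList S) (+-suc j b)) (trans (rowList-suc S (j + b))
  (trans (cong (λ z → rowList S (j + b) ++ (if z then [ suc (j + b) ] else [])) (h (suc (j + b)) (s≤s (m≤m+n j b))))
    (trans (++-identityʳ _) (rowList-empty S j b h))))

columns-snoc : ∀ j b → columns j (suc b) ≡ columns j b ++ [ suc (j + b) ]
columns-snoc j zero = cong (λ z → [ suc z ]) (sym (+-identityʳ j))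
columns-snoc j (suc b) = cong (suc j ∷_) (trans (columns-snoc (suc j) b)
  (cong (λ z → columns (suc j) b ++ [ suc z ]) (sym (+-suc j b))))

rowList-full : ∀ S j b → (∀ c → j < c → c ≤ j + b → S c ≡ true) → rowList S (j + b) ≡ rowList S j ++ columns j b
rowList-full S j zero h = trans (cong (rowList S) (+-identityʳ j)) (sym (++-identityʳ _))
rowList-full S j (suc b) h = trans (cong (rowList S) (+-suc j b)) (trans (rowList-suc S (j + b))
  (trans (cong₂ (λ xs z → xs ++ (if z then [ suc (j + b) ] else []))
           (rowList-full S j b (λ c p q → h c p (≤-trans q (+-monoʳ-≤ j (n≤1+n b)))))
           (h (suc (j + b)) (s≤s (m≤m+n j b)) (≤-reflexive (sym (+-suc j b)))))
    (trans (++-assoc (rowList S j) (columns j b) _) (cong (rowList S j ++_) (sym (columns-snoc j b))))))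

rowList-appended : ∀ {S S′ j m} n → Appended S S′ j m → j + m ≤ n → rowList S n ≡ rowList S′ n ++ columns j m
rowList-appended {S} {S′} {j} {m} n A h = begin
  rowList S n                    ≡⟨ cong (rowList S) (sym (m+[n∸m]≡n h)) ⟩
  rowList S (j + m + (n ∸ (j + m))) ≡⟨ rowList-empty S (j + m) _ (λ c → Appended.beyond A) ⟩
  rowList S (j + m)              ≡⟨ rowList-full S j m (λ c → Appended.on-patch A) ⟩
  rowList S j ++ columns j m     ≡⟨ cong (_++ columns j m) (rowList-cong S S′ j (λ c → Appended.before A)) ⟩
  rowList S′ j ++ columns j m    ≡⟨ cong (_++ columns j m) (sym (rowList-empty S′ j (n ∸ j) (λ c p → Appended.bound A c (<⇒≤ p)))) ⟩
  rowList S′ (j + (n ∸ j)) ++ columns j m ≡⟨ cong (λ z → rowList S′ z ++ columns j m) (m+[n∸m]≡n (≤-trans (m≤m+n j m) h)) ⟩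
  rowList S′ n ++ columns j m    ∎
  where open ≡-Reasoning

aligned : ∀ {S k} → (∀ c → S c ≡ interval 0 k c) → Appended S (λ _ → false) 0 k
aligned h = record { union = h ; bound = λ _ _ → refl }

rowList-aligned : ∀ {S k} n → (∀ c → S c ≡ interval 0 k c) → k ≤ n → rowList S n ≡ columns 0 k
rowList-aligned n h k≤n = trans (rowList-appended n (aligned h) k≤n) (cong (_++ _) (rowList-empty (λ _ → false) 0 n (λ _ _ → refl)))

entries-columns : ∀ r j m → entries r (columns j m) ≡ block r j m (r , [])
entries-columns r j zero = refl
entries-columns r j (suc m) = cong (_ ∷_) (entries-columns r (suc j) m)

memS-entries : ∀ r S xs {x c} → S c ≡ false → memS (entries r (L.filterᵇ S xs)) (x , c) ≡ false
memS-entries r S [] e = refl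
memS-entries r S (y ∷ xs) {x} {c} e with S y in e′
... | true = ∨-false (posEq-col {r} {y} {x} {c} (λ { refl → true≢false e′ e })) (memS-entries r S xs e)
... | false = memS-entries r S xs e

memS-entries-row : ∀ r xs {x c} → r ≢ x → memS (entries r xs) (x , c) ≡ false
memS-entries-row r [] h = refl
memS-entries-row r (y ∷ xs) {x} {c} h = ∨-false (posEq-row {r} {y} {x} {c} h) (memS-entries-row r xs h)

tagged : Index → State → ℕ
tagged e = count (λ x → indexEq (proj₂ x) e)

tagged-↭ : ∀ e {xs ys} → xs ↭ ys → tagged e xs ≡ tagged e ys
tagged-↭ e h = ↭-length (filter-↭ _ h)

tagged-++ : ∀ e xs ys → tagged e (xs ++ ys) ≡ tagged e xs + tagged e ys
tagged-++ e xs ys = trans (cong length (filter-++ _ xs ys)) (length-++ (L.filterᵇ _ xs))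

tagged-block : ∀ e r j m tag → tagged e (block r j m tag) ≡ (if indexEq tag e then m else 0)
tagged-block e r j m tag with indexEq tag e in eq
... | true = go j m
  where go : ∀ j m → tagged e (block r j m tag) ≡ m
        go j zero = refl
        go j (suc m) rewrite eq = cong suc (go (suc j) m)
... | false = go j m
  where go : ∀ j m → tagged e (block r j m tag) ≡ 0
        go j zero = refl
        go j (suc m) rewrite eq = go (suc j) m

module _ {n : ℕ} {D : ℕ → Row} {lf : ℕ → ℕ} (bounded : Bounded n lf) where

  upper : ℕ → State
  upper zero = []
  upper (suc i) = upper i ++ entries (suc i) (rowList (D (suc i)) n)

  todo : ℕ → Row → State
  todo zero S = []
  todo (suc i) S = upper i ++ entries (suc i) (rowList S n)

  upper-todo : ∀ i → upper i ≡ todo i (D i)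
  upper-todo zero = refl
  upper-todo (suc i) = refl

  memS-upper : ∀ i {x c} → i < x → memS (upper i) (x , c) ≡ false
  memS-upper zero h = refl
  memS-upper (suc i) h = memS-neither (upper i) _ _ (memS-upper i (<⇒≤ h)) (memS-entries-row (suc i) (rowList (D (suc i)) n) (<⇒≢ h))

  record Lower (i : ℕ) (l : ℕ → ℕ) (st : State) : Set where
    field
      inside  : ∀ x c → i < x → memS st (x , c) ≡ interval 0 (l x) c
      outside : ∀ x c → x ≤ i → memS st (x , c) ≡ false

  -- `lower` collects the crosses that have become left-aligned. A `row` step hands it the remainder
  -- of the current row, whose tags have no moves and are counted by no index; a `patch` step hands
  -- it the landed block, with the index of the event as tag.
  run-rounds : ∀ {i S l es} → Run D lf i S l es → ∀ lower → Lower i l lower →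
    ∀ f st → st ↭ todo i S ++ lower → columnSum st < f →
    ∃[ st′ ] rounds n f st ≡ just st′ ×
      (∀ a k ks → tagged (a , k ∷ ks) st′ ≡ tagged (a , k ∷ ks) lower + sumEvents (λ e → indexEq e (a , k ∷ ks)) es)
  run-rounds {l = l} (done _) lower low (suc f) st h lt =
    st , eqn , λ a k ks → trans (tagged-↭ (a , k ∷ ks) h) (sym (+-identityʳ _))
    where
      neighbour : ∀ r c t → ((r , suc (suc c)) , t) ∈ st → memS st (r , suc c) ≡ true
      neighbour zero c t i = ⊥-elim (true≢false (memS-∈ (∈-resp-↭ h i)) (Lower.outside low 0 _ z≤n))
      neighbour (suc r) c t i = trans (memS-↭ h _) (trans (Lower.inside low (suc r) (suc c) z<s)
        (interval-true z<s (≤-trans (n≤1+n _) (proj₂ (interval-true⁻ {0} {l (suc r)}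
          (trans (sym (Lower.inside low (suc r) (suc (suc c)) z<s)) (memS-∈ (∈-resp-↭ h i))))))))
      eqn : rounds n (suc f) st ≡ just st
      eqn rewrite candidate-nothing st neighbour = refl
  run-rounds {suc i} {S} {l} (row h₀ ρ) lower low f st h lt
    with run-rounds ρ lower′ low′ f st h′ lt
    where
      l≤n : l (suc i) ≤ n
      l≤n with l (suc i) in eq | run-bounded ρ bounded (suc i)
      ... | zero | _ = z≤n
      ... | suc k | b = ≤-trans (m≤n+m (suc k) (suc i)) (b z<s)
      aligned-part = block (suc i) 0 (l (suc i)) (suc i , [])
      lower′ = aligned-part ++ lower
      h′ : st ↭ todo i (D i) ++ lower′
      h′ = ↭-trans h (Perm.↭-reflexive (trans (++-assoc (upper i) _ lower)
        (cong₂ _++_ (upper-todo i) (cong (_++ lower)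
          (trans (cong (entries (suc i)) (rowList-aligned n h₀ l≤n)) (entries-columns (suc i) 0 (l (suc i))))))))
      low′ : Lower i l lower′
      low′ = record
        { inside = inside′
        ; outside = λ x c p → memS-neither aligned-part lower _
            (memS-block-row (suc i) 0 (l (suc i)) (suc i , []) {x} {c} (>⇒≢ (s≤s p))) (Lower.outside low x c (≤-trans p (n≤1+n i))) }
        where
          inside′ : ∀ x c → i < x → memS lower′ (x , c) ≡ interval 0 (l x) c
          inside′ x c p with m≤n⇒m<n∨m≡n p
          ... | inj₁ lt′ = trans (memS-++ aligned-part lower (x , c))
                (trans (cong (_∨ memS lower (x , c)) (memS-block-row (suc i) 0 (l (suc i)) (suc i , []) {x} {c} (<⇒≢ lt′))) (Lower.inside low x c lt′))
          ... | inj₂ refl with c | c ≤? l (suc i)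
          ...   | zero | _ = memS-neither aligned-part lower _ (memS-block-low (suc i) 0 (l (suc i)) (suc i , []) {suc i} {0} z≤n) (Lower.outside low (suc i) 0 ≤-refl)
          ...   | suc c | yes q = trans (memS-left aligned-part lower _ (memS-block-true (suc i) 0 (l (suc i)) (suc i , []) z<s q))
                                     (sym (interval-true {0} z<s q))
          ...   | suc c | no q = trans (memS-neither aligned-part lower _ (memS-block-high (suc i) 0 (l (suc i)) (suc i , []) {suc i} {suc c} (≰⇒> q)) (Lower.outside low (suc i) (suc c) ≤-refl))
                                     (sym (interval-false-high {0} (≰⇒> q)))
  ... | st′ , eq , ts = st′ , eq , λ a k ks → trans (ts a k ks) (cong (_+ _)
        (trans (tagged-++ (a , k ∷ ks) (block (suc i) 0 (l (suc i)) (suc i , [])) lower)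
          (cong (_+ tagged (a , k ∷ ks) lower) (trans (tagged-block (a , k ∷ ks) (suc i) 0 (l (suc i)) (suc i , []))
            (cong (λ z → if z then l (suc i) else 0) (∧-zeroʳ (suc i ≡ᵇ a)))))))
  run-rounds {suc i} {S} {l} (patch {S′ = S′} {l′ = l′} {j} {m} {ks₀} {t} {es} 1≤m A φ u ρ) lower low f st h lt
    with falls {rest = todo (suc i) S′ ++ lower} {o = suc i} (suc i) [] φ (+-comm 1 (suc i)) (λ { x (s≤s _) (s≤s ()) }) 1≤m u
           (run-bounded ρ bounded) right under f st h₁ lt
    where
      patch≤n : j + m ≤ n
      patch≤n = ≤-trans (m≤n+m (j + m) (suc i)) (s≤s⁻¹ (fall-bound φ 1≤m u (run-bounded ρ bounded)))
      h₁ : st ↭ block (suc i) j m (suc i , []) ++ (todo (suc i) S′ ++ lower)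
      h₁ = ↭-trans h (↭-trans (Perm.↭-reflexive (trans (cong (λ z → (upper i ++ z) ++ lower)
             (trans (cong (entries (suc i)) (rowList-appended n A patch≤n))
               (trans (map-++ _ (rowList S′ n) (columns j m)) (cong (entries (suc i) (rowList S′ n) ++_) (entries-columns (suc i) j m)))))
             (trans (cong (_++ lower) (sym (++-assoc (upper i) _ _))) (++-assoc (todo (suc i) S′) _ lower))))
           (shifts (todo (suc i) S′) (block (suc i) j m (suc i , []))))
      right : ∀ c → j ≤ c → memS (todo (suc i) S′ ++ lower) (suc i , c) ≡ false
      right c p = memS-neither (todo (suc i) S′) lower _ (memS-neither (upper i) _ _ (memS-upper i ≤-refl)
        (memS-entries (suc i) S′ (range n) (Appended.bound A c p))) (Lower.outside low (suc i) c ≤-refl)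
      under : ∀ x → suc i < x → ∀ c → memS (todo (suc i) S′ ++ lower) (x , c) ≡ interval 0 (l x) c
      under x p c = trans (memS-++ (todo (suc i) S′) lower _) (trans (cong (_∨ memS lower (x , c))
        (memS-neither (upper i) _ _ (memS-upper i (<⇒≤ p)) (memS-entries-row (suc i) (rowList S′ n) (<⇒≢ p)))) (Lower.inside low x c p))
  ... | st₁ , f₁ , eq₁ , lt₁ , h₁
    with run-rounds ρ (block t (l t) m (suc i , ks₀) ++ lower) low′ f₁ st₁
           (↭-trans h₁ (shifts (block t (l t) m (suc i , ks₀)) (todo (suc i) S′))) lt₁
    where
      lower′ = block t (l t) m (suc i , ks₀) ++ lower
      low′ : Lower (suc i) l′ lower′
      low′ = record
        { inside = inside′
        ; outside = λ x c p → memS-neither (block t (l t) m _) lower _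
            (memS-block-row t (l t) m _ (>⇒≢ (≤-<-trans p (fall-≥ φ)))) (Lower.outside low x c p) }
        where
          inside′ : ∀ x c → suc i < x → memS lower′ (x , c) ≡ interval 0 (l′ x) c
          inside′ x c p with x ≟ t
          ... | no ne = trans (memS-++ (block t (l t) m _) lower (x , c))
                (trans (cong₂ _∨_ (memS-block-row t (l t) m _ (λ e → ne (sym e))) (Lower.inside low x c p))
                  (cong (λ z → interval 0 z c) (sym (proj₂ u x ne))))
          ... | yes refl rewrite proj₁ u with c ≤? l t | c ≤? l t + m
          ...   | yes q | _ = trans (memS-++ (block t (l t) m _) lower (t , c))
                  (trans (cong₂ _∨_ (memS-block-low t (l t) m _ q) (Lower.inside low t c p)) (initial c q))
            where initial : ∀ c → c ≤ l t → interval 0 (l t) c ≡ interval 0 (l t + m) c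
                  initial zero q = refl
                  initial (suc c) q = trans (interval-true {0} z<s q) (sym (interval-true {0} z<s (≤-trans q (m≤m+n _ m))))
          ...   | no q | yes q′ = trans (memS-left (block t (l t) m _) lower _ (memS-block-true t (l t) m _ (≰⇒> q) q′))
                  (sym (interval-true {0} (≤-<-trans z≤n (≰⇒> q)) q′))
          ...   | no q | no q′ = trans (memS-neither (block t (l t) m _) lower _ (memS-block-high t (l t) m _ (≰⇒> q′))
                    (trans (Lower.inside low t c p) (interval-false-high {0} (≰⇒> q))))
                  (sym (interval-false-high {0} (≰⇒> q′)))
  ...   | st′ , eq , ts = st′ , trans eq₁ eq , λ a k ks → trans (ts a k ks)
          (trans (cong (_+ sumEvents (λ e → indexEq e (a , k ∷ ks)) es)
            (trans (tagged-++ (a , k ∷ ks) (block t (l t) m (suc i , ks₀)) lower)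
              (trans (cong (_+ tagged (a , k ∷ ks) lower) (tagged-block (a , k ∷ ks) t (l t) m (suc i , ks₀)))
                (+-comm _ (tagged (a , k ∷ ks) lower)))))
            (+-assoc (tagged (a , k ∷ ks) lower) _ _))

-- Encodings and weights

indexEq-steps : ∀ i ks ks′ → indexEq (i , ks) (i , ks′) ≡ true → ks ≡ ks′
indexEq-steps i [] [] h = refl
indexEq-steps i [] (k ∷ ks) h rewrite dec-true (i ≟ i) refl = contradiction h λ ()
indexEq-steps i (k ∷ ks) [] h rewrite dec-true (i ≟ i) refl = contradiction h λ ()
indexEq-steps i (k ∷ ks) (k′ ∷ ks′) h with k ≟ k′
... | no ¬p rewrite dec-true (i ≟ i) refl | dec-false (k ≟ k′) ¬p = contradiction h λ ()
... | yes refl = cong (k ∷_) (indexEq-steps i ks ks′ tail)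
  where tail : indexEq (i , ks) (i , ks′) ≡ true
        tail rewrite dec-true (i ≟ i) refl | dec-true (k ≟ k) refl = h

indexEq-sound : ∀ e e′ → indexEq e e′ ≡ true → e ≡ e′
indexEq-sound (i , ks) (i′ , ks′) h with i ≟ i′
... | no ¬p rewrite dec-false (i ≟ i′) ¬p = contradiction h λ ()
... | yes refl = cong (i ,_) (indexEq-steps i ks ks′ h)

indexEq-refl : ∀ e → indexEq e e ≡ true
indexEq-refl (i , []) rewrite dec-true (i ≟ i) refl = refl
indexEq-refl (i , k ∷ ks) with indexEq-refl (i , ks)
... | h rewrite dec-true (i ≟ i) refl | dec-true (k ≟ k) refl = h

indexEq-≢ : ∀ {e e′} → e ≢ e′ → indexEq e e′ ≡ false
indexEq-≢ {e} {e′} ne with indexEq e e′ in eq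
... | true = contradiction (indexEq-sound e e′ eq) ne
... | false = refl

crossTags : List Pos → State
crossTags = map (λ p → (p , (proj₁ p , [])))

module _ {n : ℕ} (G : Grid n) {lf : ℕ → ℕ} (bounded : Bounded n lf) where

  crossList-upper : ∀ i → crossTags (concatMap (λ r → map (λ c → (r , c)) (L.filterᵇ (cell G r) (range n))) (range i))
                        ≡ upper {D = cell G} bounded i
  crossList-upper zero = refl
  crossList-upper (suc i) = begin
    crossTags (concatMap cr (range (suc i)))                     ≡⟨ cong (λ z → crossTags (concatMap cr z)) (range-suc i) ⟩
    crossTags (concatMap cr (range i ++ [ suc i ]))              ≡⟨ cong crossTags (concatMap-++ cr (range i) [ suc i ]) ⟩
    crossTags (concatMap cr (range i) ++ (cr (suc i) ++ []))     ≡⟨ map-++ _ (concatMap cr (range i)) _ ⟩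
    crossTags (concatMap cr (range i)) ++ crossTags (cr (suc i) ++ []) ≡⟨ cong₂ (λ a b → a ++ crossTags b) (crossList-upper i) (++-identityʳ _) ⟩
    upper bounded i ++ crossTags (cr (suc i))                    ≡⟨ cong (upper bounded i ++_) (sym (map-∘ _)) ⟩
    upper bounded (suc i)                                        ∎
    where open ≡-Reasoning
          cr : ℕ → List Pos
          cr r = map (λ c → (r , c)) (L.filterᵇ (cell G r) (range n))

  columnSum-entries : ∀ r (S : Row) xs → All (_≤ n) xs → columnSum (entries r (L.filterᵇ S xs)) ≤ length xs * n
  columnSum-entries r S [] [] = z≤n
  columnSum-entries r S (y ∷ xs) (h ∷ hs) with S y
  ... | true = +-mono-≤ h (columnSum-entries r S xs hs)
  ... | false = ≤-trans (columnSum-entries r S xs hs) (m≤n+m _ n)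

  range-≤ : All (_≤ n) (range n)
  range-≤ = AllP.map⁺ (AllP.applyUpTo⁺₁ id n id)

  -- With i = n this shows that the fuel `suc (n * n * n)` of `encode` exceeds the measure: at most
  -- n crosses in each of n rows, each in a column of at most n.
  columnSum-upper : ∀ i → columnSum (upper {D = cell G} bounded i) ≤ i * (n * n)
  columnSum-upper zero = z≤n
  columnSum-upper (suc i) = ≤-trans (≤-reflexive (columnSum-++ (upper bounded i) _))
    (≤-trans (+-mono-≤ (columnSum-upper i)
      (≤-trans (columnSum-entries (suc i) (cell G (suc i)) (range n) range-≤)
        (≤-reflexive (cong (_* n) (trans (length-map suc (upTo n)) (length-upTo n))))))
    (≤-reflexive (+-comm (i * (n * n)) (n * n))))

  run-encode : ∀ {l es} → Run (cell G) lf n (cell G n) l es →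
    ∃[ x ] encode G ≡ just x × (∀ a → x (a , []) ≡ 0) ×
      (∀ a k ks → x (a , k ∷ ks) ≡ sumEvents (λ e → indexEq e (a , k ∷ ks)) es)
  run-encode {l} ρ with run-rounds bounded ρ [] low (suc (n * n * n)) (crossTags (crossList G)) perm small
    where
      low : Lower {D = cell G} bounded n l []
      low = record { inside = inside ; outside = λ _ _ _ → refl }
        where
          inside : ∀ x c → n < x → false ≡ interval 0 (l x) c
          inside x c p with l x | run-bounded ρ bounded x
          ... | suc k | b = contradiction (≤-trans (m≤m+n x (suc k)) (b z<s)) (<⇒≱ p)
          inside x zero p | zero | b = refl
          inside x (suc c) p | zero | b = refl
      perm : crossTags (crossList G) ↭ todo bounded n (cell G n) ++ []
      perm = Perm.↭-reflexive (trans (crossList-upper n) (trans (upper-todo bounded n) (sym (++-identityʳ _))))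
      small : columnSum (crossTags (crossList G)) < suc (n * n * n)
      small = s≤s (≤-trans (≤-reflexive (cong columnSum (crossList-upper n)))
                (≤-trans (columnSum-upper n) (≤-reflexive (sym (*-assoc n n n)))))
  ... | st , eq , ts = tally st , eqn , (λ _ → refl) , ts
    where eqn : encode G ≡ just (tally st)
          eqn rewrite eq = refl

length-columns : ∀ j m → length (columns j m) ≡ m
length-columns j zero = refl
length-columns j (suc m) = cong suc (length-columns (suc j) m)

-- Patches land strictly below their origin, so the length of row r is not changed while row r or a
-- row above it is processed. The crosses of row r are its initial run together with the patches
-- starting there.
run-weight : ∀ {n D lf i S l es} → Run D lf i S l es → Bounded n lf → ∀ r → 1 ≤ r →
  (r < i → length (rowList (D r) n) ≡ l r + sumEvents (λ e → proj₁ e ≡ᵇ r) es) ×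
  (r ≡ i → length (rowList S n) ≡ l r + sumEvents (λ e → proj₁ e ≡ᵇ r) es)
run-weight (done _) b r p = (λ ()) , (λ { refl → contradiction p λ () })
run-weight {n} {D} {S = S} {l} {es} (row {i = i} h ρ) b r p = (λ q → earlier (m≤n⇒m<n∨m≡n (s≤s⁻¹ q))) , λ { refl → last }
  where
    earlier : r < i ⊎ r ≡ i → length (rowList (D r) n) ≡ l r + sumEvents (λ e → proj₁ e ≡ᵇ r) es
    earlier (inj₁ q) = proj₁ (run-weight ρ b r p) q
    earlier (inj₂ refl) = proj₂ (run-weight ρ b r p) refl
    l≤n : l (suc i) ≤ n
    l≤n with l (suc i) | run-bounded ρ b (suc i)
    ... | zero | _ = z≤n
    ... | suc k | b′ = ≤-trans (m≤n+m (suc k) (suc i)) (b′ z<s)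
    last : length (rowList S n) ≡ l (suc i) + sumEvents (λ e → proj₁ e ≡ᵇ suc i) es
    last = trans (cong length (rowList-aligned n h l≤n)) (trans (length-columns 0 (l (suc i)))
      (trans (sym (+-identityʳ _)) (cong (l (suc i) +_) (sym (sumEvents-none _ es
        (All.map (λ {e} q → dec-false (proj₁ (proj₁ e) ≟ suc i) (<⇒≢ (s≤s q))) (run-index ρ)))))))
run-weight {n} {D} {S = S} {l = l} (patch {i = i} {S′ = S′} {l′ = l′} {j} {m} {ks} {t} {es} 1≤m A f u ρ) b r p = earlier , λ { refl → last }
  where
    keep : ∀ {r} → r ≤ suc i → l′ r ≡ l r
    keep {r} q = proj₂ u r (<⇒≢ (≤-<-trans q (fall-≥ f)))
    earlier : r < suc i → length (rowList (D r) n) ≡ l r + ((if suc i ≡ᵇ r then m else 0) + sumEvents (λ e → proj₁ e ≡ᵇ r) es)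
    earlier q rewrite dec-false (suc i ≟ r) (>⇒≢ q) =
      trans (proj₁ (run-weight ρ b r p) q) (cong (_+ sumEvents (λ e → proj₁ e ≡ᵇ r) es) (keep (<⇒≤ q)))
    last : length (rowList S n) ≡ l (suc i) + ((if suc i ≡ᵇ suc i then m else 0) + sumEvents (λ e → proj₁ e ≡ᵇ suc i) es)
    last rewrite dec-true (suc i ≟ suc i) refl = begin
      length (rowList S n)                     ≡⟨ cong length (rowList-appended {S} n A (≤-trans (m≤n+m (j + m) (suc i)) (s≤s⁻¹ (fall-bound f 1≤m u (run-bounded ρ b))))) ⟩
      length (rowList S′ n ++ columns j m)     ≡⟨ length-++ (rowList S′ n) ⟩
      length (rowList S′ n) + length (columns j m) ≡⟨ cong₂ _+_ (proj₂ (run-weight ρ b (suc i) (s≤s z≤n)) refl) (length-columns j m) ⟩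
      l′ (suc i) + E + m                       ≡⟨ +-assoc (l′ (suc i)) E m ⟩
      l′ (suc i) + (E + m)                     ≡⟨ cong₂ _+_ (keep ≤-refl) (+-comm E m) ⟩
      l (suc i) + (m + E)                      ∎
      where open ≡-Reasoning
            E = sumEvents (λ e → proj₁ e ≡ᵇ suc i) es

-- The enumeration of the index set.

range-∈ : ∀ {k m} → 1 ≤ k → k ≤ m → k ∈ range m
range-∈ {suc k} _ h = ∈-map⁺ suc (∈-upTo⁺ h)

∈-concat : ∀ {A B : Set} (f : A → List B) {x xs y} → x ∈ xs → y ∈ f x → y ∈ concatMap f xs
∈-concat f {y = y} p q = ∈-concatMap⁺ f (Any.map (λ { refl → q }) p)

seqs-∈ : ∀ {m ks} → All (1 ≤_) ks → sum ks ≤ m → ks ∈ seqs (length ks) m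
seqs-∈ [] h = here refl
seqs-∈ {m} {k ∷ ks} (p ∷ ps) h = ∈-concat (λ k → map (k ∷_) (seqs (length ks) m))
  (range-∈ p (≤-trans (m≤m+n k _) h)) (∈-map⁺ (k ∷_) (seqs-∈ ps (≤-trans (m≤n+m _ k) h)))

length-≤-sum : ∀ {ks} → All (1 ≤_) ks → length ks ≤ sum ks
length-≤-sum [] = z≤n
length-≤-sum (p ∷ ps) = +-mono-≤ p (length-≤-sum ps)

Lenum-∈ : ∀ {m e} → InL m e → e ∈ Lenum m
Lenum-∈ {m} {i , ks} h@(1≤i , 1≤ks , pos , abs) = ∈-filter⁺ (InL? m)
  (∈-concat _ (range-∈ 1≤i (≤-trans (m≤m+n i _) abs))
    (∈-concat _ (range-∈ 1≤ks (≤-trans (length-≤-sum pos) sum≤))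
      (∈-map⁺ (i ,_) (seqs-∈ pos sum≤)))) h
  where sum≤ = ≤-trans (m≤n+m (sum ks) i) abs

Lenum-InL : ∀ m → All (InL m) (Lenum m)
Lenum-InL m = AllP.all-filter (InL? m)
  (concatMap (λ i → concatMap (λ ℓ → map (λ ks → (i , ks)) (seqs ℓ m)) (range m)) (range m))

concatMap-unique : ∀ {A B : Set} (f : A → List B) {xs} → (∀ x → Unique (f x)) →
  (∀ {x y z} → z ∈ f x → z ∈ f y → x ≡ y) → Unique xs → Unique (concatMap f xs)
concatMap-unique f u d [] = []
concatMap-unique f {x ∷ xs} u d (h ∷ hs) = Uniq.++⁺ (u x) (concatMap-unique f u d hs) disjoint
  where
    disjoint : ∀ {z} → z ∈ f x × z ∈ concatMap f xs → ⊥
    disjoint {z} (p , q) = AllP.All¬⇒¬Any h (Any.map (λ r → d p r) (∈-concatMap⁻ f q))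

range-unique : ∀ m → Unique (range m)
range-unique m = Uniq.map⁺ suc-injective (Uniq.upTo⁺ m)

seqs-length : ∀ ℓ {m ks} → ks ∈ seqs ℓ m → length ks ≡ ℓ
seqs-length zero (here refl) = refl
seqs-length (suc ℓ) {m} p with satisfied (∈-concatMap⁻ (λ k → map (k ∷_) (seqs ℓ m)) {xs = range m} p)
... | k , q with ∈-map⁻ (k ∷_) q
...   | ks , q′ , refl = cong suc (seqs-length ℓ q′)

seqs-unique : ∀ ℓ m → Unique (seqs ℓ m)
seqs-unique zero m = [] ∷ []
seqs-unique (suc ℓ) m = concatMap-unique _ (λ k → Uniq.map⁺ (λ { refl → refl }) (seqs-unique ℓ m)) heads (range-unique m)
  where
    heads : ∀ {x y z} → z ∈ map (x ∷_) (seqs ℓ m) → z ∈ map (y ∷_) (seqs ℓ m) → x ≡ y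
    heads p q with ∈-map⁻ _ p | ∈-map⁻ _ q
    ... | _ , _ , refl | _ , _ , refl = refl

Lenum-unique : ∀ m → Unique (Lenum m)
Lenum-unique m = Uniq.filter⁺ (InL? m) (concatMap-unique _
  (λ i → concatMap-unique _ (λ ℓ → Uniq.map⁺ (λ { refl → refl }) (seqs-unique ℓ m)) (lengths i) (range-unique m))
  origins (range-unique m))
  where
    lengths : ∀ i {x y z} → z ∈ map (i ,_) (seqs x m) → z ∈ map (i ,_) (seqs y m) → x ≡ y
    lengths i {x} {y} p q with ∈-map⁻ _ p | ∈-map⁻ _ q
    ... | _ , p′ , refl | _ , q′ , refl = trans (sym (seqs-length x p′)) (seqs-length y q′)
    inner : ℕ → List Index
    inner i = concatMap (λ ℓ → map (i ,_) (seqs ℓ m)) (range m)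
    origin : ∀ i {z} → z ∈ inner i → proj₁ z ≡ i
    origin i p with satisfied (∈-concatMap⁻ (λ ℓ → map (i ,_) (seqs ℓ m)) {xs = range m} p)
    ... | ℓ , q with ∈-map⁻ _ q
    ...   | _ , _ , refl = refl
    origins : ∀ {x y z} → z ∈ inner x → z ∈ inner y → x ≡ y
    origins {x} {y} p q = trans (sym (origin x p)) (origin y q)

sumWhere-cong : ∀ p x y xs → All (λ e → x e ≡ y e) xs → sumWhere p x xs ≡ sumWhere p y xs
sumWhere-cong p x y [] [] = refl
sumWhere-cong p x y (e ∷ xs) (h ∷ hs) with p e
... | true = cong₂ _+_ h (sumWhere-cong p x y xs hs)
... | false = sumWhere-cong p x y xs hs

sumWhere-zero : ∀ p xs → sumWhere p (λ _ → 0) xs ≡ 0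
sumWhere-zero p [] = refl
sumWhere-zero p (e ∷ xs) with p e
... | true = sumWhere-zero p xs
... | false = sumWhere-zero p xs

sumWhere-+ : ∀ p x y xs → sumWhere p (λ e → x e + y e) xs ≡ sumWhere p x xs + sumWhere p y xs
sumWhere-+ p x y [] = refl
sumWhere-+ p x y (e ∷ xs) with p e
... | false = sumWhere-+ p x y xs
... | true = begin
  x e + y e + sumWhere p (λ e → x e + y e) xs ≡⟨ cong (x e + y e +_) (sumWhere-+ p x y xs) ⟩
  x e + y e + (X + Y)     ≡⟨ +-assoc (x e) (y e) (X + Y) ⟩
  x e + (y e + (X + Y))   ≡⟨ cong (x e +_) (trans (sym (+-assoc (y e) X Y)) (trans (cong (_+ Y) (+-comm (y e) X)) (+-assoc X (y e) Y))) ⟩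
  x e + (X + (y e + Y))   ≡⟨ sym (+-assoc (x e) X (y e + Y)) ⟩
  x e + X + (y e + Y)     ∎
  where open ≡-Reasoning
        X = sumWhere p x xs
        Y = sumWhere p y xs

sumWhere-indicator-∉ : ∀ p e m xs → All (e ≢_) xs → sumWhere p (λ e′ → if indexEq e e′ then m else 0) xs ≡ 0
sumWhere-indicator-∉ p e m [] [] = refl
sumWhere-indicator-∉ p e m (e′ ∷ xs) (h ∷ hs) with p e′
... | true rewrite indexEq-≢ h = sumWhere-indicator-∉ p e m xs hs
... | false = sumWhere-indicator-∉ p e m xs hs

sumWhere-indicator : ∀ p e m {xs} → Unique xs → e ∈ xs →
  sumWhere p (λ e′ → if indexEq e e′ then m else 0) xs ≡ (if p e then m else 0)
sumWhere-indicator p e m {.e ∷ xs} (h ∷ hs) (here refl) with p e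
... | true rewrite indexEq-refl e = trans (cong (m +_) (sumWhere-indicator-∉ p e m xs h)) (+-identityʳ m)
... | false = sumWhere-indicator-∉ p e m xs h
sumWhere-indicator p e m {e′ ∷ xs} (h ∷ hs) (there i) with p e′ in eq
... | true rewrite indexEq-≢ {e} {e′} (λ { refl → AllP.All¬⇒¬Any h i }) = sumWhere-indicator p e m hs i
... | false = sumWhere-indicator p e m hs i

-- Exchange of summation: the index of each event occurs exactly once in `xs`.
sumWhere-events : ∀ p {xs} → Unique xs → ∀ es → All (λ e → proj₁ e ∈ xs) es →
  sumWhere p (λ e′ → sumEvents (λ e → indexEq e e′) es) xs ≡ sumEvents p es
sumWhere-events p {xs} u [] [] = sumWhere-zero p xs
sumWhere-events p {xs} u ((e , m) ∷ es) (h ∷ hs) =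
  trans (sumWhere-+ p (λ e′ → if indexEq e e′ then m else 0) _ xs)
    (cong₂ _+_ (sumWhere-indicator p e m u h) (sumWhere-events p u es hs))

-- Common crosses of pipes

lastElbow-cross : ∀ S b {c} → lastElbow S b < c → c ≤ b → S c ≡ true
lastElbow-cross S zero p q = contradiction p (≤⇒≯ q)
lastElbow-cross S (suc b) {c} p q with S (suc b) in eq
... | false = contradiction p (≤⇒≯ q)
... | true with m≤n⇒m<n∨m≡n q
...   | inj₁ lt = lastElbow-cross S b p (s≤s⁻¹ lt)
...   | inj₂ refl = eq

lastElbow-false : ∀ S b → 0 < lastElbow S b → S (lastElbow S b) ≡ false
lastElbow-false S zero ()
lastElbow-false S (suc b) p with S (suc b) in eq
... | true = lastElbow-false S b p
... | false = eq

lastElbow-within : ∀ S b {c} → lastElbow S b < c → c ≤ b → lastElbow S c ≡ lastElbow S b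
lastElbow-within S b {c} p q = trans (sym (lastElbow-run S c (b ∸ c)
    (λ d lo hi → lastElbow-cross S b (<-trans p lo) (≤-trans hi (≤-reflexive (m+[n∸m]≡n q))))))
  (cong (lastElbow S) (m+[n∸m]≡n q))

leftCrosses-∈ : ∀ r S b {c} → lastElbow S b < c → c ≤ b → (r , c) ∈ leftCrosses r S b
leftCrosses-∈ r S zero p q = contradiction p (≤⇒≯ q)
leftCrosses-∈ r S (suc b) {c} p q with S (suc b) in eq
... | false = contradiction p (≤⇒≯ q)
... | true with m≤n⇒m<n∨m≡n q
...   | inj₁ lt = ∈-++⁺ˡ (leftCrosses-∈ r S b p (s≤s⁻¹ lt))
...   | inj₂ refl = ∈-++⁺ʳ (leftCrosses r S b) (here refl)

-- The vertical pipe in column c meets the horizontal one entering at c′.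
descend-over : ∀ r S {c c′} → c < c′ → descend S c′ < c →
  S c ≡ true × (r , c) ∈ rowCrosses r S c′ × lastElbow S c ≡ descend S c′
descend-over r S {c} {suc c′} lt p with S (suc c′)
... | true = contradiction p (<-asym lt)
... | false = lastElbow-cross S c′ p (s≤s⁻¹ lt) , leftCrosses-∈ r S c′ p (s≤s⁻¹ lt) , lastElbow-within S c′ p (s≤s⁻¹ lt)

descend-inj : ∀ S {c c′} → c < c′ → descend S c ≡ descend S c′ → 0 < descend S c → ⊥
descend-inj S {suc c} {suc c′} lt e p with S (suc c) in eq | S (suc c′) in eq′
... | true | true = <⇒≢ lt e
... | true | false = true≢false eq (subst (λ z → S z ≡ false) (sym e) (lastElbow-false S c′ (subst (0 <_) e p)))
... | false | true = <⇒≱ lt (≤-trans (≤-reflexive (sym e)) (≤-trans (lastElbow-≤ S c) (n≤1+n c)))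
... | false | false = <⇒≱ (lastElbow-last lt) (≤-trans (≤-reflexive (sym e)) (lastElbow-≤ S c))
  where
    lastElbow-last : suc c < suc c′ → c < lastElbow S c′
    lastElbow-last q with suc c ≤? lastElbow S c′
    ... | yes r = r
    ... | no ¬r = ⊥-elim (true≢false (lastElbow-cross S c′ (≰⇒> ¬r) (s≤s⁻¹ q)) eq)

common : List Pos → List Pos → ℕ
common xs ys = count (λ p → elemP p ys) xs

elemP-++ : ∀ p xs ys → elemP p (xs ++ ys) ≡ (elemP p xs ∨ elemP p ys)
elemP-++ p [] ys = refl
elemP-++ p (x ∷ xs) ys = trans (cong (posEq p x ∨_) (elemP-++ p xs ys)) (sym (∨-assoc (posEq p x) _ _))

elemP-∈ : ∀ {p xs} → p ∈ xs → elemP p xs ≡ true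
elemP-∈ {p} (here refl) rewrite posEq-refl p = refl
elemP-∈ {p} {x ∷ xs} (there h) = trans (cong (posEq p x ∨_) (elemP-∈ h)) (∨-zeroʳ _)

elemP-∉ : ∀ p xs → All (p ≢_) xs → elemP p xs ≡ false
elemP-∉ p [] [] = refl
elemP-∉ p (x ∷ xs) (h ∷ hs) = ∨-false (posEq≢ h) (elemP-∉ p xs hs)
  where posEq≢ : p ≢ x → posEq p x ≡ false
        posEq≢ h with posEq p x in eq
        ... | true = contradiction (posEq-sound p x eq) h
        ... | false = refl

common-++ : ∀ xs xs′ ys → common (xs ++ xs′) ys ≡ common xs ys + common xs′ ys
common-++ xs xs′ ys = trans (cong length (filter-++ _ xs xs′)) (length-++ (L.filterᵇ _ xs))

common-∈ : ∀ {p xs ys} → p ∈ xs → p ∈ ys → 1 ≤ common xs ys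
common-∈ {p} {.p ∷ xs} {ys} (here refl) i rewrite elemP-∈ i = s≤s z≤n
common-∈ {p} {x ∷ xs} {ys} (there h) i with elemP x ys
... | true = s≤s z≤n
... | false = common-∈ h i

common-mono : ∀ xs ys zs → (∀ p → elemP p ys ≡ true → elemP p zs ≡ true) → common xs ys ≤ common xs zs
common-mono [] ys zs h = z≤n
common-mono (x ∷ xs) ys zs h with elemP x ys in eq | elemP x zs in eq′
... | true | true = s≤s (common-mono xs ys zs h)
... | true | false = ⊥-elim (true≢false (h x eq) eq′)
... | false | true = ≤-trans (common-mono xs ys zs h) (n≤1+n _)
... | false | false = common-mono xs ys zs h

common-none : ∀ xs ys → All (λ p → elemP p ys ≡ false) xs → common xs ys ≡ 0
common-none [] ys [] = refl
common-none (x ∷ xs) ys (h ∷ hs) rewrite h = common-none xs ys hs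

common-cong : ∀ xs ys zs → All (λ p → elemP p ys ≡ elemP p zs) xs → common xs ys ≡ common xs zs
common-cong [] ys zs [] = refl
common-cong (x ∷ xs) ys zs (h ∷ hs) with elemP x ys | elemP x zs | h
... | true | _ | refl = cong suc (common-cong xs ys zs hs)
... | false | _ | refl = common-cong xs ys zs hs

common-separate : ∀ {r} xs xs′ ys ys′ → All (λ p → r < proj₁ p) xs → All (λ p → r < proj₁ p) ys →
  All (λ p → proj₁ p ≡ r) xs′ → All (λ p → proj₁ p ≡ r) ys′ →
  common (xs ++ xs′) (ys ++ ys′) ≡ common xs ys + common xs′ ys′
common-separate {r} xs xs′ ys ys′ a b a′ b′ = trans (common-++ xs xs′ (ys ++ ys′)) (cong₂ _+_
  (common-cong xs (ys ++ ys′) ys (All.map (λ {p} lt → trans (elemP-++ p ys ys′) (trans (cong (elemP p ys ∨_)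
     (elemP-∉ p ys′ (All.map (λ { e refl → <⇒≢ lt (sym e) }) b′))) (∨-identityʳ _))) a))
  (common-cong xs′ (ys ++ ys′) ys′ (All.map (λ {p} e → trans (elemP-++ p ys ys′) (cong (_∨ elemP p ys′)
     (elemP-∉ p ys (All.map (λ { lt refl → <⇒≢ lt (sym e) }) b)))) a′)))

leftCrosses-all : ∀ r S b → All (λ p → proj₁ p ≡ r × lastElbow S b < proj₂ p × proj₂ p ≤ b) (leftCrosses r S b)
leftCrosses-all r S zero = []
leftCrosses-all r S (suc b) with S (suc b)
... | true = AllP.++⁺ (All.map (λ { (a , p , q) → a , p , ≤-trans q (n≤1+n b) }) (leftCrosses-all r S b))
               ((refl , s≤s (lastElbow-≤ S b) , ≤-refl) ∷ [])
... | false = []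

rowCrosses-row : ∀ r S c → All (λ p → proj₁ p ≡ r) (rowCrosses r S c)
rowCrosses-row r S zero = []
rowCrosses-row r S (suc c) with S (suc c)
... | true = refl ∷ []
... | false = All.map proj₁ (leftCrosses-all r S c)

rowCrosses-≤ : ∀ r S c → All (λ p → proj₂ p ≤ c) (rowCrosses r S c)
rowCrosses-≤ r S zero = []
rowCrosses-≤ r S (suc c) with S (suc c)
... | true = ≤-refl ∷ []
... | false = All.map (λ { (_ , _ , q) → ≤-trans q (n≤1+n c) }) (leftCrosses-all r S c)

rowCrosses-> : ∀ r S c {d} → d < c → d ≤ descend S c → All (λ p → d < proj₂ p) (rowCrosses r S c)
rowCrosses-> r S (suc c) {d} lt p with S (suc c)
... | true = lt ∷ []
... | false = All.map (λ { (_ , q , _) → ≤-<-trans p q }) (leftCrosses-all r S c)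

rowCrosses-cross : ∀ r S c → S (suc c) ≡ true → rowCrosses r S (suc c) ≡ [ (r , suc c) ]
rowCrosses-cross r S c e = cong (λ z → if z then [ (r , suc c) ] else leftCrosses r S c) e

common-single : ∀ q ys → common [ q ] ys ≤ 1
common-single q ys with elemP q ys
... | true = ≤-refl
... | false = z≤n

-- A list with increasing columns meets a point at most once.
leftCrosses-single : ∀ r S b q → common (leftCrosses r S b) [ q ] ≤ 1
leftCrosses-single r S zero q = z≤n
leftCrosses-single r S (suc b) q with S (suc b)
... | false = z≤n
... | true with posEq-or q
  where
    posEq-or : ∀ q → elemP (r , suc b) [ q ] ≡ false ⊎ (r , suc b) ≡ q
    posEq-or q with posEq (r , suc b) q in eq
    ... | true = inj₂ (posEq-sound _ q eq)
    ... | false = inj₁ refl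
...   | inj₁ e = ≤-trans (≤-reflexive (trans (common-++ (leftCrosses r S b) [ (r , suc b) ] [ q ])
                   (trans (cong (common (leftCrosses r S b) [ q ] +_) (common-none [ (r , suc b) ] [ q ] (e ∷ []))) (+-identityʳ _))))
                   (leftCrosses-single r S b q)
...   | inj₂ refl = ≤-trans (≤-reflexive (trans (common-++ (leftCrosses r S b) [ (r , suc b) ] [ q ])
                   (cong (_+ common [ (r , suc b) ] [ q ]) (common-none (leftCrosses r S b) [ q ]
                     (All.map (λ { {a , c} (_ , _ , le) → elemP-∉ (a , c) [ q ] ((λ { refl → <-irrefl refl (s≤s le) }) ∷ []) }) (leftCrosses-all r S b))))))
                   (common-single q [ q ])

rowCrosses-single : ∀ r S c q → common (rowCrosses r S c) [ q ] ≤ 1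
rowCrosses-single r S zero q = z≤n
rowCrosses-single r S (suc c) q with S (suc c)
... | true = common-single (r , suc c) [ q ]
... | false = leftCrosses-single r S c q

module _ {n : ℕ} {R : ℕ → Row} where

  pipe-inΔ : ∀ {r c t cs} → Pipe n R r c t cs → r + c ≤ suc n
  pipe-inΔ (exit b _) = b
  pipe-inΔ (step b _ _) = b

  pipe-pos : ∀ {r c t cs} → Pipe n R r c t cs → 0 < c
  pipe-pos (exit _ _) = z<s
  pipe-pos (step _ _ _) = z<s

  pipe-≥ : ∀ {r c t cs} → Pipe n R r c t cs → r ≤ t
  pipe-≥ (exit _ _) = ≤-refl
  pipe-≥ (step _ _ p) = <⇒≤ (pipe-≥ p)

  pipe-rows : ∀ {r c t cs} → Pipe n R r c t cs → All (λ p → r ≤ proj₁ p) cs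
  pipe-rows (exit {r} {c} _ _) = All.map (λ e → ≤-reflexive (sym e)) (rowCrosses-row r (R r) (suc c))
  pipe-rows (step {r} {c} _ _ p) = AllP.++⁺ (All.map <⇒≤ (pipe-rows p))
    (All.map (λ e → ≤-reflexive (sym e)) (rowCrosses-row r (R r) (suc c)))

  pipe-det : ∀ {r c t cs t′ cs′} → Pipe n R r c t cs → Pipe n R r c t′ cs′ → t ≡ t′
  pipe-det (exit _ _) (exit _ _) = refl
  pipe-det (exit _ e) (step _ e′ _) = contradiction (trans (sym e) e′) λ ()
  pipe-det (step _ e _) (exit _ e′) = contradiction (trans (sym e′) e) λ ()
  pipe-det (step _ e p) (step _ e′ p′) with trans (sym e) e′
  ... | refl = pipe-det p p′

  step′ : ∀ {r c c′ t cs} → r + c ≤ suc n → descend (R r) c ≡ c′ → Pipe n R (suc r) c′ t cs →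
          Pipe n R r c t (cs ++ rowCrosses r (R r) c)
  step′ {r} {zero} b refl p = contradiction (pipe-pos p) λ ()
  step′ {r} {suc c} {zero} b e p = contradiction (pipe-pos p) λ ()
  step′ {r} {suc c} {suc c′} b e p = step b e p

  -- Follow both pipes row by row. They never share a column below a row, because pipes with a
  -- common column have the same exit. In the first row that reverses their order, or from which
  -- only the right one leaves at the edge, the right pipe runs horizontally over the column where
  -- the left one goes straight down.
  inversion⇒cross : ∀ {r c c′ t t′ cs cs′} → Pipe n R r c t cs → Pipe n R r c′ t′ cs′ → c < c′ → t′ < t →
                    ∃[ p ] p ∈ cs × p ∈ cs′
  inversion⇒cross (exit _ _) p′ lt h = contradiction h (≤⇒≯ (pipe-≥ p′))
  inversion⇒cross {r} (step {c = c} {cs = cs} b e p) (exit {c = c′} b′ e′) lt h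
    with descend-over r (R r) lt (subst (_< suc c) (sym e′) z<s)
  ... | a , i , _ = (r , suc c) , ∈-++⁺ʳ cs (subst ((r , suc c) ∈_) (sym (rowCrosses-cross r (R r) c a)) (here refl)) , i
  inversion⇒cross {r} (step {c = c} {d} {cs = cs} b e p) (step {c = c′} {d′} {cs = cs′} b′ e′ p′) lt h with <-cmp (suc d) (suc d′)
  ... | tri< lt′ _ _ with inversion⇒cross p p′ lt′ h
  ...   | q , i , i′ = q , ∈-++⁺ˡ i , ∈-++⁺ˡ i′
  inversion⇒cross {r} (step {c = c} {d} {cs = cs} b e p) (step {c = c′} {d′} {cs = cs′} b′ e′ p′) lt h | tri≈ _ refl _ =
    contradiction (pipe-det p′ p) (<⇒≢ h)
  inversion⇒cross {r} (step {c = c} {d} {cs = cs} b e p) (step {c = c′} {d′} {cs = cs′} b′ e′ p′) lt h | tri> _ _ gt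
    with descend-over r (R r) lt (subst (_< suc c) (sym e′) (<-≤-trans gt (subst (_≤ suc c) e (descend-≤ (R r) (suc c)))))
  ... | a , i , _ = (r , suc c) , ∈-++⁺ʳ cs (subst ((r , suc c) ∈_) (sym (rowCrosses-cross r (R r) c a)) (here refl)) , ∈-++⁺ʳ cs′ i

  -- Where a vertical pipe meets a horizontal one, their order below makes this their only cross.
  NoRecross : ℕ → Row → Set
  NoRecross r S = ∀ {c t t′ cs cs′} → S c ≡ true → Pipe n R (suc r) (lastElbow S c) t cs → Pipe n R (suc r) c t′ cs′ → t < t′

  -- The form needed for induction: none in the case of exits in the order of the columns, at most
  -- one otherwise. Both directions are carried along because the pipes exchange roles after a
  -- crossing.
  Few : ℕ → ℕ → List Pos → List Pos → Set
  Few t t′ cs cs′ = (t < t′ → common cs cs′ ≡ 0 × common cs′ cs ≡ 0) × common cs cs′ ≤ 1 × common cs′ cs ≤ 1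

  few-add : ∀ {r t t′} xs xs′ ys ys′ → All (λ p → r < proj₁ p) xs → All (λ p → r < proj₁ p) ys →
    All (λ p → proj₁ p ≡ r) xs′ → All (λ p → proj₁ p ≡ r) ys′ → common xs′ ys′ ≡ 0 → common ys′ xs′ ≡ 0 →
    Few t t′ xs ys → Few t t′ (xs ++ xs′) (ys ++ ys′)
  few-add xs xs′ ys ys′ a b a′ b′ e e′ (z , p , q)
    rewrite common-separate xs xs′ ys ys′ a b a′ b′ | common-separate ys ys′ xs xs′ b a b′ a′
    | e | e′ | +-identityʳ (common xs ys) | +-identityʳ (common ys xs) = z , p , q

  row-disjoint : ∀ r S {c c′} → c < c′ → c ≤ descend S c′ →
    common (rowCrosses r S c) (rowCrosses r S c′) ≡ 0 × common (rowCrosses r S c′) (rowCrosses r S c) ≡ 0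
  row-disjoint r S {c} {c′} lt p =
    common-none (rowCrosses r S c) (rowCrosses r S c′) (All.map (λ {p} q → elemP-∉ p (rowCrosses r S c′) (All.map (λ { q′ refl → <⇒≱ q′ q }) hi)) lo) ,
    common-none (rowCrosses r S c′) (rowCrosses r S c) (All.map (λ {p} q → elemP-∉ p (rowCrosses r S c) (All.map (λ { q′ refl → <⇒≱ q q′ }) lo)) hi)
    where lo = rowCrosses-≤ r S c
          hi = rowCrosses-> r S c′ lt p

  -- When the pipes meet in row r, the horizontal one continues on the left and, by `NoRecross`,
  -- leaves first. The first clause of `Few` then applies to the rows below, so this meeting is the
  -- only one.
  few-crosses : (∀ r → 1 ≤ r → NoRecross r (R r)) → ∀ {r c c′ t t′ cs cs′} → 1 ≤ r →
    Pipe n R r c t cs → Pipe n R r c′ t′ cs′ → c < c′ → Few t t′ cs cs′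
  few-crosses nr {r} 1≤r (exit {c = c} b e) (exit {c = c′} b′ e′) lt with descend-over r (R r) lt (subst (_< suc c) (sym e′) z<s)
  ... | a , _ = contradiction (trans (sym (descend-cross (R r) (suc c) a)) e) λ ()
  few-crosses nr {r} 1≤r (exit {c = c} b e) (step {c = c′} {d′} {cs = cs′} b′ e′ p′) lt with suc c ≤? suc d′
  ... | no ¬h with descend-over r (R r) lt (subst (_< suc c) (sym e′) (≰⇒> ¬h))
  ...   | a , _ = contradiction (trans (sym (descend-cross (R r) (suc c) a)) e) λ ()
  few-crosses nr {r} 1≤r (exit {c = c} b e) (step {c = c′} {d′} {cs = cs′} b′ e′ p′) lt | yes h =
    few-add [] _ cs′ _ [] (pipe-rows p′) (rowCrosses-row r (R r) (suc c)) (rowCrosses-row r (R r) (suc c′))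
      (proj₁ disj) (proj₂ disj) ((λ _ → refl , none) , z≤n , ≤-trans (≤-reflexive none) z≤n)
    where
      disj = row-disjoint r (R r) lt (subst (suc c ≤_) (sym e′) h)
      none : common cs′ [] ≡ 0
      none = common-none cs′ [] (All.tabulate (λ _ → refl))
  few-crosses nr {r} 1≤r (step {c = c} {d} {cs = cs} b e p) (exit {c = c′} b′ e′) lt
    with descend-over r (R r) lt (subst (_< suc c) (sym e′) z<s)
  ... | a , _ rewrite rowCrosses-cross r (R r) c a =
    (λ h → contradiction h (≤⇒≯ (<⇒≤ (pipe-≥ p)))) ,
    ≤-trans (≤-reflexive (trans (common-separate cs [ (r , suc c) ] [] (rowCrosses r (R r) (suc c′)) (pipe-rows p) [] (refl ∷ []) (rowCrosses-row r (R r) (suc c′)))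
      (cong (_+ common [ (r , suc c) ] (rowCrosses r (R r) (suc c′))) (common-none cs [] (All.tabulate (λ _ → refl)))))) (common-single (r , suc c) (rowCrosses r (R r) (suc c′))) ,
    ≤-trans (≤-reflexive (common-separate [] (rowCrosses r (R r) (suc c′)) cs [ (r , suc c) ] [] (pipe-rows p) (rowCrosses-row r (R r) (suc c′)) (refl ∷ [])))
      (rowCrosses-single r (R r) (suc c′) (r , suc c))
  few-crosses nr {r} 1≤r (step {c = c} {d} {cs = cs} b e p) (step {c = c′} {d′} {cs = cs′} b′ e′ p′) lt with suc c ≤? suc d′
  ... | yes h = few-add cs _ cs′ _ (pipe-rows p) (pipe-rows p′) (rowCrosses-row r (R r) (suc c)) (rowCrosses-row r (R r) (suc c′))
      (proj₁ disj) (proj₂ disj) (few-crosses nr (s≤s z≤n) p p′ d<d′)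
    where
      disj = row-disjoint r (R r) lt (subst (suc c ≤_) (sym e′) h)
      d<d′ : suc d < suc d′
      d<d′ = ≤∧≢⇒< (≤-trans (subst (_≤ suc c) e (descend-≤ (R r) (suc c))) h)
        (λ eq → descend-inj (R r) lt (trans e (trans eq (sym e′))) (subst (0 <_) (sym e) z<s))
  ... | no ¬h with descend-over r (R r) lt (subst (_< suc c) (sym e′) (≰⇒> ¬h))
  ...   | a , _ , le = over (trans (sym e) (descend-cross (R r) (suc c) a))
    where
      over : suc d ≡ suc c → Few _ _ (cs ++ rowCrosses r (R r) (suc c)) (cs′ ++ rowCrosses r (R r) (suc c′))
      over refl rewrite rowCrosses-cross r (R r) c a =
        (λ h → contradiction h (<-asym t′<t)) ,
        ≤-trans (≤-reflexive (trans (common-separate cs [ (r , suc c) ] cs′ ys (pipe-rows p) (pipe-rows p′) (refl ∷ []) (rowCrosses-row r (R r) (suc c′)))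
          (cong (_+ common [ (r , suc c) ] ys) (proj₂ none)))) (common-single (r , suc c) ys) ,
        ≤-trans (≤-reflexive (trans (common-separate cs′ ys cs [ (r , suc c) ] (pipe-rows p′) (pipe-rows p) (rowCrosses-row r (R r) (suc c′)) (refl ∷ []))
          (cong (_+ common ys [ (r , suc c) ]) (proj₁ none)))) (rowCrosses-single r (R r) (suc c′) (r , suc c))
        where
          ys = rowCrosses r (R r) (suc c′)
          t′<t = nr r 1≤r a (subst (λ z → Pipe n R (suc r) z _ cs′) (sym (trans le e′)) p′) p
          none = proj₁ (few-crosses nr (s≤s z≤n) p′ p (≰⇒> ¬h)) t′<t

-- Pipes of a run

module _ {n : ℕ} {R : ℕ → Row} where

  pipe-rowExit : ∀ {r l} → (∀ {c t cs} → Pipe n R (suc r) c t cs → Exit l (suc r) c t) →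
    ∀ {c t cs} → Pipe n R r c t cs → RowExit (R r) l r c t
  pipe-rowExit h (exit b e) = inj₁ (e , refl)
  pipe-rowExit {l = l} h (step b e p) = inj₂ (subst (0 <_) (sym e) z<s , subst (λ z → Exit l _ z _) (sym e) (h p))

  -- The invariant linking the pipes of the unchanged array R with the current stage of a run. At
  -- stage zero every row is aligned, and it is a statement about `Exit` from row one.
  PipeExits : ℕ → Row → (ℕ → ℕ) → Set
  PipeExits zero S l = ∀ {c t cs} → Pipe n R 1 c t cs → Exit l 1 c t
  PipeExits (suc i) S l = ∀ {c t cs} → Pipe n R (suc i) c t cs → RowExit S l (suc i) c t

  pipeExits-aligned : ∀ {i S l} → (∀ c → S c ≡ interval 0 (l (suc i)) c) → PipeExits (suc i) S l →
    ∀ {c t cs} → Pipe n R (suc i) c t cs → Exit l (suc i) c t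
  pipeExits-aligned h E {suc c} p = rowExit-aligned h (E p)
  pipeExits-aligned h E {zero} p = contradiction (pipe-pos p) λ ()

  pipeExits-next : ∀ {l} i → (∀ {c t cs} → Pipe n R (suc i) c t cs → Exit l (suc i) c t) → PipeExits i (R i) l
  pipeExits-next zero h = h
  pipeExits-next (suc i) h = pipe-rowExit h

  pipeExits-appended : ∀ {S S′ l l′ i j m ks t} → Appended S S′ j m → Fall l (suc (suc i)) 1 j m ks t →
    Updated l l′ t m → PipeExits (suc i) S l → PipeExits (suc i) S′ l′
  pipeExits-appended A f u E {suc c} p = rowExit-appended A f u (E p)
  pipeExits-appended A f u E {zero} p = contradiction (pipe-pos p) λ ()

  -- Every step of a run preserves exit rows, hence the pipes of R leave where the final lengths
  -- say.
  run-pipeExits : ∀ {lf i S l es} → Run R lf i S l es → PipeExits i S l → ∀ {c t cs} → Pipe n R 1 c t cs → Exit lf 1 c t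
  run-pipeExits (done h) E p = exit-agree (λ s _ → sym (h s)) (E p)
  run-pipeExits (row {i} h ρ) E = run-pipeExits ρ (pipeExits-next i (pipeExits-aligned h E))
  run-pipeExits (patch _ A f u ρ) E = run-pipeExits ρ (pipeExits-appended A f u E)

  -- From runs to reducedness

  -- Once a patch has been moved, the lengths describe the pipes below correctly only in columns
  -- left of that patch. Hence the bound b on the columns, which drops to j at each patch. For a
  -- cross in the patch itself the claim is `fall-order`; a cross of the initial run has no elbow to
  -- its left.
  run-noRecross : ∀ {lf i S l es} b → Run R lf (suc i) S l es → (∀ c → S c ≡ true → c < b) →
    (∀ {c t cs} → c < b → Pipe n R (suc (suc i)) c t cs → Exit l (suc (suc i)) c t) → NoRecross {n} {R} (suc i) S
  run-noRecross {S = S} {l} b (row {i = i} h ρ) bd E {c} e p q =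
    contradiction (pipe-pos p) (λ lt → <-irrefl refl (<-≤-trans lt (≤-reflexive none)))
    where
      c≤ : c ≤ l (suc i)
      c≤ = proj₂ (interval-true⁻ {0} (trans (sym (h c)) e))
      none : lastElbow S c ≡ 0
      none = lastElbow-run S 0 c (λ d lo hi → trans (h d) (interval-true lo (≤-trans hi c≤)))
  run-noRecross {S = S} {l} b (patch {S′ = S′} {j = j} {m} 1≤m A f u ρ) bd E {c} e p q with c ≤? j
  ... | yes c≤j = run-noRecross j ρ (λ d e′ → below e′) (λ lt p′ → Added.added-low f u lt (E (<-trans lt j<b) p′))
                    (trans (sym (Appended.before A c≤j)) e)
                    (subst (λ z → Pipe n R _ z _ _) (lastElbow-cong c (λ d d≤ → Appended.before A (≤-trans d≤ c≤j))) p) q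
    where
      below : ∀ {d} → S′ d ≡ true → d < j
      below {d} e′ with d <? j
      ... | yes lt = lt
      ... | no ¬lt = ⊥-elim (true≢false e′ (Appended.bound A d (≮⇒≥ ¬lt)))
      j<b : j < b
      j<b = <⇒≤ (≤-<-trans ≤-refl (bd (suc j) (Appended.on-patch A ≤-refl (≤-trans (≤-reflexive (+-comm 1 j)) (+-monoʳ-≤ j 1≤m)))))
  ... | no c≰j = subst (_< _) (exit-det (fall-exit f) (E (<-trans (≰⇒> c≰j) (bd c e)) (subst (λ z → Pipe n R _ z _ _) elbow p)))
                   (fall-order f (≰⇒> c≰j) c≤ (E (bd c e) q))
    where
      c≤ : c ≤ j + m
      c≤ with c ≤? j + m
      ... | yes h = h
      ... | no ¬h = ⊥-elim (true≢false e (Appended.beyond A (≰⇒> ¬h)))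
      within : lastElbow S (j + m) ≡ lastElbow S c
      within = trans (cong (lastElbow S) (sym (m+[n∸m]≡n c≤)))
        (lastElbow-run S c (j + m ∸ c) (λ d lo hi → Appended.on-patch A (<-trans (≰⇒> c≰j) lo) (≤-trans hi (≤-reflexive (m+[n∸m]≡n c≤)))))
      elbow : lastElbow S c ≡ j
      elbow = trans (sym within) (trans (lastElbow-run S j m (λ d → Appended.on-patch A)) (lastElbow-elbow S j (Appended.elbow A)))

  run-inΔ : ∀ {lf i S l es} → Run R lf i S l es → Bounded n lf →
    (∀ c → 1 ≤ i → S c ≡ true → i + c ≤ n) × (∀ r c → 1 ≤ r → r < i → R r c ≡ true → r + c ≤ n)
  run-inΔ (done _) b = (λ _ ()) , (λ _ _ _ ())
  run-inΔ {l = l} (row {i = i} h ρ) b = here′ , rows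
    where
      here′ : ∀ c → 1 ≤ suc i → _ ≡ true → suc i + c ≤ n
      here′ c _ e with interval-true⁻ {0} {l (suc i)} (trans (sym (h c)) e)
      ... | lo , hi = ≤-trans (+-monoʳ-≤ (suc i) hi) (run-bounded ρ b (suc i) (<-≤-trans lo hi))
      rows : ∀ r c → 1 ≤ r → r < suc i → R r c ≡ true → r + c ≤ n
      rows r c p q e with m≤n⇒m<n∨m≡n (s≤s⁻¹ q)
      ... | inj₁ lt = proj₂ (run-inΔ ρ b) r c p lt e
      ... | inj₂ refl = proj₁ (run-inΔ ρ b) c p e
  run-inΔ {S = S} (patch {i = i} {S′} {j = j} {m} 1≤m A f u ρ) b = here′ , proj₂ (run-inΔ ρ b)
    where
      here′ : ∀ c → 1 ≤ suc i → S c ≡ true → suc i + c ≤ n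
      here′ c p e with c ≤? j | c ≤? j + m
      ... | yes q | _ = proj₁ (run-inΔ ρ b) c p (trans (sym (Appended.before A q)) e)
      ... | no _ | yes q = ≤-trans (+-monoʳ-≤ (suc i) q) (s≤s⁻¹ (fall-bound f 1≤m u (run-bounded ρ b)))
      ... | no _ | no q = ⊥-elim (true≢false e (Appended.beyond A (≰⇒> q)))

  run-noRecross-rows : ∀ {lf i S l es} → Run R lf i S l es → PipeExits i S l →
    (∀ r c → 1 ≤ r → R r c ≡ true → r + c ≤ n) → ∀ r → 1 ≤ r → r < i → NoRecross {n} {R} r (R r)
  run-noRecross-rows (row {i} h ρ) E inΔ r p q with m≤n⇒m<n∨m≡n (s≤s⁻¹ q)
  ... | inj₁ lt = run-noRecross-rows ρ (pipeExits-next i (pipeExits-aligned h E)) inΔ r p lt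
  run-noRecross-rows (row {suc i} h ρ) E inΔ .(suc i) p q | inj₂ refl =
    run-noRecross (suc n) ρ (λ c e → s≤s (≤-trans (m≤n+m c _) (inΔ (suc i) c p e))) (λ _ → pipeExits-aligned h E)
  run-noRecross-rows (patch _ A f u ρ) E inΔ = run-noRecross-rows ρ (pipeExits-appended A f u E) inΔ

  -- Row r has k columns and no cross in the last of them, so a pipe leaving it downwards arrives in
  -- one of the k-1 columns of the next row.
  pipe-total : (∀ r c → 1 ≤ r → R r c ≡ true → r + c ≤ n) → ∀ k r c → 1 ≤ r → r + k ≡ suc n → 1 ≤ c → c ≤ k →
    ∃[ t ] ∃[ cs ] Pipe n R r c t cs
  pipe-total inΔ (suc k) r (suc c) 1≤r e 1≤c c≤k with descend (R r) (suc c) in eq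
  ... | zero = r , _ , exit (≤-trans (+-monoʳ-≤ r c≤k) (≤-reflexive e)) eq
  ... | suc d with pipe-total inΔ k (suc r) (suc d) (s≤s z≤n) (trans (sym (+-suc r k)) e) (s≤s z≤n) d≤k
    where
      d≤k : suc d ≤ k
      d≤k with R r (suc c) in e′
      ... | true = subst (_≤ k) eq (+-cancelˡ-≤ r _ _ (≤-trans (inΔ r (suc c) 1≤r e′) (≤-reflexive (suc-injective (trans (sym e) (+-suc r k))))))
      ... | false = subst (_≤ k) eq (≤-trans (lastElbow-≤ (R r) c) (s≤s⁻¹ c≤k))
  ...   | t , cs , p = t , _ , step (≤-trans (+-monoʳ-≤ r c≤k) (≤-reflexive e)) eq p

  -- From pipe dreams to runs

  -- What being a pipe dream means for the rows from r on. No permutation is prescribed, as it would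
  -- change from row to row.
  record Good (r : ℕ) : Set where
    field
      cover   : ∀ c → 1 ≤ c → r + c ≤ suc n → ∃[ t ] ∃[ cs ] Pipe n R r c t cs
      reduced : ∀ {c c′ t t′ cs cs′} → Pipe n R r c t cs → Pipe n R r c′ t′ cs′ → c ≢ c′ → common cs cs′ ≤ 1

  module _ {r : ℕ} (G : Good r) where

    cross-inside : ∀ {c} → R r c ≡ true → 1 ≤ c → r + c ≤ suc n → suc r + c ≤ suc n
    cross-inside {suc c} e p b with Good.cover G (suc c) p b
    ... | t , _ , exit _ e′ = contradiction (trans (sym (descend-cross (R r) (suc c) e)) e′) λ ()
    ... | t , _ , step _ e′ q with trans (sym (descend-cross (R r) (suc c) e)) e′
    ...   | refl = pipe-inΔ q

    -- The search to the right ends at the antidiagonal at the latest: a cross there would send its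
    -- vertical pipe out of the triangle.
    next-elbow : ∀ c → suc r + c ≤ suc n → ∃[ e ] c ≤ e × R r (suc e) ≡ false × r + suc e ≤ suc n ×
                 (∀ d → c < d → d ≤ e → R r d ≡ true)
    next-elbow c h = search (suc n ∸ (suc r + c)) c (m+[n∸m]≡n h) ≤-refl (λ d lo hi → contradiction lo (≤⇒≯ hi))
      where
        search : ∀ k e → suc r + e + k ≡ suc n → c ≤ e → (∀ d → c < d → d ≤ e → R r d ≡ true) →
                 ∃[ e ] c ≤ e × R r (suc e) ≡ false × r + suc e ≤ suc n × (∀ d → c < d → d ≤ e → R r d ≡ true)
        search k e eq c≤e run with R r (suc e) in e′
        ... | false = e , c≤e , e′ , ≤-trans (≤-reflexive (+-suc r e)) (≤-trans (m≤m+n _ k) (≤-reflexive eq)) , run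
        search zero e eq c≤e run | true = contradiction
          (cross-inside e′ (s≤s z≤n) (≤-reflexive (trans (+-suc r e) (trans (sym (+-identityʳ _)) eq))))
          (<⇒≱ (s≤s (≤-reflexive (trans (sym eq) (trans (+-identityʳ _) (sym (+-suc r e)))))))
        search (suc k) e eq c≤e run | true = search k (suc e) (trans (cong (_+ k) (+-suc (suc r) e)) (trans (sym (+-suc (suc r + e) k)) eq))
          (≤-trans c≤e (n≤1+n e)) run′
          where
            run′ : ∀ d → c < d → d ≤ suc e → R r d ≡ true
            run′ d lo hi with m≤n⇒m<n∨m≡n hi
            ... | inj₁ lt = run d lo (s≤s⁻¹ lt)
            ... | inj₂ refl = e′

    -- If column c of row r holds a cross, the pipe came straight down; otherwise it entered at the
    -- next elbow to the right and ran left over crosses.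
    above : ∀ c → 1 ≤ c → suc r + c ≤ suc n → ∃[ c₀ ] r + c₀ ≤ suc n × descend (R r) c₀ ≡ c
    above c p b with R r c in eq
    ... | true = c , <⇒≤ b , descend-cross (R r) c eq
    ... | false with next-elbow c b
    ...   | e , c≤e , f , b′ , run = suc e , b′ , trans (descend-elbow (R r) e f)
              (trans (cong (lastElbow (R r)) (sym (m+[n∸m]≡n c≤e)))
                (trans (lastElbow-run (R r) c (e ∸ c) (λ d lo hi → run d lo (≤-trans hi (≤-reflexive (m+[n∸m]≡n c≤e)))))
                  (lastElbow-elbow (R r) c eq)))

    -- By `above`, two different pipes starting in row r+1 extend upwards to two different pipes
    -- starting in row r, which have at least as many common crosses.
    good-suc : Good (suc r)
    good-suc = record { cover = cover ; reduced = reduced }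
      where
        cover : ∀ c → 1 ≤ c → suc r + c ≤ suc n → ∃[ t ] ∃[ cs ] Pipe n R (suc r) c t cs
        cover c p b with above c p b
        ... | c₀ , b₀ , e with c₀ ≟ 0
        ...   | yes refl = contradiction (subst (0 <_) (sym e) p) λ ()
        ...   | no ¬z with Good.cover G c₀ (n≢0⇒n>0 ¬z) b₀
        ...     | t , _ , exit _ e′ = contradiction (trans (sym e) e′) (>⇒≢ p)
        ...     | t , _ , step {cs = cs} _ e′ q = t , cs , subst (λ z → Pipe n R (suc r) z t cs) (trans (sym e′) e) q
        reduced : ∀ {c c′ t t′ cs cs′} → Pipe n R (suc r) c t cs → Pipe n R (suc r) c′ t′ cs′ → c ≢ c′ → common cs cs′ ≤ 1
        reduced {c} {c′} {cs = cs} {cs′} p p′ ne with above c (pipe-pos p) (pipe-inΔ p) | above c′ (pipe-pos p′) (pipe-inΔ p′)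
        ... | c₀ , b₀ , e | c₀′ , b₀′ , e′ = ≤-trans (common-mono cs cs′ (cs′ ++ rowCrosses r (R r) c₀′)
              (λ q h → trans (elemP-++ q cs′ (rowCrosses r (R r) c₀′)) (cong (_∨ elemP q (rowCrosses r (R r) c₀′)) h)))
              (≤-trans (≤-trans (m≤m+n _ _) (≤-reflexive (sym (common-++ cs (rowCrosses r (R r) c₀) (cs′ ++ rowCrosses r (R r) c₀′)))))
                (Good.reduced G (step′ b₀ e p) (step′ b₀′ e′ p′) (λ { refl → ne (trans (sym e) e′) })))

    -- The two pipes already meet at this cross. If the vertical one left above the horizontal one,
    -- `inversion⇒cross` would give a second meeting below; equal exits are excluded by the
    -- injectivity hypothesis.
    order-at-cross : (∀ {c c′ t cs cs′} → Pipe n R (suc r) c t cs → Pipe n R (suc r) c′ t cs′ → c ≡ c′) →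
      ∀ {c} → R r c ≡ true → 1 ≤ c → r + c ≤ suc n → 0 < lastElbow (R r) c →
      ∃[ t ] ∃[ t′ ] ∃[ cs ] ∃[ cs′ ] Pipe n R (suc r) (lastElbow (R r) c) t cs × Pipe n R (suc r) c t′ cs′ × t < t′
    order-at-cross inj {suc c} e p b pos with cross-inside e p b
    ... | b′ with next-elbow (suc c) b′
      | Good.cover good-suc (lastElbow (R r) (suc c)) pos (≤-trans (+-monoʳ-≤ (suc r) (lastElbow-≤ (R r) (suc c))) b′)
      | Good.cover good-suc (suc c) p b′
    ...   | d , c≤d , f , bd , run | t , cs , q | t′ , cs′ , q′ with <-cmp t t′
    ...     | tri< lt _ _ = t , t′ , cs , cs′ , q , q′ , lt
    ...     | tri≈ _ refl _ = ⊥-elim (true≢false e (subst (λ z → R r z ≡ false) (inj q q′) (lastElbow-false (R r) (suc c) pos)))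
    ...     | tri> _ _ gt = contradiction few (<⇒≱ twice)
      where
        a = lastElbow (R r) (suc c)
        a<c : a < suc c
        a<c = ≤∧≢⇒< (lastElbow-≤ (R r) (suc c)) (λ eq → true≢false e (subst (λ z → R r z ≡ false) eq (lastElbow-false (R r) (suc c) pos)))
        eq-d : lastElbow (R r) d ≡ a
        eq-d = trans (cong (lastElbow (R r)) (sym (m+[n∸m]≡n c≤d)))
                 (lastElbow-run (R r) (suc c) (d ∸ suc c) (λ x lo hi → run x lo (≤-trans hi (≤-reflexive (m+[n∸m]≡n c≤d)))))
        desc : descend (R r) (suc d) ≡ a
        desc = trans (descend-elbow (R r) d f) eq-d
        over = descend-over r (R r) (s≤s c≤d) (subst (_< suc c) (sym desc) a<c)
        vert = step′ (<⇒≤ b′) (descend-cross (R r) (suc c) e) q′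
        horiz = step′ bd desc q
        few : common (cs′ ++ rowCrosses r (R r) (suc c)) (cs ++ rowCrosses r (R r) (suc d)) ≤ 1
        few = Good.reduced G vert horiz (λ eq → <⇒≢ (s≤s c≤d) eq)
        twice : 2 ≤ common (cs′ ++ rowCrosses r (R r) (suc c)) (cs ++ rowCrosses r (R r) (suc d))
        twice with inversion⇒cross q q′ a<c gt
        ... | x , i , i′ = ≤-trans (+-mono-≤ (common-∈ {xs = cs′} {horizontal} i′ (∈-++⁺ˡ i))
                (common-∈ {r , suc c} {rowCrosses r (R r) (suc c)} {horizontal}
                  (subst ((r , suc c) ∈_) (sym (rowCrosses-cross r (R r) c e)) (here refl)) (∈-++⁺ʳ cs (proj₁ (proj₂ over)))))
                (≤-reflexive (sym (common-++ cs′ (rowCrosses r (R r) (suc c)) horizontal)))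
          where horizontal = cs ++ rowCrosses r (R r) (suc d)

-- Runs of a pipe dream

-- A row as an initial run of k crosses with patches behind elbows. The condition `1 ≤ j` separates
-- a patch from the initial run. The rightmost patch comes first, in the order in which the encoding
-- treats them.
data Shape : Row → ℕ → Set where
  base  : ∀ {S k} → (∀ c → S c ≡ interval 0 k c) → Shape S k
  patch : ∀ {S S′ j m k} → 1 ≤ j → 1 ≤ m → Appended S S′ j m → Shape S′ k → Shape S k

shape : ∀ f b S → b ≤ f → S 0 ≡ false → (∀ c → b < c → S c ≡ false) → ∃[ k ] Shape S k
shape f zero S _ z h = 0 , base eq
  where eq : ∀ c → S c ≡ interval 0 0 c
        eq zero = z
        eq (suc c) = trans (h (suc c) z<s) (sym (interval-false-high {0} {0} {suc c} z<s))
shape (suc f) (suc b) S b≤f z h with S (suc b) in e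
... | false = shape f b S (s≤s⁻¹ b≤f) z h′
  where h′ : ∀ c → b < c → S c ≡ false
        h′ c lt with m≤n⇒m<n∨m≡n lt
        ... | inj₁ lt′ = h c lt′
        ... | inj₂ refl = e
... | true with lastElbow S b in le
...   | zero = suc b , base eq
  where eq : ∀ c → S c ≡ interval 0 (suc b) c
        eq zero = z
        eq (suc c) with suc c ≤? suc b
        ... | no q = trans (h _ (≰⇒> q)) (sym (interval-false-high {0} (≰⇒> q)))
        ... | yes q with m≤n⇒m<n∨m≡n q
        ...   | inj₁ lt = trans (lastElbow-cross S b (subst (_< suc c) (sym le) z<s) (s≤s⁻¹ lt)) (sym (interval-true {0} {suc b} {suc c} z<s q))
        ...   | inj₂ refl = trans e (sym (interval-true {0} {suc b} {suc b} z<s ≤-refl))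
shape (suc f) (suc b) S b≤f z h | true | suc j = proj₁ rest , patch (s≤s z≤n) (m<n⇒0<n∸m (s≤s j≤b)) (record { union = union ; bound = bound }) (proj₂ rest)
  where
    S′ : Row
    S′ c = S c ∧ (c <ᵇ suc j)
    j≤b : suc j ≤ b
    j≤b = subst (_≤ b) le (lastElbow-≤ S b)
    bound : ∀ c → suc j ≤ c → S′ c ≡ false
    bound c lt = trans (cong (S c ∧_) (dec-false (c <? suc j) (≤⇒≯ lt))) (∧-zeroʳ _)
    rest : ∃[ k ] Shape S′ k
    rest = shape f j S′ (≤-trans (≤-trans (n≤1+n j) j≤b) (s≤s⁻¹ b≤f)) (cong (_∧ (0 <ᵇ suc j)) z) bound
    total : suc j + (suc b ∸ suc j) ≡ suc b
    total = m+[n∸m]≡n {suc j} {suc b} (≤-trans j≤b (n≤1+n b))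
    union : ∀ c → S c ≡ S′ c ∨ interval (suc j) (suc j + (suc b ∸ suc j)) c
    union c rewrite total with <-cmp c (suc j)
    ... | tri< lt _ _ rewrite dec-true (c <? suc j) lt | interval-false-low {suc j} {suc b} (<⇒≤ lt) with S c
    ...   | true = refl
    ...   | false = refl
    union c | tri≈ _ refl _ = trans (subst (λ z → S z ≡ false) le (lastElbow-false S b (subst (0 <_) (sym le) z<s)))
      (sym (cong₂ _∨_ (bound (suc j) ≤-refl) (interval-false-low {suc j} {suc b} ≤-refl)))
    union c | tri> _ _ gt with c ≤? suc b
    ... | no q = trans (h c (≰⇒> q)) (sym (cong₂ _∨_ (bound c (<⇒≤ gt)) (interval-false-high {suc j} (≰⇒> q))))
    ... | yes q = trans onRow (sym (trans (cong (S′ c ∨_) (interval-true gt q)) (∨-zeroʳ _)))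
      where onRow : S c ≡ true
            onRow with m≤n⇒m<n∨m≡n q
            ... | inj₁ lt = lastElbow-cross S b (subst (_< c) (sym le) gt) (s≤s⁻¹ lt)
            ... | inj₂ refl = e

shape-empty : ∀ {S k} → Shape S k → S 1 ≡ false → k ≡ 0
shape-empty {k = zero} _ _ = refl
shape-empty {k = suc k} (base h) e = ⊥-elim (true≢false (trans (h 1) (interval-true {0} {suc k} {1} z<s (s≤s z≤n))) e)
shape-empty {k = suc k} (patch {S′ = S′} {j} {m} 1≤j _ A sh) e = shape-empty sh (trans (sym (Appended.before A 1≤j)) e)

bump : (ℕ → ℕ) → ℕ → ℕ → ℕ → ℕ
bump l t m r = if r ≡ᵇ t then l r + m else l r

bump-updated : ∀ l t m → Updated l (bump l t m) t m
bump-updated l t m = cong (λ z → if z then l t + m else l t) (dec-true (t ≟ t) refl) ,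
  λ r ne → cong (λ z → if z then l r + m else l r) (dec-false (r ≟ t) ne)

patch-elbow : ∀ {S S′ j m} → Appended S S′ j m → ∀ s → j < s → s ≤ j + m → lastElbow S s ≡ j
patch-elbow {S} {j = j} A s a b = trans (cong (lastElbow S) (sym (m+[n∸m]≡n (<⇒≤ a))))
  (trans (lastElbow-run S j (s ∸ j) (λ d lo hi → Appended.on-patch A lo (≤-trans hi (≤-trans (≤-reflexive (m+[n∸m]≡n (<⇒≤ a))) b))))
    (lastElbow-elbow S j (Appended.elbow A)))

-- The local condition at the crosses of S, stated for the current lengths rather than for the
-- original pipes, so that it survives the change of lengths. The bound on t′ ensures that patches
-- land in rows of the grid.
Ordered : ℕ → Row → (ℕ → ℕ) → ℕ → Set
Ordered n S l r = ∀ c → S c ≡ true → 0 < lastElbow S c →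
  ∃[ t ] ∃[ t′ ] Exit l (suc r) (lastElbow S c) t × Exit l (suc r) c t′ × t < t′ × t′ ≤ n

pipe-≤ : ∀ {n R r c t cs} → Pipe n R r c t cs → t ≤ n
pipe-≤ (exit {r} {c} b _) = ≤-trans (m≤m+n r c) (s≤s⁻¹ (≤-trans (≤-reflexive (sym (+-suc r c))) b))
pipe-≤ (step _ _ p) = pipe-≤ p

module _ {n : ℕ} {R : ℕ → Row} (inΔ : ∀ r c → R r c ≡ true → 1 ≤ r × 1 ≤ c × r + c ≤ suc n)
         (good : ∀ r → 1 ≤ r → Good {n} {R} r) where

  ordered-start : ∀ {l} i → (∀ {c t cs} → Pipe n R (suc i) c t cs → Exit l (suc i) c t) → Ordered n (R i) l i
  ordered-start i E c e pos with inΔ i c e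
  ... | 1≤i , 1≤c , b with order-at-cross (good i 1≤i) (λ p q → exit-inj (E p) (E q)) e 1≤c b pos
  ...   | t , t′ , cs , cs′ , p , q , lt = t , t′ , E p , E q , lt , pipe-≤ q

  -- All crosses of the patch have the same last elbow j, so the order conditions at them compare
  -- one and the same pipe with the pipes of columns j+1,...,j+m. This is what `exits⇒fall` asks
  -- for.
  patch-falls : ∀ {r S S′ l j m} → 1 ≤ j → 1 ≤ m → Appended S S′ j m → Ordered n S l r →
    ∃[ t ] ∃[ ks ] Fall l (suc r) 1 j m ks t × t ≤ n
  patch-falls {r} {S} {l = l} {j} {m} 1≤j 1≤m A ord with ord (suc j) (Appended.on-patch A ≤-refl first) (subst (0 <_) (sym (patch-elbow A (suc j) ≤-refl first)) 1≤j)
    where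
      first : suc j ≤ j + m
      first = ≤-trans (≤-reflexive (+-comm 1 j)) (+-monoʳ-≤ j 1≤m)
  ... | t , t′ , e , e′ , lt , t′≤n with exits⇒fall {m = m} 1 e₁ others
    where
      e₁ = subst (λ z → Exit l _ z t) (patch-elbow A (suc j) ≤-refl (≤-trans (≤-reflexive (+-comm 1 j)) (+-monoʳ-≤ j 1≤m))) e
      others : ∀ s → j < s → s ≤ j + m → ∃[ t′ ] Exit l (suc r) s t′ × t < t′
      others s a b with ord s (Appended.on-patch A a b) (subst (0 <_) (sym (patch-elbow A s a b)) 1≤j)
      ... | t₂ , t₂′ , e₂ , e₂′ , lt₂ , _ = t₂′ , e₂′ , subst (_< t₂′) (exit-det (subst (λ z → Exit l _ z t₂) (patch-elbow A s a b) e₂) e₁) lt₂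
  ...   | ks , f = t , ks , f , ≤-trans (<⇒≤ lt) t′≤n

  -- The remaining crosses lie left of j, where `added-low` keeps all exits.
  ordered-appended : ∀ {r S S′ l l′ j m ks t} → Appended S S′ j m → Fall l (suc r) 1 j m ks t → Updated l l′ t m →
    Ordered n S l r → Ordered n S′ l′ r
  ordered-appended {S = S} {S′} {l′ = l′} {j} A f u ord c e′ pos with c <? j
  ... | no ¬lt = ⊥-elim (true≢false e′ (Appended.bound A c (≮⇒≥ ¬lt)))
  ... | yes c<j with lastElbow-cong {S} {S′} c (λ d d≤ → Appended.before A (≤-trans d≤ (<⇒≤ c<j)))
  ...   | same with ord c (trans (Appended.before A (<⇒≤ c<j)) e′) (subst (0 <_) (sym same) pos)
  ...     | t₁ , t₂ , e₁ , e₂ , lt = t₁ , t₂ ,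
              subst (λ z → Exit l′ _ z t₁) same (Added.added-low f u (≤-<-trans (lastElbow-≤ S c) c<j) e₁) ,
              Added.added-low f u c<j e₂ , lt

  Built : ℕ → Row → (ℕ → ℕ) → Set
  Built i S l = ∃[ es ] ∃[ lf ] Run R lf i S l es × (∀ x → x < 1 ⊎ n < x → lf x ≡ l x) × (∀ {c t cs} → Pipe n R 1 c t cs → Exit lf 1 c t)

  -- Outer recursion on the row, inner recursion `row-patches` on the shape of the current row. The
  -- lengths vary during the inner one, while the entry of the current row does not, because patches
  -- land below it; hence the separate equation `k ≡ l i`.
  build : ∀ i {S l k} → Shape S k → k ≡ l i → (∀ r → r < i → Shape (R r) (l r)) → Ordered n S l i → PipeExits {n} {R} i S l → Built i S l
  build zero {l = l} sh eq shapes ord E = [] , l , done (λ _ → refl) , (λ _ _ → refl) , E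
  build (suc i) = row-patches
    where
      outside : ∀ {l q d j m ks t x} → Fall l (suc q) d j m ks t → t ≤ n → x < 1 ⊎ n < x → x ≢ t
      outside f t≤n (inj₁ lt) refl = <⇒≱ lt (≤-trans (s≤s z≤n) (fall-≥ f))
      outside f t≤n (inj₂ lt) refl = <⇒≱ lt t≤n
      row-patches : ∀ {S l k} → Shape S k → k ≡ l (suc i) → (∀ r → r < suc i → Shape (R r) (l r)) → Ordered n S l (suc i) →
        PipeExits {n} {R} (suc i) S l → Built (suc i) S l
      row-patches {l = l} (base h) refl shapes ord E
        with build i (shapes i ≤-refl) refl (λ r lt → shapes r (≤-trans lt (n≤1+n i)))
               (ordered-start i (pipeExits-aligned h E)) (pipeExits-next i (pipeExits-aligned h E))
      ... | es , lf , ρ , z , F = es , lf , row h ρ , z , F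
      row-patches {l = l} (patch {m = m} 1≤j 1≤m A sh) eq shapes ord E with patch-falls 1≤j 1≤m A ord
      ... | t , ks , f , t≤n with bump-updated l t m
      ...   | u with row-patches {l = bump l t m} sh (trans eq (sym (proj₂ u (suc i) (<⇒≢ (fall-≥ f)))))
                       (λ r lt → subst (Shape (R r)) (sym (proj₂ u r (<⇒≢ (<-trans lt (fall-≥ f))))) (shapes r lt))
                       (ordered-appended A f u ord) (pipeExits-appended A f u E)
      ...     | es , lf , ρ , z , F = _ , lf , patch 1≤m A f u ρ ,
              (λ x out → trans (z x out) (proj₂ u x (outside f t≤n out))) , F

-- The pipe leaving at row r is the one in column `suc (l r)`, and it is the same for both length
-- functions. Their values at r therefore agree, and the remaining pipes enter the next row in the
-- same columns.
exit-unique : ∀ {n l l′} k r → r + k ≡ suc n → 1 ≤ r → (∀ x → 1 ≤ x → x ≤ n → x + l′ x ≤ n) →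
  (∀ c → 1 ≤ c → c ≤ k → ∃[ t ] Exit l r c t × Exit l′ r c t) → ∀ x → r ≤ x → x ≤ n → l x ≡ l′ x
exit-unique zero r e 1≤r b h x p q = contradiction (≤-trans p q) (<⇒≱ (≤-reflexive (trans (sym e) (+-identityʳ r))))
exit-unique {n} {l} {l′} (suc k) r e 1≤r b h x p q with m≤n⇒m<n∨m≡n p
  | h (suc (l′ r)) (s≤s z≤n) (s≤s (+-cancelˡ-≤ r _ _ (≤-trans (b r 1≤r (≤-trans p q)) (≤-reflexive (suc-injective (trans (sym e) (+-suc r k)))))))
... | _ | t , x₁ , x₂ with exit-here⁻ refl x₂
exit-unique {n} {l} {l′} (suc k) r e 1≤r b h x p q | inj₂ refl | t , x₁ , x₂ | refl = sym (suc-injective (exit-row⁻ x₁))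
exit-unique {n} {l} {l′} (suc k) r e 1≤r b h x p q | inj₁ lt | t , x₁ , x₂ | refl =
  exit-unique k (suc r) (trans (sym (+-suc r k)) e) (s≤s z≤n) b h′ x lt q
  where
    same : l r ≡ l′ r
    same = sym (suc-injective (exit-row⁻ x₁))
    h′ : ∀ c → 1 ≤ c → c ≤ k → ∃[ t ] Exit l (suc r) c t × Exit l′ (suc r) c t
    h′ c 1≤c c≤k with c ≤? l r
    ... | yes le with h c 1≤c (≤-trans c≤k (n≤1+n k))
    ...   | t , y , y′ = t , exit-pass⁻ le y , exit-pass⁻ (≤-trans le (≤-reflexive same)) y′
    h′ c 1≤c c≤k | no ¬le with h (suc c) (s≤s z≤n) (s≤s c≤k)
    ... | t , y , y′ = t , exit-shift⁻ (≰⇒> ¬le) y , exit-shift⁻ (≤-<-trans (≤-reflexive (sym same)) (≰⇒> ¬le)) y′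

-- Codes

indicator : Bool → ℕ
indicator true = 1
indicator false = 0

module _ {A : Set} where

  count-∷ : ∀ (p : A → Bool) x xs → count p (x ∷ xs) ≡ indicator (p x) + count p xs
  count-∷ p x xs with p x
  ... | true = refl
  ... | false = refl

  count-split : ∀ (p q s : A → Bool) xs → (∀ x → indicator (p x) ≡ indicator (q x) + indicator (s x)) →
                count p xs ≡ count q xs + count s xs
  count-split p q s [] h = refl
  count-split p q s (x ∷ xs) h = begin
    count p (x ∷ xs)   ≡⟨ count-∷ p x xs ⟩
    indicator (p x) + count p xs ≡⟨ cong₂ _+_ (h x) (count-split p q s xs h) ⟩
    a + b + (c + d)    ≡⟨ +-assoc a b (c + d) ⟩
    a + (b + (c + d))  ≡⟨ cong (a +_) (trans (sym (+-assoc b c d)) (trans (cong (_+ d) (+-comm b c)) (+-assoc c b d))) ⟩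
    a + (c + (b + d))  ≡⟨ sym (+-assoc a c (b + d)) ⟩
    a + c + (b + d)    ≡⟨ sym (cong₂ _+_ (count-∷ q x xs) (count-∷ s x xs)) ⟩
    count q (x ∷ xs) + count s (x ∷ xs) ∎
    where open ≡-Reasoning
          a = indicator (q x)
          b = indicator (s x)
          c = count q xs
          d = count s xs

  count-mono : ∀ (p q : A → Bool) xs → (∀ x → p x ≡ true → q x ≡ true) → count p xs ≤ count q xs
  count-mono p q [] h = z≤n
  count-mono p q (x ∷ xs) h with p x in e | q x in e′
  ... | true | true = s≤s (count-mono p q xs h)
  ... | true | false = ⊥-elim (true≢false (h x e) e′)
  ... | false | true = ≤-trans (count-mono p q xs h) (n≤1+n _)
  ... | false | false = count-mono p q xs h

  count-strict : ∀ (p q : A → Bool) {xs y} → (∀ x → p x ≡ true → q x ≡ true) → y ∈ xs → p y ≡ false → q y ≡ true →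
                 count p xs < count q xs
  count-strict p q {y ∷ xs} h (here refl) e e′ rewrite e | e′ = s≤s (count-mono p q xs h)
  count-strict p q {x ∷ xs} h (there i) e e′ with p x in f | q x in f′
  ... | true | true = s≤s (count-strict p q h i e e′)
  ... | true | false = ⊥-elim (true≢false (h x f) f′)
  ... | false | true = ≤-trans (count-strict p q h i e e′) (n≤1+n _)
  ... | false | false = count-strict p q h i e e′

  count-none : ∀ (p : A → Bool) xs → All (λ x → p x ≡ false) xs → count p xs ≡ 0
  count-none p [] [] = refl
  count-none p (x ∷ xs) (h ∷ hs) rewrite h = count-none p xs hs

  count-one : ∀ (p : A → Bool) y {xs} → Unique xs → y ∈ xs → (∀ x → x ≢ y → p x ≡ false) → count p xs ≡ indicator (p y)
  count-one p y {.y ∷ xs} (h ∷ hs) (here refl) f = trans (count-∷ p y xs)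
    (trans (cong (indicator (p y) +_) (count-none p xs (All.map (λ ne → f _ (λ e → ne (sym e))) h))) (+-identityʳ _))
  count-one p y {x ∷ xs} (h ∷ hs) (there i) f rewrite f x (λ { refl → AllP.All¬⇒¬Any h i }) = count-one p y hs i f

  count-≤ : ∀ (p : A → Bool) xs → count p xs ≤ length xs
  count-≤ p [] = z≤n
  count-≤ p (x ∷ xs) with p x
  ... | true = s≤s (count-≤ p xs)
  ... | false = ≤-trans (count-≤ p xs) (n≤1+n _)

  count-tabulate : ∀ {n} (p : A → Bool) (f : Fin n → A) → count p (L.tabulate f) ≡ finSum (λ i → indicator (p (f i)))
  count-tabulate {zero} p f = refl
  count-tabulate {suc n} p f = trans (count-∷ p (f F.zero) _) (cong (indicator (p (f F.zero)) +_) (count-tabulate p (f ∘ F.suc)))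

finSum-below : ∀ n a → a ≤ n → finSum {n} (λ i → indicator (toℕ i <ᵇ a)) ≡ a
finSum-below zero zero h = refl
finSum-below (suc n) zero h = finSum-below n zero z≤n
finSum-below (suc n) (suc a) h = cong suc (finSum-below n a (s≤s⁻¹ h))

≤ᵇ-split : ∀ r x b → indicator ((r ≤ᵇ x) ∧ b) ≡ indicator ((x ≡ᵇ r) ∧ b) + indicator ((r <ᵇ x) ∧ b)
≤ᵇ-split r x b with <-cmp r x
... | tri< lt _ _ rewrite dec-true (r ≤? x) (<⇒≤ lt) | dec-false (x ≟ r) (>⇒≢ lt) | dec-true (r <? x) lt = refl
... | tri≈ _ refl _ rewrite dec-true (r ≤? r) ≤-refl | dec-true (r ≟ r) refl | dec-false (r <? r) (<-irrefl refl) = sym (+-identityʳ _)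
... | tri> _ _ gt rewrite dec-false (r ≤? x) (<⇒≱ gt) | dec-false (x ≟ r) (<⇒≢ gt) | dec-false (r <? x) (<-asym gt) = refl

∧-true : ∀ {a b} → (a ∧ b) ≡ true → a ≡ true × b ≡ true
∧-true {true} e = refl , e

<ᵇ-true : ∀ a b → (a <ᵇ b) ≡ true → a < b
<ᵇ-true a b e with a <? b
... | yes p = p
... | no ¬p = ⊥-elim (true≢false e (dec-false (a <? b) ¬p))

module _ {n : ℕ} (u : Permutation′ n) where

  private
    val : Fin n → ℕ
    val j = toℕ (u ⟨$⟩ʳ j)

  -- Column (from 0) at the top of row r+1 of the pipe labelled a+1.
  column : ℕ → ℕ → ℕ
  column r a = count (λ j → (r ≤ᵇ toℕ j) ∧ (val j <ᵇ a)) (L.allFin n)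

  val-inj : ∀ {i j} → val i ≡ val j → i ≡ j
  val-inj {i} {j} e = trans (sym (inverseˡ u)) (trans (cong (u ⟨$⟩ˡ_) (toℕ-injective e)) (inverseˡ u))

  column-0 : ∀ a → a ≤ n → column 0 a ≡ a
  column-0 a h = trans (count-tabulate (λ j → val j <ᵇ a) id)
    (trans (sym (sum-permute (λ i → indicator (toℕ i <ᵇ a)) u)) (finSum-below n a h))

  code-fin : ∀ i → code u (suc (toℕ i)) ≡ column (suc (toℕ i)) (val i)
  code-fin i with toℕ i <? n
  ... | yes p = cong (codeF u) (fromℕ<-toℕ i p)
  ... | no ¬p = contradiction (toℕ<n i) ¬p

  code-beyond : ∀ x → n < x → code u x ≡ 0
  code-beyond (suc x) lt with x <? n
  ... | yes p = contradiction lt (≤⇒≯ p)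
  ... | no _ = refl

  column-step : ∀ i a → column (toℕ i) a ≡ indicator (val i <ᵇ a) + column (suc (toℕ i)) a
  column-step i a = trans (count-split _ (λ j → (toℕ j ≡ᵇ toℕ i) ∧ (val j <ᵇ a)) _ (L.allFin n) (λ j → ≤ᵇ-split (toℕ i) (toℕ j) (val j <ᵇ a)))
    (cong (_+ column (suc (toℕ i)) a) (trans (count-one _ i (Uniq.allFin⁺ n) (∈-allFin i)
        (λ j ne → cong (_∧ (val j <ᵇ a)) (dec-false (toℕ j ≟ toℕ i) (λ e → ne (toℕ-injective e)))))
      (cong (λ z → indicator (z ∧ (val i <ᵇ a))) (dec-true (toℕ i ≟ toℕ i) refl))))

  column-mono : ∀ r {a b} → a ≤ b → column r a ≤ column r b
  column-mono r {a} {b} a≤b = count-mono _ _ (L.allFin n) (λ j e → cong₂ _∧_ (proj₁ (∧-true e))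
    (dec-true (val j <? b) (<-≤-trans (<ᵇ-true (val j) a (proj₂ (∧-true {r ≤ᵇ toℕ j} e))) a≤b)))

  column-strict : ∀ r i {b} → r ≤ toℕ i → val i < b → column r (val i) < column r b
  column-strict r i {b} r≤i lt = count-strict _ _ {y = i} (λ j e → cong₂ _∧_ (proj₁ (∧-true e))
      (dec-true (val j <? b) (<-trans (<ᵇ-true (val j) (val i) (proj₂ (∧-true {r ≤ᵇ toℕ j} e))) lt)))
    (∈-allFin i) (trans (cong ((r ≤ᵇ toℕ i) ∧_) (dec-false (val i <? val i) (<-irrefl refl))) (∧-zeroʳ _))
    (cong₂ _∧_ (dec-true (r ≤? toℕ i) r≤i) (dec-true (val i <? b) lt))

  -- The pipe leaving at row r+1 has label `val f`, and it separates the others: a larger label lies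
  -- to its right and shifts, a smaller one lies to its left and passes. Correspondingly the count
  -- in `column` loses one element or none, and the code at f is the column of `val f` counted from
  -- position r+1.
  code-exit-from : ∀ k r i → r + k ≡ toℕ i → Exit (code u) (suc r) (suc (column r (val i))) (suc (toℕ i))
  code-exit-from zero r i e with trans (sym (+-identityʳ r)) e
  ... | refl = here (cong suc (trans (column-step i (val i)) (trans (cong (λ z → indicator z + column (suc (toℕ i)) (val i))
                 (dec-false (val i <? val i) (<-irrefl refl))) (sym (code-fin i)))))
  code-exit-from (suc k) r i e = go r (fromℕ< r<n) (toℕ-fromℕ< r<n) r<i rest
    where
      r<i : r < toℕ i
      r<i = ≤-trans (s≤s (m≤m+n r k)) (≤-reflexive (trans (sym (+-suc r k)) e))
      r<n : r < n
      r<n = <-trans r<i (toℕ<n i)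
      rest : Exit (code u) (suc (suc r)) (suc (column (suc r) (val i))) (suc (toℕ i))
      rest = code-exit-from k (suc r) i (trans (sym (+-suc r k)) e)
      go : ∀ r (f : Fin n) → toℕ f ≡ r → r < toℕ i → Exit (code u) (suc (suc r)) (suc (column (suc r) (val i))) (suc (toℕ i)) →
           Exit (code u) (suc r) (suc (column r (val i))) (suc (toℕ i))
      go r f refl r<i rest with <-cmp (val f) (val i)
      ... | tri≈ _ eq _ = contradiction (cong toℕ (val-inj eq)) (<⇒≢ r<i)
      ... | tri< lt _ _ = subst (λ z → Exit (code u) _ (suc z) _)
              (sym (trans (column-step f (val i)) (cong (λ z → indicator z + column (suc r) (val i)) (dec-true (val f <? val i) lt))))
              (shift (s≤s (≤-trans (≤-reflexive (code-fin f)) (column-mono (suc r) (<⇒≤ lt)))) rest)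
      ... | tri> _ _ gt = subst (λ z → Exit (code u) _ (suc z) _)
              (sym (trans (column-step f (val i)) (cong (λ z → indicator z + column (suc r) (val i)) (dec-false (val f <? val i) (<-asym gt)))))
              (pass (≤-trans (column-strict (suc r) i r<i gt) (≤-reflexive (sym (code-fin f)))) rest)

  code-exit : ∀ i → Exit (code u) 1 (suc (val i)) (suc (toℕ i))
  code-exit i = subst (λ z → Exit (code u) 1 (suc z) (suc (toℕ i))) (column-0 (val i) (<⇒≤ (toℕ<n _)))
    (code-exit-from (toℕ i) 0 i refl)

  -- The first x positions and those counted by the code at x are disjoint subsets of the n
  -- positions.
  code-bound : ∀ x → 1 ≤ x → x ≤ n → x + code u x ≤ n
  code-bound (suc x) _ x<n = go x (fromℕ< x<n) (toℕ-fromℕ< x<n)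
    where
      go : ∀ x (i : Fin n) → toℕ i ≡ x → suc x + code u (suc x) ≤ n
      go x i refl = ≤-trans (≤-reflexive (cong₂ _+_ below (code-fin i)))
        (≤-trans (≤-reflexive (sym (count-split either _ _ (L.allFin n) split)))
          (≤-trans (count-≤ either (L.allFin n)) (≤-reflexive (length-tabulate id))))
        where
          c : Fin n → Bool
          c j = (suc (toℕ i) ≤ᵇ toℕ j) ∧ (val j <ᵇ val i)
          either : Fin n → Bool
          either j = (toℕ j <ᵇ suc (toℕ i)) ∨ c j
          below : suc (toℕ i) ≡ count (λ j → toℕ j <ᵇ suc (toℕ i)) (L.allFin n)
          below = sym (trans (count-tabulate {n = n} (λ (j : Fin n) → toℕ j <ᵇ suc (toℕ i)) id) (finSum-below n (suc (toℕ i)) (toℕ<n i)))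
          split : ∀ j → indicator (either j) ≡ indicator (toℕ j <ᵇ suc (toℕ i)) + indicator (c j)
          split j with toℕ j ≤? toℕ i
          ... | yes p rewrite dec-true (toℕ j <? suc (toℕ i)) (s≤s p) | dec-false (toℕ i <? toℕ j) (≤⇒≯ p) = refl
          ... | no ¬p rewrite dec-false (toℕ j <? suc (toℕ i)) (λ q → ¬p (s≤s⁻¹ q)) = refl

  code-bounded : Bounded n (code u)
  code-bounded x pos with x ≤? n
  code-bounded zero () | yes h
  code-bounded (suc x) pos | yes h = code-bound (suc x) (s≤s z≤n) h
  ... | no ¬h = contradiction (code-beyond x (≰⇒> ¬h)) (>⇒≢ pos)

  code-≤-μ : ∀ x → 0 < code u x → x ≤ μ u
  code-≤-μ zero ()
  code-≤-μ (suc x) pos = subst (_≤ μ u) (cong (λ z → if z then suc x else 0) (dec-true (0 <? code u (suc x)) pos))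
    (max-≥ (∈-map⁺ (λ i → if 0 <ᵇ code u i then i else 0) (range-∈ (s≤s z≤n) (≤-trans (m≤m+n (suc x) _) (code-bounded (suc x) pos)))))
    where
      max-≥ : ∀ {y xs} → y ∈ xs → y ≤ foldr _⊔_ 0 xs
      max-≥ {xs = z ∷ xs} (here refl) = m≤m⊔n z _
      max-≥ {xs = z ∷ xs} (there i) = ≤-trans (max-≥ i) (m≤n⊔m z _)

run-lengths : ∀ {R lf lf′ i S l es} → (∀ r → lf r ≡ lf′ r) → Run R lf i S l es → Run R lf′ i S l es
run-lengths e (done h) = done (λ r → trans (h r) (e r))
run-lengths e (row h ρ) = row h (run-lengths e ρ)
run-lengths e (patch a A f u ρ) = patch a A f u (run-lengths e ρ)

run-rows : ∀ {R R′ lf i S S′ l es} → (∀ r c → 1 ≤ r → r < i → R r c ≡ R′ r c) → (∀ c → 1 ≤ i → S c ≡ S′ c) →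
  Run R lf i S l es → Run R′ lf i S′ l es
run-rows h h′ (done e) = done e
run-rows h h′ (row {i} e ρ) = row (λ c → trans (sym (h′ c (s≤s z≤n))) (e c))
  (run-rows (λ r c p q → h r c p (≤-trans q (n≤1+n i))) (λ c p → h i c p ≤-refl) ρ)
run-rows h h′ (patch a A f u ρ) = patch a
  (record { union = λ c → trans (sym (h′ c (s≤s z≤n))) (Appended.union A c) ; bound = Appended.bound A })
  f u (run-rows h (λ _ _ → refl) ρ)

run-column-0 : ∀ {R lf i S l es} → Run R lf i S l es → (1 ≤ i → S 0 ≡ false) × (∀ r → 1 ≤ r → r < i → R r 0 ≡ false)
run-column-0 (done _) = (λ ()) , (λ _ _ ())
run-column-0 {R} (row {i} h ρ) = (λ _ → h 0) , rows
  where rows : ∀ r → 1 ≤ r → r < suc i → R r 0 ≡ false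
        rows r p q with m≤n⇒m<n∨m≡n (s≤s⁻¹ q)
        ... | inj₁ lt = proj₂ (run-column-0 ρ) r p lt
        ... | inj₂ refl = proj₁ (run-column-0 ρ) p
run-column-0 (patch _ A f u ρ) = (λ p → trans (Appended.before A z≤n) (proj₁ (run-column-0 ρ) p)) , proj₂ (run-column-0 ρ)

-- Boolean grids, and pipe dreams as the grids that carry a run

module _ {A : Set} {d : A} where

  at-beyond : ∀ {m} (xs : Vec A m) k → m ≤ k → at d xs k ≡ d
  at-beyond V.[] k h = refl
  at-beyond (x V.∷ xs) (suc k) h = at-beyond xs k (s≤s⁻¹ h)

  at-replicate : ∀ m k → at d (V.replicate m d) k ≡ d
  at-replicate zero k = refl
  at-replicate (suc m) zero = refl
  at-replicate (suc m) (suc k) = at-replicate m k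

  at-tabulate : ∀ {m} (f : Fin m → A) i → at d (V.tabulate f) (toℕ i) ≡ f i
  at-tabulate f F.zero = refl
  at-tabulate f (F.suc i) = at-tabulate (f ∘ F.suc) i

  at-ext : ∀ {m} (xs ys : Vec A m) → (∀ k → k < m → at d xs k ≡ at d ys k) → xs ≡ ys
  at-ext V.[] V.[] h = refl
  at-ext (x V.∷ xs) (y V.∷ ys) h = cong₂ V._∷_ (h 0 z<s) (at-ext xs ys (λ k lt → h (suc k) (s≤s lt)))

module _ {n : ℕ} where

  cell-ext : (G G′ : Grid n) → (∀ r c → 1 ≤ r → r ≤ n → cell G r c ≡ cell G′ r c) → G ≡ G′
  cell-ext G G′ h = at-ext G G′ (λ r lt → at-ext _ _ (λ c _ → h (suc r) (suc c) (s≤s z≤n) lt))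

  cell-pos : (G : Grid n) → ∀ r c → cell G r c ≡ true → 1 ≤ r × 1 ≤ c × r ≤ n
  cell-pos G (suc r) (suc c) e with suc r ≤? n
  ... | yes p = s≤s z≤n , s≤s z≤n , p
  ... | no ¬p = ⊥-elim (true≢false e (trans (cong (λ z → at false z c) (at-beyond G r (s≤s⁻¹ (≰⇒> ¬p)))) (at-replicate n c)))

  gridOf : (ℕ → Row) → Grid n
  gridOf R = V.tabulate (λ r → V.tabulate (λ c → R (suc (toℕ r)) (suc (toℕ c))))

  cell-gridOf : ∀ R r c → r < n → c < n → cell (gridOf R) (suc r) (suc c) ≡ R (suc r) (suc c)
  cell-gridOf R r c r<n c<n = go r c (fromℕ< r<n) (fromℕ< c<n) (toℕ-fromℕ< r<n) (toℕ-fromℕ< c<n)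
    where
      go : ∀ r c (i j : Fin n) → toℕ i ≡ r → toℕ j ≡ c → cell (gridOf R) (suc r) (suc c) ≡ R (suc r) (suc c)
      go r c i j refl refl = trans (cong (λ z → at false z (toℕ j)) (at-tabulate {d = V.replicate n false} (λ r → V.tabulate (λ c → R (suc (toℕ r)) (suc (toℕ c)))) i))
        (at-tabulate (λ c → R (suc (toℕ i)) (suc (toℕ c))) j)

  pipe-just : (G : Grid n) → ∀ {c t cs} → Pipe n (cell G) 1 c t cs → pipe G c ≡ just (t , cs)
  pipe-just G {c} {t} {cs} p = trans (Pipe⇒trace G (suc (suc (n + n))) 1 c [] p
    (s≤s (≤-trans (+-monoˡ-≤ (suc n) (s≤s⁻¹ (pipe-inΔ p))) (≤-trans (≤-reflexive (+-suc n n)) (s≤s (m≤m+n _ 1))))))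
    (cong (λ z → just (t , z)) (++-identityʳ cs))

  crossings-common : (G : Grid n) → ∀ {a b t t′ cs cs′} → pipe G a ≡ just (t , cs) → pipe G b ≡ just (t′ , cs′) →
    crossings G a b ≡ common cs cs′
  crossings-common G {a} {b} e e′ with pipe G a | pipe G b
  crossings-common G refl refl | _ | _ = refl

  fin : ∀ c → 1 ≤ c → c ≤ n → ∃[ f ] suc (toℕ {n} f) ≡ c
  fin (suc c) _ h = fromℕ< h , cong suc (toℕ-fromℕ< h)

  module _ (u : Permutation′ n) (G : Grid n) where

    -- Below row n the triangle has no columns, so the induction from the bottom row starts with
    -- vacuous hypotheses.
    none-below : ∀ {r c t cs} {B : Set} → n ≤ r → Pipe n (cell G) (suc r) c t cs → B
    none-below {r} h p = contradiction (≤-trans (+-mono-≤ (s≤s h) (pipe-pos p)) (pipe-inΔ p))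
      (<⇒≱ (≤-reflexive (cong suc (+-comm 1 n))))

    module _ (P : IsPipeDream u G) where
      open IsPipeDream P

      private
        inΔ : ∀ r c → cell G r c ≡ true → 1 ≤ r × 1 ≤ c × r + c ≤ suc n
        inΔ r c e with cell-pos G r c e
        ... | p , q , _ = p , q , subsetΔ r c (subst T (sym e) _)

        label-pipe : ∀ f → ∃[ cs ] Pipe n (cell G) 1 (suc (toℕ f)) (suc (toℕ (u ⟨$⟩ˡ f))) cs
        label-pipe f with exits (u ⟨$⟩ˡ f)
        ... | cs , e with trace⇒Pipe G (suc (suc (n + n))) 1 _ [] e
        ...   | cs′ , _ , p = cs′ , subst (λ z → Pipe n (cell G) 1 (suc (toℕ z)) _ cs′) (inverseʳ u) p

        good-1 : Good {n} {cell G} 1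
        good-1 = record { cover = cover ; reduced = red }
          where
            cover : ∀ c → 1 ≤ c → 1 + c ≤ suc n → ∃[ t ] ∃[ cs ] Pipe n (cell G) 1 c t cs
            cover c p b with fin c p (s≤s⁻¹ b)
            ... | f , refl = _ , label-pipe f
            red : ∀ {c c′ t t′ cs cs′} → Pipe n (cell G) 1 c t cs → Pipe n (cell G) 1 c′ t′ cs′ → c ≢ c′ → common cs cs′ ≤ 1
            red {c} {c′} p p′ ne with fin c (pipe-pos p) (s≤s⁻¹ (pipe-inΔ p)) | fin c′ (pipe-pos p′) (s≤s⁻¹ (pipe-inΔ p′))
            ... | f , refl | f′ , refl = subst (_≤ 1) (crossings-common G (pipe-just G p) (pipe-just G p′)) (reduced f f′ (λ { refl → ne refl }))

        good : ∀ r → 1 ≤ r → Good {n} {cell G} r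
        good (suc zero) _ = good-1
        good (suc (suc r)) _ = good-suc (good (suc r) (s≤s z≤n))

        rowShape : ∀ r → ∃[ k ] Shape (cell G r) k
        rowShape r = shape (suc n) (suc n) (cell G r) ≤-refl (zero-col r) (λ c lt → far c lt)
          where
            zero-col : ∀ r → cell G r 0 ≡ false
            zero-col zero = refl
            zero-col (suc r) = refl
            far : ∀ c → suc n < c → cell G r c ≡ false
            far c lt with cell G r c in e
            ... | false = refl
            ... | true = contradiction (≤-trans (m≤n+m c r) (proj₂ (proj₂ (inΔ r c e)))) (<⇒≱ lt)

        initial : ℕ → ℕ
        initial r = proj₁ (rowShape r)

        initial-outside : ∀ x → x < 1 ⊎ n < x → initial x ≡ 0
        initial-outside x h = shape-empty (proj₂ (rowShape x)) (empty x h)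
          where
            empty : ∀ x → x < 1 ⊎ n < x → cell G x 1 ≡ false
            empty zero _ = refl
            empty (suc x) (inj₁ (s≤s ()))
            empty (suc x) (inj₂ lt) with cell G (suc x) 1 in e
            ... | false = refl
            ... | true = contradiction (proj₂ (proj₂ (cell-pos G (suc x) 1 e))) (<⇒≱ lt)

      -- The final lengths built from the grid and the code of u both send every label to its exit
      -- row, so `exit-unique` identifies them in rows 1 to n. Elsewhere both are zero.
      pipeDream⇒run : ∃[ es ] ∃[ l ] Run (cell G) (code u) n (cell G n) l es
      pipeDream⇒run with build inΔ good n {l = initial} (proj₂ (rowShape n)) refl (λ r _ → proj₂ (rowShape r))
                          (ordered-start inΔ good n (none-below ≤-refl)) (pipeExits-next n (none-below ≤-refl))
      ... | es , lf , ρ , out , E = es , initial , run-lengths same ρ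
        where
          both : ∀ c → 1 ≤ c → c ≤ n → ∃[ t ] Exit lf 1 c t × Exit (code u) 1 c t
          both c p q with fin c p q
          ... | f , refl = _ , E (proj₂ (label-pipe f)) ,
                subst (λ z → Exit (code u) 1 (suc (toℕ z)) (suc (toℕ (u ⟨$⟩ˡ f)))) (inverseʳ u) (code-exit u (u ⟨$⟩ˡ f))
          same : ∀ x → lf x ≡ code u x
          same zero = trans (out 0 (inj₁ z<s)) (initial-outside 0 (inj₁ z<s))
          same (suc x) with ≤-<-connex (suc x) n
          ... | inj₁ p = exit-unique n 1 refl ≤-refl (code-bound u) both (suc x) (s≤s z≤n) p
          ... | inj₂ p = trans (trans (out (suc x) (inj₂ p)) (initial-outside (suc x) (inj₂ p))) (sym (code-beyond u (suc x) p))

    module _ {l es} (ρ : Run (cell G) (code u) n (cell G n) l es) where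
      private
        inΔ : ∀ r c → 1 ≤ r → cell G r c ≡ true → r + c ≤ n
        inΔ r c p e with m≤n⇒m<n∨m≡n (proj₂ (proj₂ (cell-pos G r c e)))
        ... | inj₁ lt = proj₂ (run-inΔ ρ (code-bounded u)) r c p lt e
        ... | inj₂ refl = proj₁ (run-inΔ ρ (code-bounded u)) c p e

        noRecross : ∀ r → 1 ≤ r → NoRecross {n} {cell G} r (cell G r)
        noRecross r p with r <? n
        ... | yes lt = run-noRecross-rows ρ (pipeExits-next n (none-below ≤-refl)) inΔ r p lt
        ... | no ¬lt = λ _ q _ → none-below (≮⇒≥ ¬lt) q

        label-pipe : ∀ c → 1 ≤ c → c ≤ n → ∃[ t ] ∃[ cs ] Pipe n (cell G) 1 c t cs
        label-pipe c p q = pipe-total inΔ n 1 c ≤-refl refl p q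

        exit-row : ∀ {c t cs} → Pipe n (cell G) 1 c t cs → Exit (code u) 1 c t
        exit-row = run-pipeExits ρ (pipeExits-next n (none-below ≤-refl))

      -- The actual pipes leave as the final lengths, that is the code, prescribe, and `code-exit`
      -- reads this as u. Reducedness is `few-crosses`.
      run⇒pipeDream : IsPipeDream u G
      run⇒pipeDream = record { subsetΔ = subsetΔ ; exits = exits ; reduced = reduced }
        where
          subsetΔ : InΔ G
          subsetΔ r c t with cell G r c in e
          ... | true = ≤-trans (inΔ r c (proj₁ (cell-pos G r c e)) e) (n≤1+n n)
          exits : ∀ i → Σ (List Pos) λ cs → pipe G (suc (toℕ (u ⟨$⟩ʳ i))) ≡ just (suc (toℕ i) , cs)
          exits i with label-pipe (suc (toℕ (u ⟨$⟩ʳ i))) (s≤s z≤n) (toℕ<n _)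
          ... | t , cs , p = cs , trans (pipe-just G p) (cong (λ z → just (z , cs)) (exit-det (exit-row p) (code-exit u i)))
          reduced : ∀ (a b : Fin n) → a ≢ b → crossings G (suc (toℕ a)) (suc (toℕ b)) ≤ 1
          reduced a b ne with label-pipe (suc (toℕ a)) (s≤s z≤n) (toℕ<n _) | label-pipe (suc (toℕ b)) (s≤s z≤n) (toℕ<n _)
          ... | t , cs , p | t′ , cs′ , p′ = subst (_≤ 1) (sym (crossings-common G (pipe-just G p) (pipe-just G p′))) few
            where
              few : common cs cs′ ≤ 1
              few with <-cmp (toℕ a) (toℕ b)
              ... | tri< lt _ _ = proj₁ (proj₂ (few-crosses noRecross ≤-refl p p′ (s≤s lt)))
              ... | tri≈ _ e _ = contradiction (toℕ-injective e) ne
              ... | tri> _ _ gt = proj₂ (proj₂ (few-crosses noRecross ≤-refl p′ p (s≤s gt)))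

-- The ladder order

data Lex : List ℕ → List ℕ → Set where
  end  : ∀ {a r} → Lex (a ∷ r) []
  less : ∀ {a b r r′} → a < b → Lex (a ∷ r) (b ∷ r′)
  same : ∀ {a r r′} → Lex r r′ → Lex (a ∷ r) (a ∷ r′)

data Before : Index → Index → Set where
  lower : ∀ {i i′ ks ks′} → i′ < i → Before (i , ks) (i′ , ks′)
  row   : ∀ {i ks ks′} → Lex ks ks′ → Before (i , ks) (i , ks′)

lex⇒precL : ∀ {a b} → Lex a b → precL a b ≡ true
lex⇒precL end = refl
lex⇒precL (less {a} {b} lt) rewrite dec-true (a <? b) lt = refl
lex⇒precL (same {a} h) rewrite dec-false (a <? a) (<-irrefl refl) | dec-true (a ≟ a) refl = lex⇒precL h

precL⇒lex : ∀ a b → precL a b ≡ true → Lex a b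
precL⇒lex (a ∷ r) [] e = end
precL⇒lex (a ∷ r) (b ∷ r′) e with <-cmp a b
... | tri< lt _ _ = less lt
... | tri≈ _ refl _ rewrite dec-false (a <? a) (<-irrefl refl) | dec-true (a ≟ a) refl = same (precL⇒lex r r′ e)
... | tri> ¬lt ne _ rewrite dec-false (a <? b) ¬lt | dec-false (a ≟ b) ne = contradiction e λ ()

before⇒prec : ∀ {e e′} → Before e e′ → prec e e′ ≡ true
before⇒prec (lower {i} {i′} lt) rewrite dec-true (i′ <? i) lt = refl
before⇒prec (row {i} h) rewrite dec-true (i ≟ i) refl | lex⇒precL h = ∨-zeroʳ (i <ᵇ i)

prec⇒before : ∀ e e′ → prec e e′ ≡ true → Before e e′
prec⇒before (i , ks) (i′ , ks′) h with ∨-true {i′ <ᵇ i} h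
... | inj₁ lt = lower (<ᵇ-true i′ i lt)
... | inj₂ eq with i ≟ i′
...   | yes refl = row (precL⇒lex ks ks′ (proj₂ (∧-true {i ≡ᵇ i} eq)))
...   | no ne = contradiction (trans (sym (dec-false (i ≟ i′) ne)) (proj₁ (∧-true eq))) λ ()

lex-trans : ∀ {a b c} → Lex a b → Lex b c → Lex a c
lex-trans end ()
lex-trans (less p) end = end
lex-trans (less p) (less q) = less (<-trans p q)
lex-trans (less p) (same _) = less p
lex-trans (same p) end = end
lex-trans (same p) (less q) = less q
lex-trans (same p) (same q) = same (lex-trans p q)

lex-irrefl : ∀ {a} → ¬ Lex a a
lex-irrefl (less p) = <-irrefl refl p
lex-irrefl (same p) = lex-irrefl p

lex-tri : ∀ a b → Lex a b ⊎ a ≡ b ⊎ Lex b a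
lex-tri [] [] = inj₂ (inj₁ refl)
lex-tri [] (b ∷ r) = inj₂ (inj₂ end)
lex-tri (a ∷ r) [] = inj₁ end
lex-tri (a ∷ r) (b ∷ r′) with <-cmp a b
... | tri< p _ _ = inj₁ (less p)
... | tri> _ _ p = inj₂ (inj₂ (less p))
... | tri≈ _ refl _ with lex-tri r r′
...   | inj₁ p = inj₁ (same p)
...   | inj₂ (inj₁ refl) = inj₂ (inj₁ refl)
...   | inj₂ (inj₂ p) = inj₂ (inj₂ (same p))

before-trans : ∀ {a b c} → Before a b → Before b c → Before a c
before-trans (lower p) (lower q) = lower (<-trans q p)
before-trans (lower p) (row _) = lower p
before-trans (row _) (lower q) = lower q
before-trans (row p) (row q) = row (lex-trans p q)

before-irrefl : ∀ {a} → ¬ Before a a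
before-irrefl (lower p) = <-irrefl refl p
before-irrefl (row p) = lex-irrefl p

before-tri : ∀ a b → Before a b ⊎ a ≡ b ⊎ Before b a
before-tri (i , ks) (i′ , ks′) with <-cmp i i′
... | tri< p _ _ = inj₂ (inj₂ (lower p))
... | tri> _ _ p = inj₁ (lower p)
... | tri≈ _ refl _ with lex-tri ks ks′
...   | inj₁ p = inj₁ (row p)
...   | inj₂ (inj₁ refl) = inj₂ (inj₁ refl)
...   | inj₂ (inj₂ p) = inj₂ (inj₂ (row p))

before-row : ∀ {e e′} → Before e e′ → proj₁ e′ ≤ proj₁ e
before-row (lower p) = <⇒≤ p
before-row (row _) = ≤-refl

¬before⇒prec-false : ∀ {e e′} → ¬ Before e e′ → prec e e′ ≡ false
¬before⇒prec-false {e} {e′} h with prec e e′ in eq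
... | true = contradiction (prec⇒before e e′ eq) h
... | false = refl

Sorted : List Index → Set
Sorted = AllPairs Before

sorted-≡ : ∀ {xs ys} → Sorted xs → Sorted ys → (∀ e → e ∈ xs → e ∈ ys) → (∀ e → e ∈ ys → e ∈ xs) → xs ≡ ys
sorted-≡ {[]} {[]} _ _ f g = refl
sorted-≡ {[]} {y ∷ ys} _ _ f g with g y (here refl)
... | ()
sorted-≡ {x ∷ xs} {[]} _ _ f g with f x (here refl)
... | ()
sorted-≡ {x ∷ xs} {y ∷ ys} (a ∷ as) (b ∷ bs) f g = cong₂ _∷_ x≡y
  (sorted-≡ as bs (λ e i → drop (λ { refl → before-irrefl (All.lookup a (subst (_∈ xs) (sym x≡y) i)) }) (f e (there i)))
                  (λ e i → drop (λ { refl → before-irrefl (All.lookup b (subst (_∈ ys) x≡y i)) }) (g e (there i))))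
  where
    drop : ∀ {e z : Index} {zs} → e ≢ z → e ∈ z ∷ zs → e ∈ zs
    drop ne (here e) = contradiction e ne
    drop ne (there i) = i
    x≡y : x ≡ y
    x≡y with f x (here refl) | g y (here refl)
    ... | here e | _ = e
    ... | there _ | here e = sym e
    ... | there i | there j = contradiction (before-trans (All.lookup a j) (All.lookup b i)) before-irrefl

insert : Index → List Index → List Index
insert e [] = e ∷ []
insert e (x ∷ xs) with before-tri e x
... | inj₁ _ = e ∷ x ∷ xs
... | inj₂ _ = x ∷ insert e xs

insert-↭ : ∀ e xs → insert e xs ↭ e ∷ xs
insert-↭ e [] = ↭-refl
insert-↭ e (x ∷ xs) with before-tri e x
... | inj₁ _ = ↭-refl
... | inj₂ _ = ↭-trans (prep x (insert-↭ e xs)) (swap x e ↭-refl)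

insert-sorted : ∀ e xs → All (e ≢_) xs → Sorted xs → Sorted (insert e xs)
insert-sorted e [] ne [] = [] ∷ []
insert-sorted e (x ∷ xs) (n ∷ ne) (a ∷ as) with before-tri e x
... | inj₁ lt = (lt ∷ All.map (before-trans lt) a) ∷ a ∷ as
... | inj₂ (inj₁ eq) = contradiction eq n
... | inj₂ (inj₂ gt) = All.tabulate (λ i → later (∈-resp-↭ (insert-↭ e xs) i)) ∷ insert-sorted e xs ne as
  where later : ∀ {y} → y ∈ e ∷ xs → Before x y
        later (here refl) = gt
        later (there i) = All.lookup a i

sort : List Index → List Index
sort [] = []
sort (e ∷ es) = insert e (sort es)

sort-↭ : ∀ es → sort es ↭ es
sort-↭ [] = ↭-refl
sort-↭ (e ∷ es) = ↭-trans (insert-↭ e (sort es)) (prep e (sort-↭ es))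

sort-sorted : ∀ {es} → Unique es → Sorted (sort es)
sort-sorted [] = []
sort-sorted {e ∷ es} (h ∷ hs) = insert-sorted e (sort es) (All.tabulate (λ i → All.lookup h (∈-resp-↭ (sort-↭ es) i))) (sort-sorted hs)

minPrec-least : ∀ xs h → h ∈ xs → All (λ e → e ≡ h ⊎ Before h e) xs → minPrec xs ≡ just h
minPrec-least (e ∷ []) .e (here refl) _ = refl
minPrec-least (e ∷ e′ ∷ es) .e (here refl) (_ ∷ hs) with minPrec (e′ ∷ es) in eq | minPrec-∈ (e′ ∷ es)
  where minPrec-∈ : ∀ xs {m} → minPrec xs ≡ just m → m ∈ xs
        minPrec-∈ (e ∷ es) eq with minPrec es in eq′
        minPrec-∈ (e ∷ es) refl | nothing = here refl
        ... | just m with prec e m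
        minPrec-∈ (e ∷ es) refl | just m | true = here refl
        minPrec-∈ (e ∷ es) refl | just m | false = there (minPrec-∈ es eq′)
... | nothing | f = refl
... | just m | f with All.lookup hs (f refl)
...   | inj₂ b rewrite before⇒prec b = refl
...   | inj₁ refl with prec m m
...     | true = refl
...     | false = refl
minPrec-least (e ∷ es) h (there i) (h₀ ∷ hs) rewrite minPrec-least es h i hs with h₀
... | inj₁ refl rewrite ¬before⇒prec-false (before-irrefl {e}) = refl
... | inj₂ b rewrite ¬before⇒prec-false {e} {h} (λ b′ → before-irrefl (before-trans b b′)) = refl

sumWhere-↭ : ∀ p x {xs ys} → xs ↭ ys → sumWhere p x xs ≡ sumWhere p x ys
sumWhere-↭ p x h = sum-↭ (map⁺ x (filter-↭ _ h))

filterᵇ-cong : ∀ {A : Set} (p q : A → Bool) xs → All (λ e → p e ≡ q e) xs → L.filterᵇ p xs ≡ L.filterᵇ q xs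
filterᵇ-cong p q [] [] = refl
filterᵇ-cong p q (x ∷ xs) (h ∷ hs) with p x | q x | h
... | true | _ | refl = cong (x ∷_) (filterᵇ-cong p q xs hs)
... | false | _ | refl = filterᵇ-cong p q xs hs

filterᵇ-none : ∀ {A : Set} (p : A → Bool) xs → All (λ e → p e ≡ false) xs → L.filterᵇ p xs ≡ []
filterᵇ-none p [] [] = refl
filterᵇ-none p (x ∷ xs) (h ∷ hs) with p x | h
... | false | _ = filterᵇ-none p xs hs

sorted-split : ∀ pre {e post} → Sorted (pre ++ e ∷ post) → All (λ f → Before f e) pre × All (Before e) post × Sorted post
sorted-split [] (a ∷ as) = [] , a , as
sorted-split (f ∷ pre) {e} (a ∷ as) with sorted-split pre as
... | b , c , d = All.lookup a (∈-++⁺ʳ pre (here refl)) ∷ b , c , d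

filter-after : ∀ (q : Index → Bool) pre e post → Sorted (pre ++ e ∷ post) →
  L.filterᵇ (λ f → prec e f ∧ q f) (pre ++ e ∷ post) ≡ L.filterᵇ q post
filter-after q pre e post s with sorted-split pre s
... | b , c , d = trans (filter-++ _ pre (e ∷ post)) (cong₂ _++_
  (filterᵇ-none _ pre (All.map (λ {f} lt → cong (_∧ q f) (¬before⇒prec-false (λ lt′ → before-irrefl (before-trans lt lt′)))) b))
  (trans (dropHead (cong (_∧ q e) (¬before⇒prec-false (before-irrefl {e}))))
    (filterᵇ-cong _ q post (All.map (λ {f} lt → cong (_∧ q f) (before⇒prec lt)) c))))
  where
    dropHead : (prec e e ∧ q e) ≡ false → L.filterᵇ (λ f → prec e f ∧ q f) (e ∷ post) ≡ L.filterᵇ (λ f → prec e f ∧ q f) post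
    dropHead h with prec e e ∧ q e | h
    ... | false | _ = refl

-- Fall in terms of lengths only: at the rows where the patch stops the row is too short
-- to touch it, and the rows it passes reach beyond it.

-- The equation `r + d ≡ q + sum pre` means r = q - d + sum pre, where q - d is the row from which
-- the current move starts. An empty `pre` is left out: that row may be the unfinished origin row,
-- which is not described by a length.
Stops : (ℕ → ℕ) → ℕ → ℕ → List ℕ → ℕ → Set
Stops l q d ks t = ∀ pre k post → ks ≡ pre ++ k ∷ post → pre ≢ [] → ∀ r → r + d ≡ q + sum pre → l r ≤ l t + length post

-- With `length post` moves to come after the current one, the last column of the patch is
-- `l t + m + suc (length post)`. For the current move only the rows from q on matter, hence `d ≤ s`
-- when `pre` is empty.
Passes : (ℕ → ℕ) → ℕ → ℕ → ℕ → List ℕ → ℕ → Set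
Passes l q d m ks t = ∀ pre k post → ks ≡ pre ++ k ∷ post → ∀ s → 1 ≤ s → (pre ≡ [] → d ≤ s) → s < k →
  ∀ r → r + d ≡ q + sum pre + s → l t + m + suc (length post) ≤ l r

private
  shift-head : ∀ {r d q} a → r + d ≡ q + (d + a) → r ≡ q + a
  shift-head {r} {d} {q} a e = +-cancelʳ-≡ d r (q + a) (trans e (trans (cong (q +_) (+-comm d a)) (sym (+-assoc q a d))))

  next-row : ∀ {r d} q a → r + d ≡ q + (d + a) → r + 1 ≡ suc q + a
  next-row {r} {d} q a e = trans (+-comm r 1) (cong suc (shift-head {r} {d} {q} a e))

  next-row-+ : ∀ {r d} q a s → r + d ≡ q + (d + a) + s → r + 1 ≡ suc q + a + s
  next-row-+ {r} {d} q a s e = trans (next-row {r} {d} q (a + s) (trans e (trans (+-assoc q (d + a) s) (cong (q +_) (+-assoc d a s)))))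
    (cong suc (sym (+-assoc q a s)))

  patch-end : ∀ {j lt ℓ} m → j ≡ lt + suc ℓ → j + m ≡ lt + m + suc ℓ
  patch-end {lt = lt} {ℓ} m refl = trans (+-assoc lt (suc ℓ) m) (trans (cong (lt +_) (+-comm (suc ℓ) m)) (sym (+-assoc lt m (suc ℓ))))

fall⇒stops : ∀ {l q d j m ks t} → Fall l q d j m ks t → Stops l q d ks t
fall⇒stops (pass {d = d} p f) pre k post e ne r er = fall⇒stops f pre k post e ne r (trans (+-suc r d) (cong suc er))
fall⇒stops (land p f) [] k post e ne r er = contradiction refl ne
fall⇒stops {l} {q} {t = t} (land {d = d} p f) (.d ∷ []) k post refl ne r er
  rewrite trans (shift-head {r} {d} {q} 0 er) (+-identityʳ q) =
  s≤s⁻¹ (≤-trans p (≤-reflexive (trans (fall-col f) (+-suc (l t) (length post)))))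
fall⇒stops {q = q} (land p f) (d ∷ b ∷ pre) k post refl ne r er = fall⇒stops f (b ∷ pre) k post refl (λ ()) r (next-row q (sum (b ∷ pre)) er)
fall⇒stops (stop x) [] k post e ne r er = contradiction refl ne
fall⇒stops (stop x) (d ∷ []) k post () ne r er
fall⇒stops (stop x) (d ∷ _ ∷ _) k post () ne r er

fall⇒passes : ∀ {l q d j m ks t} → Fall l q d j m ks t → Passes l q d m ks t
fall⇒passes {l} {q} {m = m} (pass {d = d} p f) [] k post refl s 1≤s d≤s s<k r er with m≤n⇒m<n∨m≡n (d≤s refl)
... | inj₁ lt = fall⇒passes f [] k post refl s 1≤s (λ _ → lt) s<k r (trans (+-suc r d) (cong suc er))
... | inj₂ refl rewrite +-cancelʳ-≡ d r q (trans er (cong (_+ d) (+-identityʳ q))) =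
  ≤-trans (≤-reflexive (sym (patch-end m (fall-col f)))) p
fall⇒passes (pass {d = d} p f) pre@(_ ∷ _) k post e s 1≤s d≤s s<k r er =
  fall⇒passes f pre k post e s 1≤s (λ ()) s<k r (trans (+-suc r d) (cong suc er))
fall⇒passes (land p f) [] k post refl s 1≤s d≤s s<k r er = contradiction (d≤s refl) (<⇒≱ s<k)
fall⇒passes {q = q} (land p f) (d ∷ pre) k post refl s 1≤s d≤s s<k r er =
  fall⇒passes f pre k post refl s 1≤s (λ _ → 1≤s) s<k r (next-row-+ q (sum pre) s er)
fall⇒passes (stop x) [] k post refl s 1≤s d≤s s<k r er = contradiction (d≤s refl) (<⇒≱ s<k)
fall⇒passes (stop x) (d ∷ []) k post () s 1≤s d≤s s<k r er
fall⇒passes (stop x) (d ∷ _ ∷ _) k post () s 1≤s d≤s s<k r er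

-- Here d counts the rows of the current move up to row q and g those still missing to k. The column
-- is the one forced by `fall-col`.
stops-passes⇒fall : ∀ {l m t} k ks g d q → All (1 ≤_) ks → d + g ≡ k → 1 ≤ d → t + d ≡ q + sum (k ∷ ks) →
  Stops l q d (k ∷ ks) t → Passes l q d m (k ∷ ks) t → Fall l q d (l t + suc (length ks)) m (k ∷ ks) t
stops-passes⇒fall {l} {m} {t} k ks (suc g) d q pos e 1≤d et st ps =
  pass (≤-trans (≤-reflexive (patch-end m refl)) (ps [] k ks refl d 1≤d (λ _ → ≤-refl)
         (≤-trans (≤-reflexive (+-comm 1 d)) (≤-trans (+-monoʳ-≤ d (s≤s z≤n)) (≤-reflexive e))) q (cong (_+ d) (sym (+-identityʳ q)))))
    (stops-passes⇒fall k ks g (suc d) (suc q) pos (trans (sym (+-suc d g)) e) (s≤s z≤n) (trans (+-suc t d) (cong suc et))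
      (λ pre k post e ne r er → st pre k post e ne r (suc-injective (trans (sym (+-suc r d)) er)))
      (λ pre k post e s 1≤s d≤s s<k r er → ps pre k post e s 1≤s (λ z → <⇒≤ (d≤s z)) s<k r (suc-injective (trans (sym (+-suc r d)) er))))
stops-passes⇒fall {l} {m} {t} k [] zero d q pos e 1≤d et st ps with trans (sym (+-identityʳ d)) e
... | refl with trans (shift-head {t} {d} {q} 0 et) (+-identityʳ q)
...   | refl = stop (+-comm (l t) 1)
stops-passes⇒fall {l} {m} {t} k (k′ ∷ ks) zero d q (p ∷ pos) e 1≤d et st ps with trans (sym (+-identityʳ d)) e
... | refl = subst (λ z → Fall l q d z m (d ∷ k′ ∷ ks) t) (sym (+-suc (l t) (suc (length ks))))
  (land (≤-trans (s≤s (st (d ∷ []) k′ ks refl (λ ()) q (cong (q +_) (sym (+-identityʳ d))))) (≤-reflexive (sym (+-suc (l t) (length ks)))))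
    (stops-passes⇒fall k′ ks (k′ ∸ 1) 1 (suc q) pos (m+[n∸m]≡n p) ≤-refl (next-row q (sum (k′ ∷ ks)) et)
      (λ pre k post e ne r er → st (d ∷ pre) k post (cong (d ∷_) e) (λ ()) r (from-next (sum pre) er))
      (λ pre k post e s 1≤s d≤s s<k r er → ps (d ∷ pre) k post (cong (d ∷_) e) s 1≤s (λ ()) s<k r
        (trans (from-next (sum pre + s) (trans er (cong suc (+-assoc q (sum pre) s))))
          (trans (cong (q +_) (sym (+-assoc d (sum pre) s))) (sym (+-assoc q (d + sum pre) s)))))))
  where
    from-next : ∀ {r} a → r + 1 ≡ suc q + a → r + d ≡ q + (d + a)
    from-next {r} a er with suc-injective (trans (+-comm 1 r) er)
    ... | refl = trans (+-assoc q a d) (cong (q +_) (+-comm a d))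

-- Runs produce sorted events

-- A patch and a later one from the same row, further left, are followed until they part. Where the
-- first passes, the row reaches beyond both. Where the first lands, the second may pass, making its
-- step larger, or be aligned already, making its index a proper prefix. Where the first stops, it
-- lengthens the row by at least one, so the second must pass.
fall-lex : ∀ {l l′ q d j j′ m m′ ks ks′ t t′} → Fall l q d j m ks t → Fall l′ q d j′ m′ ks′ t′ → j′ < j →
  1 ≤ m → Updated l l′ t m → Lex ks ks′
fall-lex {q = q} {j = j} (pass p f) (land p′ g) h 1≤m u = contradiction (<-trans (<-trans p′ (n<1+n _)) h)
  (≤⇒≯ (≤-trans (m≤m+n j _) (≤-trans p (≤-reflexive (sym (proj₂ u q (<⇒≢ (fall-≥ f))))))))
fall-lex {q = q} {j = j} (pass p f) (stop refl) h 1≤m u = contradiction (<-trans (n<1+n _) h)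
  (≤⇒≯ (≤-trans (m≤m+n j _) (≤-trans p (≤-reflexive (sym (proj₂ u q (<⇒≢ (fall-≥ f))))))))
fall-lex (pass p f) (pass p′ g) h 1≤m u = fall-lex f g h 1≤m u
fall-lex (land p f) (pass p′ g) h 1≤m u with fall-head g
... | k , ks , refl , d<k = less d<k
fall-lex (land p f) (land p′ g) h 1≤m u = same (fall-lex f g (s≤s⁻¹ h) 1≤m u)
fall-lex (land p f) (stop x) h 1≤m u with fall-head f
... | k , ks , refl , _ = same end
fall-lex (stop x) (pass p′ g) h 1≤m u with fall-head g
... | k , ks , refl , d<k = less d<k
fall-lex {l} {l′} {q} {m = m} (stop refl) (land p′ g) h 1≤m u = contradiction (<-trans (<-trans p′ (n<1+n _)) h)
  (≤⇒≯ (≤-trans (≤-trans (≤-reflexive (+-comm 1 (l q))) (+-monoʳ-≤ (l q) 1≤m)) (≤-reflexive (sym (proj₁ u)))))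
fall-lex {l} {l′} {q} {m = m} (stop refl) (stop refl) h 1≤m u = contradiction (<-trans (n<1+n _) h)
  (≤⇒≯ (≤-trans (≤-trans (≤-reflexive (+-comm 1 (l q))) (+-monoʳ-≤ (l q) 1≤m)) (≤-reflexive (sym (proj₁ u)))))

appended-last : ∀ {S S′ j m} → Appended S S′ j m → 1 ≤ m → S (j + m) ≡ true
appended-last {j = j} A 1≤m = Appended.on-patch A (≤-trans (≤-reflexive (+-comm 1 j)) (+-monoʳ-≤ j 1≤m)) ≤-refl

within-bound : ∀ (S : Row) {j c} → (∀ c → j ≤ c → S c ≡ false) → S c ≡ true → c < j
within-bound S {j} {c} b e with c <? j
... | yes p = p
... | no ¬p = ⊥-elim (true≢false e (b c (≮⇒≥ ¬p)))

-- Only consecutive events need comparing: within a row by `fall-lex`, across rows by the origin.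
-- The rest is transitivity.
run-sorted : ∀ {R lf i S l es} → Run R lf i S l es → Sorted (map proj₁ es)
run-sorted (done _) = []
run-sorted (row _ ρ) = run-sorted ρ
run-sorted (patch {i = i} {m = m} {ks} 1≤m A f u ρ) = first ρ A f u (run-sorted ρ) ∷ run-sorted ρ
  where
    first : ∀ {R lf S S′ l l′ j t es} → Run R lf (suc i) S′ l′ es → Appended S S′ j m → Fall l (suc (suc i)) 1 j m ks t →
      Updated l l′ t m → Sorted (map proj₁ es) → All (Before (suc i , ks)) (map proj₁ es)
    first (row _ ρ) A f u s = AllP.map⁺ (All.map (λ h → lower (s≤s h)) (run-index ρ))
    first {S′ = S′} (patch {j = j′} {m = m′} 1≤m′ A′ f′ u′ ρ) A f u (b ∷ _) = before ∷ All.map (before-trans before) b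
      where before = row (fall-lex f f′ (≤-<-trans (m≤m+n j′ m′) (within-bound S′ (Appended.bound A) (appended-last A′ 1≤m′))) 1≤m u)

-- The quantities of the compatibility conditions

events : Φ → List Index → List Event
events x = map (λ e → (e , x e))

abs≡ : ℕ → Index → Bool
abs≡ j e = absI e ≡ᵇ j

sumWhere-∷ : ∀ p x e es → sumWhere p x (e ∷ es) ≡ (if p e then x e else 0) + sumWhere p x es
sumWhere-∷ p x e es with p e
... | true = refl
... | false = refl

sumWhere-++ : ∀ p x es es′ → sumWhere p x (es ++ es′) ≡ sumWhere p x es + sumWhere p x es′
sumWhere-++ p x es es′ = trans (cong (λ z → sum (map x z)) (filter-++ _ es es′))
  (trans (cong sum (map-++ x (L.filterᵇ p es) _)) (sum-++ (map x (L.filterᵇ p es)) _))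

sumEvents-events : ∀ p x κ → sumEvents p (events x κ) ≡ sumWhere p x κ
sumEvents-events p x [] = refl
sumEvents-events p x (e ∷ κ) = trans (cong ((if p e then x e else 0) +_) (sumEvents-events p x κ)) (sym (sumWhere-∷ p x e κ))

module _ {n : ℕ} (u : Permutation′ n) (x : Φ) where

  -- c^𝐢_j(x) for j ≠ i, where post lists the events after 𝐢.
  remaining : List Index → ℕ → ℕ
  remaining post j = code u j ∸ sumWhere (abs≡ j) x post

  -- c^𝐢_i(x), which is the column of the last cross of row i after the event 𝐢.
  rowEnd : List Index → ℕ → ℕ
  rowEnd [] i = remaining [] i
  rowEnd (e ∷ post) i = if proj₁ e ≡ᵇ i then remaining (e ∷ post) (absI e) + x e + length (proj₂ e) else remaining (e ∷ post) i

  -- Condition (2), for all j. It makes the truncated subtraction in `remaining` exact.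
  Fits : List Index → Set
  Fits κ = ∀ j → sumWhere (abs≡ j) x κ ≤ code u j

  fits-suffix : ∀ pre {post} → Fits (pre ++ post) → Fits post
  fits-suffix pre {post} h j = ≤-trans (m≤n+m _ (sumWhere (abs≡ j) x pre)) (≤-trans (≤-reflexive (sym (sumWhere-++ (abs≡ j) x pre post))) (h j))

  remaining-updated : ∀ e post → Fits (e ∷ post) → Updated (remaining (e ∷ post)) (remaining post) (absI e) (x e)
  remaining-updated e post h = at-abs , elsewhere
    where
      t = absI e
      a = sumWhere (abs≡ t) x post
      total : sumWhere (abs≡ t) x (e ∷ post) ≡ x e + a
      total = trans (sumWhere-∷ (abs≡ t) x e post) (cong (λ z → (if z then x e else 0) + a) (dec-true (t ≟ t) refl))
      at-abs : code u t ∸ a ≡ code u t ∸ sumWhere (abs≡ t) x (e ∷ post) + x e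
      at-abs rewrite total = sym (trans (cong (_+ x e) (trans (cong (code u t ∸_) (+-comm (x e) a)) (sym (∸-+-assoc (code u t) a (x e)))))
        (m∸n+n≡m (m+n≤o⇒m≤o∸n (x e) (subst (_≤ code u t) total (h t)))))
      elsewhere : ∀ r → r ≢ t → remaining post r ≡ remaining (e ∷ post) r
      elsewhere r ne = cong (code u r ∸_) (sym (trans (sumWhere-∷ (abs≡ r) x e post)
        (cong (λ z → (if z then x e else 0) + sumWhere (abs≡ r) x post) (dec-false (t ≟ r) (λ q → ne (sym q))))))

  -- The final length of a row less the patches still to arrive is its current length. This is the
  -- meaning of the numbers c in the compatibility conditions outside the origin row.
  run-remaining : ∀ {R i S l κ} → Run R (code u) i S l (events x κ) → ∀ r → remaining κ r ≡ l r
  run-remaining {l = l} {κ} ρ r = trans (cong₂ _∸_ (sym (run-sum ρ r)) (sym (sumEvents-events (abs≡ r) x κ)))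
    (m+n∸n≡m (l r) (sumEvents (abs≡ r) (events x κ)))

  run-fits : ∀ {R i S l κ} → Run R (code u) i S l (events x κ) → Fits κ
  run-fits {κ = κ} ρ r = ≤-trans (≤-reflexive (sym (sumEvents-events (abs≡ r) x κ))) (≤-trans (m≤n+m (sumEvents (abs≡ r) (events x κ)) _) (≤-reflexive (run-sum ρ r)))

  rowEnd-other : ∀ e post i → proj₁ e ≢ i → rowEnd (e ∷ post) i ≡ remaining (e ∷ post) i
  rowEnd-other e post i ne = cong (λ z → if z then remaining (e ∷ post) (absI e) + x e + length (proj₂ e) else remaining (e ∷ post) i)
    (dec-false (proj₁ e ≟ i) ne)

  rowEnd-own : ∀ e post → rowEnd (e ∷ post) (proj₁ e) ≡ remaining (e ∷ post) (absI e) + x e + length (proj₂ e)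
  rowEnd-own e post = cong (λ z → if z then remaining (e ∷ post) (absI e) + x e + length (proj₂ e) else remaining (e ∷ post) (proj₁ e))
    (dec-true (proj₁ e ≟ proj₁ e) refl)

  -- By `fall-col`, length plus multiplicity plus number of moves is the column of the last cross of
  -- the next patch. This explains the special formula for c in the origin row.
  run-rowEnd-patch : ∀ {R i S S′ l j m ks t es κ} → Run R (code u) (suc i) S l (events x κ) → events x κ ≡ ((suc i , ks) , m) ∷ es →
    Fall l (suc (suc i)) 1 j m ks t → Appended S S′ j m → rowEnd κ (suc i) ≡ j + m
  run-rowEnd-patch {i = i} {l = l} {j = j} {m} {ks} {t} {κ = (_ , _) ∷ κ} ρ refl f A = trans (rowEnd-own (suc i , ks) κ)
    (trans (cong (λ z → z + m + length ks) (trans (run-remaining ρ (suc i + sum ks)) (cong l (fall-abs f))))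
      (trans (+-assoc (l t) m (length ks)) (trans (cong (l t +_) (+-comm m (length ks)))
        (trans (sym (+-assoc (l t) (length ks) m)) (cong (_+ m) (sym (fall-col f)))))))

  rowEnd-aligned : ∀ {R i S l} κ → Run R (code u) (suc i) S l (events x κ) → All (λ e → proj₁ e ≤ i) κ → rowEnd κ (suc i) ≡ l (suc i)
  rowEnd-aligned [] ρ _ = run-remaining ρ _
  rowEnd-aligned {i = i} (e ∷ κ) ρ (h ∷ _) = trans (rowEnd-other e κ (suc i) (<⇒≢ (s≤s h))) (run-remaining ρ (suc i))

  run-index-κ : ∀ {R i S l} κ → Run R (code u) i S l (events x κ) → All (λ e → proj₁ e ≤ i) κ
  run-index-κ κ ρ = AllP.map⁻ (run-index ρ)

  run-rowEnd : ∀ {R i S l es} κ → es ≡ events x κ → Run R (code u) (suc i) S l es →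
    ((∀ c → S c ≡ interval 0 (l (suc i)) c) × rowEnd κ (suc i) ≡ l (suc i)) ⊎
    (∃[ S′ ] ∃[ j ] ∃[ m ] 1 ≤ m × Appended S S′ j m × rowEnd κ (suc i) ≡ j + m)
  run-rowEnd {R} {i} {S} {l} κ eq (row h ρ) =
    inj₁ (h , rowEnd-aligned κ (subst (Run R (code u) (suc i) S l) eq (row h ρ)) (run-index-κ κ (subst (Run R (code u) i (R i) l) eq ρ)))
  run-rowEnd {R} {i} {S} {l} κ eq (patch 1≤m A f up ρ) =
    inj₂ (_ , _ , _ , 1≤m , A , run-rowEnd-patch {κ = κ} (subst (Run R (code u) (suc i) S l) eq (patch 1≤m A f up ρ)) (sym eq) f A)

  run-rowEnd-< : ∀ {R i S l j} κ → Run R (code u) (suc i) S l (events x κ) → 1 ≤ j → (∀ c → j ≤ c → S c ≡ false) → rowEnd κ (suc i) < j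
  run-rowEnd-< {i = i} {S} {l} κ ρ 1≤j b with run-rowEnd κ refl ρ
  ... | inj₂ (_ , j , m , 1≤m , A , e) = ≤-<-trans (≤-reflexive e) (within-bound S b (appended-last A 1≤m))
  ... | inj₁ (h , e) with l (suc i)
  ...   | zero = ≤-<-trans (≤-reflexive e) 1≤j
  ...   | suc k = ≤-<-trans (≤-reflexive e) (within-bound S b (trans (h (suc k)) (interval-true {0} {suc k} {suc k} z<s ≤-refl)))

  run-≤-rowEnd : ∀ {R i S l c} κ → Run R (code u) (suc i) S l (events x κ) → S c ≡ true → c ≤ rowEnd κ (suc i)
  run-≤-rowEnd {c = c} κ ρ e with run-rowEnd κ refl ρ
  ... | inj₁ (h , e′) = ≤-trans (proj₂ (interval-true⁻ {0} (trans (sym (h c)) e))) (≤-reflexive (sym e′))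
  ... | inj₂ (_ , j , m , _ , A , e′) with c ≤? j + m
  ...   | yes p = ≤-trans p (≤-reflexive (sym e′))
  ...   | no ¬p = ⊥-elim (true≢false e (Appended.beyond A (≰⇒> ¬p)))

  -- The compatibility conditions at an event, free of truncation and of the case distinction in cc.
  record Compatible (e : Index) (post : List Index) : Set where
    field
      size   : 1 ≤ x e
      origin : 1 ≤ proj₁ e
      moves  : 1 ≤ length (proj₂ e)
      steps  : All (1 ≤_) (proj₂ e)
      stops  : Stops (remaining (e ∷ post)) (suc (proj₁ e)) 1 (proj₂ e) (absI e)
      passes : Passes (remaining (e ∷ post)) (suc (proj₁ e)) 1 (x e) (proj₂ e) (absI e)
      -- The case p = 1, q = k of (3): once the patch is gone, the origin row must end before the
      -- elbow in front of it, whose column is the right-hand side.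
      apart  : rowEnd post (proj₁ e) < remaining (e ∷ post) (absI e) + length (proj₂ e)

  run-compatible : ∀ {R i S l} pre e post {es} → es ≡ events x (pre ++ e ∷ post) → Run R (code u) i S l es → Compatible e post
  run-compatible [] e post () (done _)
  run-compatible (_ ∷ _) e post () (done _)
  run-compatible pre e post eq (row h ρ) = run-compatible pre e post eq ρ
  run-compatible (_ ∷ pre) e post refl (patch _ A f up ρ) = run-compatible pre e post refl ρ
  run-compatible {R} {suc i} {S} {l} [] e post refl (patch {t = t} 1≤m A f up ρ) with fall-abs f
  ... | refl = record
    { size = 1≤m
    ; origin = s≤s z≤n
    ; moves = moves
    ; steps = fall-steps ≤-refl f
    ; stops = λ pre k post′ e′ ne r er → subst₂ _≤_ (sym (l≡ r)) (cong (λ z → z + length post′) (sym (l≡ t))) (fall⇒stops f pre k post′ e′ ne r er)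
    ; passes = λ pre k post′ e′ s 1≤s d≤s s<k r er → subst₂ _≤_ (cong (λ z → z + x e + suc (length post′)) (sym (l≡ t))) (sym (l≡ r)) (fall⇒passes f pre k post′ e′ s 1≤s d≤s s<k r er)
    ; apart = <-≤-trans (run-rowEnd-< post ρ (fall-pos f) (Appended.bound A))
        (≤-reflexive (trans (fall-col f) (cong (λ z → z + length (proj₂ e)) (sym (l≡ t))))) }
    where
      l≡ : ∀ r → remaining (e ∷ post) r ≡ l r
      l≡ = run-remaining {κ = e ∷ post} (patch {D = R} 1≤m A f up ρ)
      moves : 1 ≤ length (proj₂ e)
      moves with fall-head f
      ... | _ , _ , refl , _ = s≤s z≤n

  data AllCompatible : List Index → Set where
    []  : AllCompatible []
    _∷_ : ∀ {e post} → Compatible e post → AllCompatible post → AllCompatible (e ∷ post)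

  -- Undoing the events from the last one on rebuilds the rows from the top.
  Realized : ℕ → List Index → Set
  Realized i κ = ∃[ R ] ∃[ S ] Run R (code u) i S (remaining κ) (events x κ)

  compatible⇒run-row : ∀ i κ → Realized i κ → Realized (suc i) κ
  compatible⇒run-row i κ (R , S , ρ) = R′ , interval 0 (remaining κ (suc i)) , row (λ _ → refl) (run-rows other current ρ)
    where
      R′ : ℕ → Row
      R′ r = if r ≡ᵇ i then S else R r
      other : ∀ r c → 1 ≤ r → r < i → R r c ≡ R′ r c
      other r c _ lt = cong (λ z → (if z then S else R r) c) (sym (dec-false (r ≟ i) (<⇒≢ lt)))
      current : ∀ c → 1 ≤ i → S c ≡ R′ i c
      current c _ = cong (λ z → (if z then S else R i) c) (sym (dec-true (i ≟ i) refl))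
  -- If the first event starts in row i+1, the later ones are rebuilt first and its patch is put
  -- back behind column j; `apart` ensures that the row built so far ends before j. If it starts
  -- higher up, sortedness places all events there, and row i+1 is aligned.
  compatible⇒run : ∀ i κ → Sorted κ → Fits κ → AllCompatible κ → All (λ e → proj₁ e ≤ i) κ → Realized i κ
  compatible⇒run zero [] s F C h = (λ _ _ → false) , (λ _ → false) , done (λ _ → refl)
  compatible⇒run zero (e ∷ κ) s F (C ∷ _) (h ∷ _) = contradiction (≤-trans (Compatible.origin C) h) λ ()
  compatible⇒run (suc i) = go
    where
    go : ∀ κ → Sorted κ → Fits κ → AllCompatible κ → All (λ e → proj₁ e ≤ suc i) κ → Realized (suc i) κ
    go [] s F C h = compatible⇒run-row i [] (compatible⇒run i [] s F C [])
    go (e@(r , ks) ∷ κ) s@(b ∷ bs) F (C ∷ Cs) (h ∷ hs) with m≤n⇒m<n∨m≡n h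
    ... | inj₁ lt = compatible⇒run-row i (e ∷ κ) (compatible⇒run i (e ∷ κ) s F (C ∷ Cs) (s≤s⁻¹ lt ∷ All.map (λ b′ → ≤-trans (before-row b′) (s≤s⁻¹ lt)) b))
    go (e@(.(suc i) , []) ∷ κ) s@(b ∷ bs) F (C ∷ Cs) (h ∷ hs) | inj₂ refl = contradiction (Compatible.moves C) λ ()
    go (e@(.(suc i) , k ∷ ks) ∷ κ) s@(b ∷ bs) F (C ∷ Cs) (h ∷ hs) | inj₂ refl
      with go κ bs (fits-suffix (e ∷ []) F) Cs hs | Compatible.steps C
    ... | R , S′ , ρ | 1≤k ∷ pos = R , S , patch (Compatible.size C) A f (remaining-updated e κ F) ρ
      where
        j = remaining (e ∷ κ) (absI e) + suc (length ks)
        S : Row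
        S c = S′ c ∨ interval j (j + x e) c
        A : Appended S S′ j (x e)
        A = record { union = λ _ → refl ; bound = bound }
          where bound : ∀ c → j ≤ c → S′ c ≡ false
                bound c j≤c with S′ c in eq
                ... | false = refl
                ... | true = contradiction (≤-trans j≤c (run-≤-rowEnd κ ρ eq)) (<⇒≱ (Compatible.apart C))
        f : Fall (remaining (e ∷ κ)) (suc (suc i)) 1 j (x e) (k ∷ ks) (absI e)
        f = stops-passes⇒fall k ks (k ∸ 1) 1 (suc (suc i)) pos (m+[n∸m]≡n 1≤k) ≤-refl (+-comm (absI e) 1)
              (Compatible.stops C) (Compatible.passes C)

open import Data.Integer as ℤ using (ℤ; +_)
import Data.Integer.Properties as ℤP

-- Compatible sequences

+-∸ : ∀ {a b} → b ≤ a → + a ℤ.- + b ≡ + (a ∸ b)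
+-∸ {a} {b} h = trans (ℤP.m-n≡m⊖n a b) (ℤP.⊖-≥ h)

module _ {n : ℕ} (u : Permutation′ n) (x : Φ) {κ pre : List Index} {i : ℕ} {ks : List ℕ} {post : List Index}
         (perm : κ ↭ pre ++ (i , ks) ∷ post) (sorted : Sorted (pre ++ (i , ks) ∷ post))
         (fits : Fits u x (pre ++ (i , ks) ∷ post)) where

  private
    e : Index
    e = (i , ks)

    after : ∀ q → L.filterᵇ (λ f → prec e f ∧ q f) κ ↭ L.filterᵇ q post
    after q = ↭-trans (filter-↭ _ perm) (↭-reflexive (filter-after q pre e post sorted))

    cOther-remaining : ∀ j → cOther u κ x e j ≡ + remaining u x post j
    cOther-remaining j = trans (cong (λ z → + code u j ℤ.- + z) (sum-↭ (map⁺ x (after (abs≡ j)))))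
      (+-∸ (fits-suffix u x (e ∷ []) (fits-suffix u x pre fits) j))

    cc-other : ∀ j → j ≢ i → cc u κ x e j ≡ + remaining u x post j
    cc-other j ne rewrite dec-false (j ≟ i) ne = cOther-remaining j

    inRow : Index → Bool
    inRow f = proj₁ f ≡ᵇ i

    cc-nothing : L.filterᵇ inRow post ≡ [] → cc u κ x e i ≡ + remaining u x post i
    cc-nothing h with ↭-empty-inv (↭-trans (after inRow) (↭-reflexive h))
    ... | eq rewrite dec-true (i ≟ i) refl | eq = cOther-remaining i

    later : All (Before e) post × Sorted post
    later = proj₂ (sorted-split pre sorted)

    row-bound : ∀ {f fs} → Sorted (f ∷ fs) → All (λ g → proj₁ g ≤ proj₁ f) (f ∷ fs)
    row-bound (a ∷ _) = ≤-refl ∷ All.map before-row a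

    -- By sortedness, the minimal later event with origin i, if there is one, is the head of `post`:
    -- when the head starts in a smaller row, so do all events after it. The search through κ thus
    -- reduces to the case distinction of `rowEnd`.
    cc-own : cc u κ x e i ≡ + rowEnd u x post i
    cc-own = cases post refl (proj₁ later) (proj₂ later)
      where
      cases : ∀ ps → post ≡ ps → All (Before e) ps → Sorted ps → cc u κ x e i ≡ + rowEnd u x ps i
      cases [] eq _ _ = trans (cc-nothing (cong (L.filterᵇ inRow) eq)) (cong (λ z → + remaining u x z i) eq)
      cases (f ∷ fs) eq (b ∷ _) s with proj₁ f ≟ i
      ... | no ne = trans (cc-nothing (trans (cong (L.filterᵇ inRow) eq) (filterᵇ-none inRow (f ∷ fs)
              (All.map (λ {g} le → dec-false (proj₁ g ≟ i) (<⇒≢ (≤-<-trans le (≤∧≢⇒< (before-row b) ne)))) (row-bound s)))))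
              (cong (λ z → + z) (trans (cong (λ z → remaining u x z i) eq) (sym (rowEnd-other u x f fs i ne))))
      ... | yes q = trans own (cong (λ z → + z) (trans (sym (rowEnd-own u x f fs)) (cong (rowEnd u x (f ∷ fs)) q)))
        where
          minimal : minPrec (L.filterᵇ (λ g → prec e g ∧ inRow g) κ) ≡ just f
          minimal = minPrec-least _ f
            (∈-resp-↭ (↭-sym (after inRow)) (∈-filter⁺ _ (subst (f ∈_) (sym eq) (here refl)) (subst T (sym (dec-true (proj₁ f ≟ i) q)) _)))
            (All.tabulate (λ {g} m → least s (subst (g ∈_) eq (proj₁ (∈-filter⁻ _ {xs = post} (∈-resp-↭ (after inRow) m))))))
            where
              least : ∀ {g} → Sorted (f ∷ fs) → g ∈ f ∷ fs → g ≡ f ⊎ Before f g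
              least _ (here refl) = inj₁ refl
              least (a ∷ _) (there m) = inj₂ (All.lookup a m)
          own : cc u κ x e i ≡ + (remaining u x (f ∷ fs) (absI f) + x f + length (proj₂ f))
          own rewrite dec-true (i ≟ i) refl | minimal =
            cong (λ z → z ℤ.+ + x f ℤ.+ + length (proj₂ f)) (trans (cOther-remaining (absI f)) (cong (λ z → + remaining u x z (absI f)) eq))

    t a : ℕ
    t = absI e
    a = remaining u x (e ∷ post) t

    updated : Updated (remaining u x (e ∷ post)) (remaining u x post) t (x e)
    updated = remaining-updated u x e post (fits-suffix u x pre fits)

    split-sum : ∀ pre′ k post′ → ks ≡ pre′ ++ k ∷ post′ → t ≡ i + (sum pre′ + (k + sum post′))
    split-sum pre′ k post′ eq = cong (λ z → i + z) (trans (cong sum eq) (sum-++ pre′ (k ∷ post′)))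

    cc-end : All (1 ≤_) ks → 1 ≤ length ks → cc u κ x e t ≡ + (a + x e)
    cc-end pos ne = trans (cc-other t (>⇒≢ (i<t pos ne))) (cong (λ z → + z) (proj₁ updated))
      where i<t : ∀ {ks} → All (1 ≤_) ks → 1 ≤ length ks → i < i + sum ks
            i<t (p ∷ _) _ = ≤-trans (≤-reflexive (+-comm 1 i)) (+-monoʳ-≤ i (≤-trans p (m≤m+n _ _)))

    cc-between : ∀ r → r ≢ i → r < t → cc u κ x e r ≡ + remaining u x (e ∷ post) r
    cc-between r ne lt = trans (cc-other r ne) (cong (λ z → + z) (proj₂ updated r (<⇒≢ lt)))

    cancel : ∀ b → + (a + x e) ℤ.- + x e ℤ.+ + b ≡ + (a + b)
    cancel b = cong (λ z → z ℤ.+ + b) (trans (+-∸ (m≤n+m (x e) a)) (cong (λ z → + z) (m+n∸n≡m a (x e))))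

    sum-pos : ∀ k′ pre′ {k post′} → ks ≡ (k′ ∷ pre′) ++ k ∷ post′ → All (1 ≤_) ks → 1 ≤ sum (k′ ∷ pre′)
    sum-pos k′ pre′ refl (p ∷ _) = ≤-trans p (m≤m+n k′ _)

    step-pos : ∀ pre′ k post′ → ks ≡ pre′ ++ k ∷ post′ → All (1 ≤_) ks → 1 ≤ k
    step-pos pre′ k post′ refl pos = All.lookup pos (∈-++⁺ʳ pre′ (here refl))

    >-start : ∀ b → 1 ≤ b → i + b ≢ i
    >-start b 1≤b = >⇒≢ (≤-trans (≤-reflexive (+-comm 1 i)) (+-monoʳ-≤ i 1≤b))

    row-< : ∀ pre′ k post′ s → ks ≡ pre′ ++ k ∷ post′ → s < k → i + sum pre′ + s < t
    row-< pre′ k post′ s eq s<k = ≤-trans (≤-reflexive (cong suc (+-assoc i (sum pre′) s)))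
      (≤-trans (+-monoʳ-< i (+-monoʳ-< (sum pre′) (<-≤-trans s<k (m≤m+n k _)))) (≤-reflexive (sym (split-sum pre′ k post′ eq))))

    stop-< : ∀ pre′ k post′ → ks ≡ pre′ ++ k ∷ post′ → All (1 ≤_) ks → i + sum pre′ < t
    stop-< pre′ k post′ eq pos = subst (_< t) (+-identityʳ _) (row-< pre′ k post′ 0 eq (step-pos pre′ k post′ eq pos))

  Condition3 : Set
  Condition3 = ∀ pre k post → ks ≡ pre ++ k ∷ post → ∀ q → 1 ≤ q → q ≤ k →
              (q ≡ k → cc u κ x (i , ks) (i + sum pre)
                         ℤ.≤ cc u κ x (i , ks) (absI (i , ks)) ℤ.- + x (i , ks) ℤ.+ + length post)
            × (q ≢ k → cc u κ x (i , ks) (i + sum pre + q)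
                         ℤ.≥ cc u κ x (i , ks) (absI (i , ks)) ℤ.+ + length post ℤ.+ ℤ.1ℤ)

  compatible⇒condition3 : Compatible u x (i , ks) post → Condition3
  compatible⇒condition3 C pre′ k post′ eq q 1≤q q≤k = stopping pre′ eq , passing
    where
      open Compatible C
      stopping : ∀ pre′ → ks ≡ pre′ ++ k ∷ post′ → q ≡ k → cc u κ x e (i + sum pre′) ℤ.≤ cc u κ x e t ℤ.- + x e ℤ.+ + length post′
      -- For p = 1 the row in question is the origin, where c is a row end and not a length, so
      -- `apart` takes the place of `stops`.
      stopping [] eq _ rewrite cc-end steps moves | cancel (length post′) | +-identityʳ i | cc-own =
        ℤ.+≤+ (s≤s⁻¹ (≤-trans apart (≤-reflexive (trans (cong (λ z → a + length z) eq) (+-suc a (length post′))))))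
      stopping (k′ ∷ pre′) eq _
        rewrite cc-end steps moves | cancel (length post′)
              | cc-between (i + sum (k′ ∷ pre′)) (>-start _ (sum-pos k′ pre′ eq steps)) (stop-< (k′ ∷ pre′) k post′ eq steps) =
        ℤ.+≤+ (stops (k′ ∷ pre′) k post′ eq (λ ()) (i + sum (k′ ∷ pre′)) (+-comm _ 1))
      passing : q ≢ k → cc u κ x e (i + sum pre′ + q) ℤ.≥ cc u κ x e t ℤ.+ + length post′ ℤ.+ ℤ.1ℤ
      passing ne
        rewrite cc-end steps moves
              | cc-between (i + sum pre′ + q) (subst (_≢ i) (sym (+-assoc i (sum pre′) q)) (>-start _ (≤-trans 1≤q (m≤n+m q _))))
                           (row-< pre′ k post′ q eq (≤∧≢⇒< q≤k ne)) =
        ℤ.+≤+ (≤-trans (≤-reflexive (trans (+-comm _ 1) (sym (+-suc (a + x e) (length post′)))))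
          (passes pre′ k post′ eq q 1≤q (λ _ → 1≤q) (≤∧≢⇒< q≤k ne) (i + sum pre′ + q) (+-comm _ 1)))

  condition3⇒compatible : 1 ≤ x (i , ks) → 1 ≤ i → 1 ≤ length ks → All (1 ≤_) ks → Condition3 → Compatible u x (i , ks) post
  condition3⇒compatible 1≤x 1≤i ne pos H = record
    { size = 1≤x ; origin = 1≤i ; moves = ne ; steps = pos ; stops = stops ; passes = passes ; apart = apart ks refl ne }
    where
      at-row : ∀ {r b} → r + 1 ≡ suc (i + b) → r ≡ i + b
      at-row {r} h = suc-injective (trans (+-comm 1 r) h)
      stops : Stops (remaining u x (e ∷ post)) (suc i) 1 ks t
      stops [] k post′ eq nil r er = contradiction refl nil
      stops (k′ ∷ pre′) k post′ eq nil r er with at-row {r} er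
      ... | refl with proj₁ (H (k′ ∷ pre′) k post′ eq k (step-pos (k′ ∷ pre′) k post′ eq pos) ≤-refl) refl
      ...   | h rewrite cc-end pos ne | cancel (length post′)
              | cc-between (i + sum (k′ ∷ pre′)) (>-start _ (sum-pos k′ pre′ eq pos)) (stop-< (k′ ∷ pre′) k post′ eq pos) = ℤP.drop‿+≤+ h
      passes : Passes (remaining u x (e ∷ post)) (suc i) 1 (x e) ks t
      passes pre′ k post′ eq s 1≤s _ s<k r er with at-row {r} (trans er (cong suc (+-assoc i (sum pre′) s)))
      ... | r≡ with trans r≡ (sym (+-assoc i (sum pre′) s))
      ...   | refl with proj₂ (H pre′ k post′ eq s 1≤s (<⇒≤ s<k)) (<⇒≢ s<k)
      ...     | h rewrite cc-end pos ne
              | cc-between (i + sum pre′ + s) (subst (_≢ i) (sym (+-assoc i (sum pre′) s)) (>-start _ (≤-trans 1≤s (m≤n+m s _))))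
                           (row-< pre′ k post′ s eq s<k) =
              ≤-trans (≤-reflexive (trans (+-suc (a + x e) (length post′)) (+-comm 1 _))) (ℤP.drop‿+≤+ h)
      apart : ∀ ks′ → ks ≡ ks′ → 1 ≤ length ks′ → rowEnd u x post i < a + length ks
      apart (k ∷ ks′) eq _ with proj₁ (H [] k ks′ eq k (step-pos [] k ks′ eq pos) ≤-refl) refl
      ... | h rewrite cc-end pos ne | cancel (length ks′) | +-identityʳ i | cc-own =
        ≤-trans (s≤s (ℤP.drop‿+≤+ h)) (≤-reflexive (sym (trans (cong (λ z → a + length z) eq) (+-suc a (length ks′)))))

-- The encoding as a bijection and its inverse

sumEvents-∉ : ∀ e es → e ∈ map proj₁ es ⊎ sumEvents (λ e′ → indexEq e′ e) es ≡ 0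
sumEvents-∉ e [] = inj₂ refl
sumEvents-∉ e ((e′ , m) ∷ es) with indexEq e′ e in eq | sumEvents-∉ e es
... | true | _ = inj₁ (here (sym (indexEq-sound e′ e eq)))
... | false | inj₁ i = inj₁ (there i)
... | false | inj₂ z = inj₂ z

sumEvents-fresh : ∀ e es → All (λ e′ → Before e e′) (map proj₁ es) → sumEvents (λ e′ → indexEq e′ e) es ≡ 0
sumEvents-fresh e [] [] = refl
sumEvents-fresh e ((e′ , m) ∷ es) (h ∷ hs) rewrite indexEq-≢ {e′} {e} (λ { refl → before-irrefl h }) = sumEvents-fresh e es hs

sumEvents-∈ : ∀ {e m es} → Sorted (map proj₁ es) → (e , m) ∈ es → sumEvents (λ e′ → indexEq e′ e) es ≡ m
sumEvents-∈ {e} {m} {(.e , .m) ∷ es} (h ∷ _) (here refl) rewrite indexEq-refl e | sumEvents-fresh e es h = +-identityʳ m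
sumEvents-∈ {e} {m} {(e′ , m′) ∷ es} (h ∷ hs) (there i)
  rewrite indexEq-≢ {e′} {e} (λ { refl → before-irrefl (All.lookup h (∈-map⁺ proj₁ i)) }) = sumEvents-∈ hs i

InL-moves : ∀ {M i} → ¬ InL M (i , [])
InL-moves (_ , () , _)

module _ {n : ℕ} (u : Permutation′ n) where

  record Encoded (D : Grid n) : Set where
    field
      x       : Φ
      κ       : List Index
      l       : ℕ → ℕ
      encodes : encode D ≡ just x
      run     : Run (cell D) (code u) n (cell D n) l (events x κ)
      sorted  : Sorted κ
      inL     : All (InL (μ u)) κ
      value   : ∀ e → InL (μ u) e → x e ≡ sumEvents (λ e′ → indexEq e′ e) (events x κ)
      support : ∀ e → x e ≢ 0 → e ∈ κ

    positive : ∀ {e} → e ∈ κ → 1 ≤ x e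
    positive i = All.lookup (AllP.map⁻ (run-pos run)) i

  encoded : ∀ D → IsPipeDream u D → Encoded D
  encoded D P with pipeDream⇒run u D P
  ... | es , l , ρ with run-encode D (code-bounded u) ρ
  ...   | x , eq , x-nil , x-cons = record
    { x = x ; κ = map proj₁ es ; l = l ; encodes = eq ; run = subst (Run _ _ _ _ _) (sym events≡) ρ
    ; sorted = run-sorted ρ ; inL = AllP.map⁺ inL ; value = value ; support = support }
    where
      inL : All (λ e → InL (μ u) (proj₁ e)) es
      inL = run-InL ρ (code-≤-μ u)
      value′ : ∀ e → InL (μ u) e → x e ≡ sumEvents (λ e′ → indexEq e′ e) es
      value′ (a , []) h = contradiction h InL-moves
      value′ (a , k ∷ ks) h = x-cons a k ks
      events≡ : events x (map proj₁ es) ≡ es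
      events≡ = trans (sym (map-∘ es)) (trans (map-cong-local (All.tabulate (λ {e} i →
        cong (proj₁ e ,_) (trans (value′ (proj₁ e) (All.lookup inL i)) (sumEvents-∈ (run-sorted ρ) i))))) (map-id es))
      value : ∀ e → InL (μ u) e → x e ≡ sumEvents (λ e′ → indexEq e′ e) (events x (map proj₁ es))
      value e h = trans (value′ e h) (cong (sumEvents (λ e′ → indexEq e′ e)) (sym events≡))
      support : ∀ e → x e ≢ 0 → e ∈ map proj₁ es
      support (a , []) ne = contradiction (x-nil a) ne
      support (a , k ∷ ks) ne with sumEvents-∉ (a , k ∷ ks) es
      ... | inj₁ i = i
      ... | inj₂ z = contradiction (trans (x-cons a k ks) z) ne

  encoded-InΦu : ∀ {D} (E : Encoded D) → InΦu u (Encoded.x E)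
  encoded-InΦu E = κ , AllPairs.map (λ { b refl → before-irrefl b }) sorted , inL , record
    { cond1 = λ e _ → (λ i z → <⇒≢ (positive i) (sym z)) , support e
    ; cond2 = λ j _ _ → run-fits u x run j
    ; cond3 = cond3 }
    where
      open Encoded E
      cond3 : ∀ i ks → (i , ks) ∈ κ → _
      cond3 i ks m with ∈-∃++ m
      ... | pre , post , eq = compatible⇒condition3 u x {κ} {pre} (↭-reflexive eq) (subst Sorted eq sorted)
              (subst (Fits u x) eq (run-fits u x run)) (run-compatible u x pre (i , ks) post (cong (events x) eq) run)

  encoded-weight : ∀ {D} (E : Encoded D) j → 1 ≤ j → wtu u (Encoded.x E) j ≡ + wt D j
  encoded-weight {D} E j 1≤j = trans (cong₂ (λ a b → (+ code u j ℤ.- + a) ℤ.+ + b) (total (abs≡ j)) (total (λ e → proj₁ e ≡ᵇ j)))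
    (trans (cong (λ z → z ℤ.+ + B) (trans (+-∸ A≤) (cong (λ z → + z) (trans (cong (_∸ A) (sym (run-sum run j))) (m+n∸n≡m (l j) A)))))
      (cong (λ z → + z) weight))
    where
      open Encoded E
      A B : ℕ
      A = sumEvents (abs≡ j) (events x κ)
      B = sumEvents (λ e → proj₁ e ≡ᵇ j) (events x κ)
      A≤ : A ≤ code u j
      A≤ = ≤-trans (m≤n+m A (l j)) (≤-reflexive (run-sum run j))
      total : ∀ p → sumWhere p x (Lenum (μ u)) ≡ sumEvents p (events x κ)
      total p = trans (sumWhere-cong p x _ (Lenum (μ u)) (All.map (λ {e} → value e) (Lenum-InL (μ u))))
        (sumWhere-events p (Lenum-unique (μ u)) (events x κ) (AllP.map⁺ (All.map Lenum-∈ inL)))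
      weight : l j + B ≡ wt D j
      weight with <-cmp j n
      ... | tri< lt _ _ = sym (proj₁ (run-weight run (code-bounded u) j 1≤j) lt)
      ... | tri≈ _ refl _ = sym (proj₂ (run-weight run (code-bounded u) j 1≤j) refl)
      ... | tri> _ _ gt = trans (cong₂ _+_ l-zero (sumEvents-none _ (events x κ) (All.map (λ {e} h → dec-false (proj₁ (proj₁ e) ≟ j) (<⇒≢ (≤-<-trans h gt))) (run-index run))))
                            (sym (count-none (cell D j) (range n) (All.tabulate (λ {c} _ → outside c))))
        where
          l-zero : l j ≡ 0
          l-zero = n≤0⇒n≡0 (≤-trans (run-≤ run j) (≤-reflexive (code-beyond u j gt)))
          outside : ∀ c → cell D j c ≡ false
          outside c with cell D j c in eq
          ... | false = refl
          ... | true = contradiction (proj₂ (proj₂ (cell-pos D j c eq))) (<⇒≱ gt)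

  encoded-outside : ∀ {D} (E : Encoded D) e → ¬ InL (μ u) e → Encoded.x E e ≡ 0
  encoded-outside E e h with Encoded.x E e ≟ 0
  ... | yes z = z
  ... | no ne = contradiction (All.lookup (Encoded.inL E) (Encoded.support E e ne)) h

  -- Equal values on the index set give equal supports. Their sorted lists then coincide, so both
  -- runs have the same events, and both end with the code of u.
  encoded-injective : ∀ {D D′} {x x′ : Φ} → Encoded D → Encoded D′ →
    encode D ≡ just x → encode D′ ≡ just x′ → x ≈[ μ u ] x′ → D ≡ D′
  encoded-injective {D} {D′} E E′ eq eq′ agree with just-injective (trans (sym eq) (Encoded.encodes E)) | just-injective (trans (sym eq′) (Encoded.encodes E′))
  ... | refl | refl = cell-ext D D′ cells
    where
      module E = Encoded E
      module E′ = Encoded E′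
      κ≡ : E.κ ≡ E′.κ
      κ≡ = sorted-≡ E.sorted E′.sorted
        (λ e i → E′.support e (>⇒≢ (≤-trans (E.positive i) (≤-reflexive (agree e (All.lookup E.inL i))))))
        (λ e i → E.support e (>⇒≢ (≤-trans (E′.positive i) (≤-reflexive (sym (agree e (All.lookup E′.inL i)))))))
      events≡ : events E.x E.κ ≡ events E′.x E′.κ
      events≡ = trans (map-cong-local (All.map (λ {e} h → cong (e ,_) (agree e h)) E.inL)) (cong (events E′.x) κ≡)
      rows : (∀ r → E.l r ≡ E′.l r) × (1 ≤ n → ∀ c → cell D n c ≡ cell D′ n c) × (∀ r c → 1 ≤ r → r < n → cell D r c ≡ cell D′ r c)
      rows = run-injective E.run (subst (Run _ _ _ _ _) (sym events≡) E′.run)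
      cells : ∀ r c → 1 ≤ r → r ≤ n → cell D r c ≡ cell D′ r c
      cells r c 1≤r r≤n with m≤n⇒m<n∨m≡n r≤n
      ... | inj₁ lt = proj₂ (proj₂ rows) r c 1≤r lt
      ... | inj₂ refl = proj₁ (proj₂ rows) 1≤r c

  -- Cutting the array down to an n by n grid loses nothing: every cross of the run satisfies r + c
  -- ≤ n, and column zero is empty.
  realize : ∀ {R S l es} → Run R (code u) n S l es → ∃[ D ] Run (cell {n} D) (code u) n (cell D n) l es
  realize {R} {S} ρ = D , run-rows (λ r c p lt → trans (other r c lt) (sym (agrees r c p (<⇒≤ lt)))) (λ c p → trans (last c) (sym (agrees n c p ≤-refl))) ρ
    where
      R′ : ℕ → Row
      R′ r = if r ≡ᵇ n then S else R r
      D : Grid n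
      D = gridOf R′
      other : ∀ r c → r < n → R r c ≡ R′ r c
      other r c lt = cong (λ z → (if z then S else R r) c) (sym (dec-false (r ≟ n) (<⇒≢ lt)))
      last : ∀ c → S c ≡ R′ n c
      last c = cong (λ z → (if z then S else R n) c) (sym (dec-true (n ≟ n) refl))
      column0 : ∀ r → 1 ≤ r → r ≤ n → R′ r 0 ≡ false
      column0 r p q with m≤n⇒m<n∨m≡n q
      ... | inj₁ lt = trans (sym (other r 0 lt)) (proj₂ (run-column-0 ρ) r p lt)
      ... | inj₂ refl = trans (sym (last 0)) (proj₁ (run-column-0 ρ) p)
      inΔ : ∀ r c → 1 ≤ r → r ≤ n → R′ r c ≡ true → r + c ≤ n
      inΔ r c p q e with m≤n⇒m<n∨m≡n q
      ... | inj₁ lt = proj₂ (run-inΔ ρ (code-bounded u)) r c p lt (trans (other r c lt) e)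
      ... | inj₂ refl = proj₁ (run-inΔ ρ (code-bounded u)) c p (trans (last c) e)
      agrees : ∀ r c → 1 ≤ r → r ≤ n → cell D r c ≡ R′ r c
      agrees (suc r) zero p q = sym (column0 (suc r) p q)
      agrees (suc r) (suc c) p q with c <? n
      ... | yes c<n = cell-gridOf R′ r c q c<n
      ... | no c≮n with R′ (suc r) (suc c) in eq
      ...   | true = contradiction (≤-trans (m≤n+m (suc c) (suc r)) (inΔ (suc r) (suc c) p q eq)) c≮n
      ...   | false = at-beyond (at (V.replicate n false) D r) c (≮⇒≥ c≮n)

  -- The support, sorted by the ladder order, becomes the event list of a run. Encoding the grid of
  -- that run reads the multiplicities back from the same events.
  decode : ∀ x → InΦu u x → Σ (Grid n) λ D → IsPipeDream u D × Σ Φ λ y → encode D ≡ just y × y ≈[ μ u ] x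
  decode x (κ , unique , inL , C) with compatible⇒run u x n (sort κ) sorted fits (compatible [] (sort κ) refl) (rows [] (sort κ) refl)
    where
      open InΦκ C
      perm : sort κ ↭ κ
      perm = sort-↭ κ
      sorted : Sorted (sort κ)
      sorted = sort-sorted unique
      -- Condition (2) speaks of j in [μ] only; no index of 𝓛_μ has another absolute value, so the
      -- other sums are empty.
      fits : Fits u x (sort κ)
      fits j = ≤-trans (≤-reflexive (sumWhere-↭ (abs≡ j) x perm)) (bound j)
        where
          bound : ∀ j → sumWhere (abs≡ j) x κ ≤ code u j
          bound j with 1 ≤? j | j ≤? μ u
          ... | yes p | yes q = cond2 j p q
          ... | no p | _ = ≤-trans (≤-reflexive (cong (λ z → sum (map x z)) (filterᵇ-none (abs≡ j) κ
                (All.map (λ {e} h → dec-false (absI e ≟ j) (λ { refl → p (≤-trans (proj₁ h) (m≤m+n (proj₁ e) _)) })) inL)))) z≤n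
          ... | yes _ | no q = ≤-trans (≤-reflexive (cong (λ z → sum (map x z)) (filterᵇ-none (abs≡ j) κ
                (All.map (λ {e} h → dec-false (absI e ≟ j) (λ { refl → q (proj₂ (proj₂ (proj₂ h))) })) inL)))) z≤n
      member : ∀ pre e post → sort κ ≡ pre ++ e ∷ post → e ∈ κ
      member pre e post eq = ∈-resp-↭ perm (subst (e ∈_) (sym eq) (∈-++⁺ʳ pre (here refl)))
      at-event : ∀ pre e post → sort κ ≡ pre ++ e ∷ post → Compatible u x e post
      at-event pre (i , ks) post eq with member pre (i , ks) post eq
      ... | m with All.lookup inL m
      ...   | 1≤i , 1≤ks , pos , abs = condition3⇒compatible u x {κ} {pre} (↭-trans (↭-sym perm) (↭-reflexive eq)) (subst Sorted eq sorted)
                (subst (Fits u x) eq fits) (n≢0⇒n>0 (proj₁ (cond1 (i , ks) (All.lookup inL m)) m)) 1≤i 1≤ks pos (cond3 i ks m)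
      compatible : ∀ pre post → sort κ ≡ pre ++ post → AllCompatible u x post
      compatible pre [] eq = []
      compatible pre (e ∷ post) eq = at-event pre e post eq ∷ compatible (pre ++ e ∷ []) post (trans eq (sym (++-assoc pre (e ∷ []) post)))
      -- The multiplicity of an event is positive and at most the code at |𝐢|, so |𝐢| and with it
      -- the origin are at most n.
      rows : ∀ pre post → sort κ ≡ pre ++ post → All (λ e → proj₁ e ≤ n) post
      rows pre [] eq = []
      rows pre (e ∷ post) eq = row≤ ∷ rows (pre ++ e ∷ []) post (trans eq (sym (++-assoc pre (e ∷ []) post)))
        where
          pos : 0 < code u (absI e)
          pos = ≤-trans (Compatible.size (at-event pre e post eq)) (≤-trans (m≤n+m (x e) _)
            (≤-trans (≤-reflexive (sym (proj₁ (remaining-updated u x e post (fits-suffix u x pre (subst (Fits u x) eq fits))))))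
              (m∸n≤m (code u (absI e)) (sumWhere (abs≡ (absI e)) x post))))
          row≤ : proj₁ e ≤ n
          row≤ = ≤-trans (m≤m+n (proj₁ e) _) (≤-trans (m≤m+n (absI e) _) (code-bounded u (absI e) pos))
  ... | R , S , ρ with realize ρ
  ...   | D , ρ′ with run-encode D (code-bounded u) ρ′
  ...     | y , eq , _ , y-cons = D , run⇒pipeDream u D ρ′ , y , eq , agree
    where
      open InΦκ C
      keys : map proj₁ (events x (sort κ)) ≡ sort κ
      keys = trans (sym (map-∘ (sort κ))) (map-id (sort κ))
      agree : y ≈[ μ u ] x
      agree (a , []) h = contradiction h InL-moves
      agree e@(a , k ∷ ks) h with sumEvents-∉ e (events x (sort κ))
      ... | inj₁ i = trans (y-cons a k ks) (sumEvents-∈ {m = x e} (subst Sorted (sym keys) (sort-sorted unique)) (∈-map⁺ (λ e → (e , x e)) (subst (e ∈_) keys i)))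
      ... | inj₂ z with x e ≟ 0
      ...   | yes x0 = trans (y-cons a k ks) (trans z (sym x0))
      ...   | no ne = trans (y-cons a k ks) (sumEvents-∈ {m = x e} (subst Sorted (sym keys) (sort-sorted unique))
                  (∈-map⁺ (λ e → (e , x e)) (∈-resp-↭ (↭-sym (sort-↭ κ)) (proj₂ (cond1 e h) ne))))

-- Bijectivity is split into totality, injectivity and surjectivity because `encode` is a partial
-- function and elements of Φ_μ are functions compared on 𝓛_μ only. Totality includes that no move
-- of the algorithm is ever undefined.
theorem4p3 : ∀ n (u : Permutation′ n) →
    (∀ (D : Grid n) → IsPipeDream u D →
    Σ Φ λ x → encode D ≡ just x
    × (∀ e → ¬ InL (μ u) e → x e ≡ 0)
    × InΦu u x
    × (∀ j → 1 ≤ j → wtu u x j ≡ + wt D j))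
    × (∀ (D D′ : Grid n) (x x′ : Φ) → IsPipeDream u D → IsPipeDream u D′ →
    encode D ≡ just x → encode D′ ≡ just x′ → x ≈[ μ u ] x′ → D ≡ D′)
    × (∀ (x : Φ) → InΦu u x →
    Σ (Grid n) λ D → IsPipeDream u D × Σ Φ λ y → encode D ≡ just y × y ≈[ μ u ] x)
theorem4p3 n u = maps , injective , decode u
  where
    maps : ∀ D → IsPipeDream u D → Σ Φ λ x → encode D ≡ just x × (∀ e → ¬ InL (μ u) e → x e ≡ 0)
      × InΦu u x × (∀ j → 1 ≤ j → wtu u x j ≡ + wt D j)
    maps D P = x , encodes , encoded-outside u E , encoded-InΦu u E , encoded-weight u E
      where
        E = encoded u D P
        open Encoded E
    injective : ∀ D D′ x x′ → IsPipeDream u D → IsPipeDream u D′ →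
      encode D ≡ just x → encode D′ ≡ just x′ → x ≈[ μ u ] x′ → D ≡ D′
    injective D D′ x x′ P P′ eq eq′ = encoded-injective u (encoded u D P) (encoded u D′ P′) eq eq′
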